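{- Let $\lambda^{(1)}/\mu^{(1)},\dots,\lambda^{(n)}/\mu^{(n)}$ be $n$ skew shapes, let $\lambda=\bigcup_i\lambda^{(i)}$ be the partition obtained by arranging all parts of all $\lambda^{(i)}$ in weakly decreasing order, and similarly let $\mu=\bigcup_i\mu^{(i)}$. Then $$\prod_{i=1}^n s_{\lambda^{[i,n]}/\mu^{[i,n]}} - \prod_{i=1}^n s_{\lambda^{(i)}/\mu^{(i)}}$$ is Schur nonnegative.
   Context: A skew shape $\lambda/\mu$ is a pair of partitions (padded with zeros) with $\mu_i\le\lambda_i$ for all $i$; $s_{\lambda/\mu}$ is the skew Schur function. For a partition $\lambda$ and $1\le i\le n$, $\lambda^{[i,n]}:=(\lambda_i,\lambda_{i+n},\lambda_{i+2n},\dots)$. A symmetric function is Schur nonnegative if it is a nonnegative linear combination of Schur functions. -}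

module Defs where

open import Data.Nat using (ℕ; zero; suc; _+_; _*_; _∸_; _≤_; _≤?_; _⊓_; _≡ᵇ_; _≤ᵇ_)
open import Data.Bool using (Bool; true; false; _∧_; if_then_else_)
open import Data.Nat.ListAction using (sum)
open import Data.List using (List; []; _∷_; [_]; map; concatMap; filter; length; upTo; zipWith; foldr; _++_; tabulate)
open import Data.Fin using (Fin; toℕ)
open import Data.Product using (_×_; _,_; ∃)
open import Relation.Binary.PropositionalEquality using (_≡_)
open import Data.Unit using (⊤)

-- Partitions are lists of naturals, padded with zeros (trailing zeros allowed).

at : List ℕ → ℕ → ℕ
at []       _       = 0
at (x ∷ _)  zero    = x
at (_ ∷ xs) (suc j) = at xs j

IsPartition : List ℕ → Set
IsPartition xs = ∀ j → at xs (suc j) ≤ at xs j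

_⊆ₚ_ : List ℕ → List ℕ → Set
μ ⊆ₚ λ′ = ∀ j → at μ j ≤ at λ′ j

IsSkewShape : List ℕ → List ℕ → Set
IsSkewShape λ′ μ = IsPartition λ′ × IsPartition μ × μ ⊆ₚ λ′

padEqᵇ : List ℕ → List ℕ → Bool
padEqᵇ xs ys = foldr (λ j b → (at xs j ≡ᵇ at ys j) ∧ b) true (upTo (length xs + length ys))

insertDesc : ℕ → List ℕ → List ℕ
insertDesc x [] = x ∷ []
insertDesc x (y ∷ ys) = if y ≤ᵇ x then x ∷ y ∷ ys else y ∷ insertDesc x ys

sortDesc : List ℕ → List ℕ
sortDesc = foldr insertDesc []

unionP : List (List ℕ) → List ℕ
unionP ls = sortDesc (foldr _++_ [] ls)

-- λ^{[i,n]} = (λ_i, λ_{i+n}, λ_{i+2n}, ...) with the paper's 1-based i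
-- corresponding to the 0-based index (toℕ i) here; padded with zeros.
subseq : (n : ℕ) → Fin n → List ℕ → List ℕ
subseq n i xs = map (λ k → at xs (toℕ i + k * n)) (upTo (length xs))

-- Semistandard tableaux of shape λ/μ as chains of horizontal strips.

range : ℕ → ℕ → List ℕ
range a b = filter (λ k → a ≤? k) (upTo (suc b))

-- all κ (as lists of length (length λ)) with μ ⊆ κ ⊆ λ and κ/μ a horizontal
-- strip, i.e. μ_j ≤ κ_j ≤ min(λ_j, μ_{j-1})
stripsGen : List ℕ → List ℕ → ℕ → ℕ → List (List ℕ)
stripsGen μ []        j cap = [ [] ]
stripsGen μ (l ∷ ls)  j cap =
  concatMap (λ k → map (k ∷_) (stripsGen μ ls (suc j) (at μ j))) (range (at μ j) (l ⊓ cap))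

strips : List ℕ → List ℕ → ℕ → List (List ℕ)
strips λ′ μ a = filter (λ κ → sum κ Data.Nat.≟ (a + sum μ)) (stripsGen μ λ′ 0 (at λ′ 0))

-- kostka λ μ α = number of SSYT of shape λ/μ with content α
-- (α_1 entries equal to 1, α_2 entries equal to 2, ...)
kostka : List ℕ → List ℕ → List ℕ → ℕ
kostka λ′ μ []      = if padEqᵇ λ′ μ then 1 else 0
kostka λ′ μ (a ∷ α) = sum (map (λ κ → kostka λ′ κ α) (strips λ′ μ a))

-- Polynomials in m variables with ℕ coefficients, given by coefficient
-- functions on exponent vectors α ∈ ℕ^m (lists of length m; the number of
-- variables is the length of the exponent list).

Poly : Set
Poly = List ℕ → ℕ

skewSchur : List ℕ → List ℕ → Poly
skewSchur λ′ μ α = kostka λ′ μ α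

schur : List ℕ → Poly
schur ν = skewSchur ν []

below : List ℕ → List (List ℕ)
below []      = [ [] ]
below (a ∷ α) = concatMap (λ b → map (b ∷_) (below α)) (upTo (suc a))

onePoly : Poly
onePoly α = if foldr (λ a b → (a ≡ᵇ 0) ∧ b) true α then 1 else 0

_·_ : Poly → Poly → Poly
(f · g) α = sum (map (λ β → f β * g (zipWith _∸_ α β)) (below α))

prodP : List Poly → Poly
prodP = foldr _·_ onePoly

prodFin : (n : ℕ) → (Fin n → Poly) → Poly
prodFin n f = prodP (tabulate f)

schurComb : List (List ℕ × ℕ) → Poly
schurComb [] α = 0
schurComb ((ν , c) ∷ cs) α = c * schur ν α + schurComb cs α

AllPartitions : List (List ℕ × ℕ) → Set
AllPartitions [] = ⊤
AllPartitions ((ν , _) ∷ cs) = IsPartition ν × AllPartitions cs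

-- f - g is Schur nonnegative: f - g = Σ c_ν s_ν with c_ν ∈ ℕ, ν partitions,
-- as an identity of symmetric functions, i.e. in every number of variables.
SchurNonnegDiff : Poly → Poly → Set
SchurNonnegDiff f g = ∃ λ (cs : List (List ℕ × ℕ)) →
  AllPartitions cs × (∀ α → f α ≡ g α + schurComb cs α)

{-# OPTIONS --safe #-}
module Submission where

-- A semistandard tableau is a chain of shapes T t (the cells with entries
-- below t), so T t r is the length of row r of the t-th shape.
--
-- Two factors.  A pair (T , U) of tableaux is read column by column from right
-- to left and within a column from top to bottom, row r of T before row r of U,
-- except that an entry of U whose right neighbour is smaller than the entry of T
-- it would follow is read before that entry (and likewise with T and U
-- exchanged).  If the reading word is not a lattice word, the Bender–Knuth
-- reflection of the cells read after the first violation is a sign-reversing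
-- involution (as in Stembridge's proof of the Littlewood–Richardson rule), so
-- s_{λ/μ} s_{ν/ρ} is the sum of s_{wt(T,U)} over the lattice pairs.  Link two
-- adjacent positions (t , r) when exchanging the values of T and U at exactly
-- one of them would violate a tableau inequality; the sign of T − U is constant
-- along links.  Exchanging T and U on every component of the link graph that
-- meets a boundary position with T < U turns a lattice pair of shapes λ/μ, ν/ρ
-- into a lattice pair of shapes (λ∨ν)/(μ∨ρ), (λ∧ν)/(μ∧ρ) (componentwise maximum
-- and minimum).  It is injective because the links depend only on the unordered
-- pairs {T t r , U t r}.
--
-- Many factors.  Interleave the n shapes into one sequence.  Join and meet of
-- two consecutive shapes exchange simultaneously those pairs of adjacent terms
-- that are out of order; for the last shape and the first, one first prepends a
-- long row to the last.  Repeating this sorts the sequence, and the sorted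
-- sequence is the interleaving of the shapes λ^{[i,n]}/μ^{[i,n]}.

open import Defs
open import Data.Bool using (Bool; true; false; if_then_else_; not) renaming (_∧_ to _and_; T to IsTrue)
open import Data.Empty using (⊥; ⊥-elim)
open import Data.Fin as Fin using (Fin; toℕ)
import Data.Fin.Properties as Fin
open import Data.Integer as ℤ using (ℤ; 0ℤ; 1ℤ) renaming (_+_ to _⊕_; _*_ to _⊛_; -_ to ⊖_)
import Data.Integer.Properties as ℤ
import Data.Integer.Tactic.RingSolver as ℤSolver
open import Data.List using (List; []; _∷_; [_]; map; concatMap; filter; length; _++_; upTo; downFrom; applyUpTo; cartesianProduct; zipWith; foldr; replicate; tabulate)
open import Data.List.Membership.Propositional using (_∈_; _∉_; find; lose)
open import Data.List.Membership.Propositional.Properties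
open import Data.List.Membership.Propositional.Properties.WithK using (unique∧set⇒bag)
open import Data.List.Properties using (length-map; length-++; length-applyUpTo; length-replicate; map-++; map-∘; map-cong; map-upTo; tabulate-cong; ++-assoc; ++-identityʳ) renaming (≡-dec to List-≡-dec)
open import Data.List.Relation.Binary.BagAndSetEquality using (∼bag⇒↭)
open import Data.List.Relation.Binary.Permutation.Propositional as ↭ using (_↭_; ↭-sym)
import Data.List.Relation.Binary.Permutation.Propositional.Properties as ↭
open import Data.List.Relation.Unary.All as All using (All; []; _∷_; all?)
import Data.List.Relation.Unary.All.Properties as All
open import Data.List.Relation.Unary.AllPairs as AllPairs using (AllPairs; []; _∷_)
import Data.List.Relation.Unary.AllPairs.Properties as AllPairs
open import Data.List.Relation.Unary.Any as Any using (Any; here; there; any?)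
open import Data.List.Relation.Unary.Unique.Propositional using (Unique)
import Data.List.Relation.Unary.Unique.Propositional.Properties as Unique
open import Data.Nat as ℕ
open import Data.Nat.Divisibility using (divides-refl)
open import Data.Nat.DivMod
open import Data.Nat.Induction using (<-wellFounded)
open import Data.Nat.ListAction using (sum)
open import Data.Nat.ListAction.Properties using (sum-++; sum-↭)
open import Data.Nat.Properties as ℕ
open import Data.Nat.Tactic.RingSolver using (solve-∀)
open import Data.Product using (_×_; _,_; proj₁; proj₂; ∃)
open import Data.Product.Properties using (≡-dec)
open import Data.Sum using (_⊎_; inj₁; inj₂)
open import Data.Unit using (⊤; tt)
open import Function using (_∘_; id; flip; mk⇔)
open import Induction.WellFounded using (Acc; acc)
open import Relation.Binary.Definitions using (Tri; tri<; tri≈; tri>)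
open import Relation.Binary.PropositionalEquality hiding ([_])
open import Relation.Nullary using (¬_; Dec; yes; no; does)
open import Relation.Nullary.Decidable using (_×-dec_; _⊎-dec_; _→-dec_; ¬?; dec-true; dec-false)
open import Relation.Nullary.Reflects using (ofʸ; ofⁿ)

-- Shapes and partial Bender–Knuth reflections

-- Schur expansions are obtained without dividing by a Vandermonde determinant: a coefficient
-- function is paired with all functions alternating in the shifted exponents, and a bounded
-- symmetric function orthogonal to all of them vanishes (`alternating-vanish`). Reflections fit
-- this pairing because the cells kept at a violation contain exactly one `k + 1` too many: the
-- weights `(a , b)` of `k` and `k + 1` become `(b - 1 , a + 1)`, a transposition of shifted
-- exponents.
--
-- The exception in the reading order is dictated by the partial reflection. An entry `k` with right
-- neighbour `k` cannot become `k + 1` while the columns to its right stay fixed, so it has to count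
-- as already read.
--
-- Ties within a row go to `T` because the exchange leaves the larger value in the first tableau. A
-- violation that survives an exchange is then either unaffected or a strict one that came from a
-- weak one with the roles of `T` and `U` reversed, and the weak one was excluded as well.

∑ : ℕ → (ℕ → ℕ) → ℕ
∑ zero    f = 0
∑ (suc n) f = ∑ n f + f n

∑-cong : ∀ n {f g : ℕ → ℕ} → (∀ r → f r ≡ g r) → ∑ n f ≡ ∑ n g
∑-cong zero    e = refl
∑-cong (suc n) e = cong₂ _+_ (∑-cong n e) (e n)

∑-+ : ∀ n (f g : ℕ → ℕ) → ∑ n (λ r → f r + g r) ≡ ∑ n f + ∑ n g
∑-+ zero    f g = refl
∑-+ (suc n) f g rewrite ∑-+ n f g = swap (∑ n f) (∑ n g) (f n) (g n)
  where
  swap : ∀ a b c d → a + b + (c + d) ≡ a + c + (b + d)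
  swap = solve-∀

∑-mono : ∀ n {f g : ℕ → ℕ} → (∀ r → f r ≤ g r) → ∑ n f ≤ ∑ n g
∑-mono zero    e = z≤n
∑-mono (suc n) e = +-mono-≤ (∑-mono n e) (e n)

∑-zero : ∀ n {f : ℕ → ℕ} → (∀ r → f r ≡ 0) → ∑ n f ≡ 0
∑-zero zero    e = refl
∑-zero (suc n) e rewrite ∑-zero n e = e n

record Shape (R : ℕ) (f : ℕ → ℕ) : Set where
  field
    anti : ∀ r → f (suc r) ≤ f r
    null : ∀ r → R ≤ r → f r ≡ 0

antitone : ∀ {f : ℕ → ℕ} → (∀ r → f (suc r) ≤ f r) → ∀ {r r′} → r ≤ r′ → f r′ ≤ f r
antitone {f} an {r} {r′} le = go (≤⇒≤′ le)
  where
  go : ∀ {r′} → r ≤′ r′ → f r′ ≤ f r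
  go ≤′-refl       = ≤-refl
  go (≤′-step le′) = ≤-trans (an _) (go le′)

-- The number of cells in the columns `c`, `c + 1`, ..., columns being counted from 0.
S : ℕ → (ℕ → ℕ) → ℕ → ℕ
S R f c = ∑ R (λ r → f r ∸ c)

-- H R f c is the number of rows of length greater than c, that is, the length of column c.
H : ℕ → (ℕ → ℕ) → ℕ → ℕ
H zero    f c = 0
H (suc R) f c with c <? f R
... | yes _ = suc R
... | no  _ = H R f c

H-below : ∀ R {f} → (∀ r → f (suc r) ≤ f r) → ∀ {c r} → r < H R f c → c < f r
H-below (suc R) {f} an {c} {r} lt with c <? f R
... | yes c<f = ≤-trans c<f (antitone an (≤-pred lt))
... | no  _   = H-below R an lt

H-above : ∀ R {f} → Shape R f → ∀ {c r} → H R f c ≤ r → f r ≤ c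
H-above R {f} sh {c} {r} le with R ≤? r
... | yes R≤r rewrite Shape.null sh r R≤r = z≤n
... | no  R≰r = go R (≰⇒> R≰r) le
  where
  go : ∀ n → r < n → H n f c ≤ r → f r ≤ c
  go (suc n) r<n h with c <? f n
  ... | yes _ = ⊥-elim (<-irrefl refl (≤-trans r<n h))
  ... | no  ¬p with r ≟ n
  ...   | yes refl = ≮⇒≥ ¬p
  ...   | no  r≢n  = go n (≤∧≢⇒< (≤-pred r<n) r≢n) h

H-unique : ∀ R {f} → Shape R f → ∀ {c h} → (∀ {r} → r < h → c < f r) → f h ≤ c → H R f c ≡ h
H-unique R {f} sh {c} {h} below above = ≤-antisym
  (≮⇒≥ λ h<H → <-irrefl refl (≤-trans (H-below R (Shape.anti sh) h<H) above))
  (≮⇒≥ λ H<h → <-irrefl refl (≤-trans (below H<h) (H-above R sh ≤-refl)))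

H-mono : ∀ R {f g} → Shape R f → Shape R g → (∀ r → f r ≤ g r) → ∀ c → H R f c ≤ H R g c
H-mono R {f} {g} shf shg le c = ≮⇒≥ λ lt →
  <-irrefl refl (≤-trans (H-below R (Shape.anti shf) lt) (≤-trans (le _) (H-above R shg ≤-refl)))

H-strip : ∀ R {f g} → Shape R f → Shape R g → (∀ r → g (suc r) ≤ f r) → ∀ c → H R g c ≤ suc (H R f c)
H-strip R {f} {g} shf shg le c = ≮⇒≥ λ lt →
  <-irrefl refl (≤-trans (H-below R (Shape.anti shg) lt) (≤-trans (le _) (H-above R shf ≤-refl)))

H-next : ∀ R {f} → Shape R f → ∀ c → H R f (suc c) ≤ H R f c
H-next R {f} sh c = ≮⇒≥ λ lt →
  <-irrefl refl (≤-trans (H-below R (Shape.anti sh) lt) (≤-trans (H-above R sh ≤-refl) (n≤1+n _)))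

H-cong : ∀ R {f g} → Shape R f → Shape R g → ∀ {c} →
  (∀ r → c < f r → c < g r) → (∀ r → c < g r → c < f r) → H R f c ≡ H R g c
H-cong R {f} {g} shf shg {c} to from = H-unique R shf
  (λ lt → from _ (H-below R (Shape.anti shg) lt))
  (≮⇒≥ λ lt → <-irrefl refl (≤-trans (to _ lt) (H-above R shg ≤-refl)))

S-step : ∀ R {f} → (∀ r → f (suc r) ≤ f r) → ∀ c → S R f c ≡ S R f (suc c) + H R f c
S-step zero    an c = refl
S-step (suc R) {f} an c with c <? f R
... | yes c<f = full (suc R) (λ r lt → ≤-trans c<f (antitone an (≤-pred lt)))
  where
  one : ∀ x → c < x → x ∸ c ≡ suc (x ∸ suc c)
  one x lt = +-∸-assoc 1 {x} {suc c} lt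
  arith : ∀ a b n → a + n + suc b ≡ a + b + suc n
  arith = solve-∀
  full : ∀ n → (∀ r → r < n → c < f r) → S n f c ≡ S n f (suc c) + n
  full zero    _ = refl
  full (suc n) h rewrite full n (λ r lt → h r (m<n⇒m<1+n lt)) | one (f n) (h n ≤-refl) =
    arith (S n f (suc c)) (f n ∸ suc c) n
... | no ¬p rewrite m≤n⇒m∸n≡0 (≮⇒≥ ¬p) | m≤n⇒m∸n≡0 (m≤n⇒m≤1+n (≮⇒≥ ¬p)) | S-step R an c =
  trans (+-identityʳ _) (cong (_+ H R f c) (sym (+-identityʳ (S R f (suc c)))))

record Chain (R : ℕ) (T : ℕ → ℕ → ℕ) : Set where
  field
    mono  : ∀ t r → T t r ≤ T (suc t) r
    strip : ∀ t r → T (suc t) (suc r) ≤ T t r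
    null  : ∀ t r → R ≤ r → T t r ≡ 0

  shape : ∀ t → Shape R (T t)
  shape t = record { anti = λ r → ≤-trans (mono t (suc r)) (strip t r) ; null = null t }

  anti : ∀ t r → T t (suc r) ≤ T t r
  anti t = Shape.anti (shape t)

  H-grow : ∀ t c → H R (T t) c ≤ H R (T (suc t)) c
  H-grow t = H-mono R (shape t) (shape (suc t)) (mono t)

  H-grow₁ : ∀ t c → H R (T (suc t)) c ≤ suc (H R (T t) c)
  H-grow₁ t = H-strip R (shape t) (shape (suc t)) (strip t)

upd : (ℕ → ℕ → ℕ) → ℕ → (ℕ → ℕ) → ℕ → ℕ → ℕ
upd T n M t r with t ≟ n
... | yes _ = M r
... | no  _ = T t r

upd-at : ∀ T n M r → upd T n M n r ≡ M r
upd-at T n M r with n ≟ n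
... | yes _ = refl
... | no ne = ⊥-elim (ne refl)

upd-off : ∀ T n M {t} → t ≢ n → ∀ r → upd T n M t r ≡ T t r
upd-off T n M {t} ne r with t ≟ n
... | yes e = ⊥-elim (ne e)
... | no  _ = refl

module Layer (T : ℕ → ℕ → ℕ) (k : ℕ) where

  -- Between fixed outer shapes the middle one can be chosen row by row, anywhere from `lo r` to
  -- `hi r`. The free entries of row `r` fill the columns between these two values, and a
  -- Bender-Knuth move reverses each such interval.
  lo hi : ℕ → ℕ
  lo r = T k r ⊔ T (2 + k) (suc r)
  hi zero    = T (2 + k) zero
  hi (suc r) = T (2 + k) (suc r) ⊓ T k r

  hi≤ : ∀ r → hi r ≤ T (2 + k) r
  hi≤ zero    = ≤-refl
  hi≤ (suc r) = m⊓n≤m _ _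

  -- The middle layer of a Bender–Knuth involution applied to the cells in columns < c only.
  refl-row : ℕ → ℕ → ℕ
  refl-row c r with lo r <? c
  ... | yes _ = (lo r + (hi r ⊓ c)) ∸ T (suc k) r
  ... | no  _ = T (suc k) r

  -- In a row whose free interval begins left of column `c`, no entry `k` lies at or beyond `c`.
  -- Reversing the part of the interval left of `c` then agrees with the part that is kept.
  Good : ℕ → Set
  Good c = ∀ r → lo r < c → T (suc k) r ≤ c

  bk : ℕ → ℕ → ℕ → ℕ
  bk c = upd T (suc k) (refl-row c)

  lo≤hi⇒Chain : ∀ {R} → Chain R T → (M : ℕ → ℕ) → (∀ r → lo r ≤ M r) → (∀ r → M r ≤ hi r) →
    Chain R (upd T (suc k) M)
  lo≤hi⇒Chain {R} ch M l h = record { mono = mn ; strip = st ; null = nl }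
    where
    open Chain ch
    mn : ∀ t r → upd T (suc k) M t r ≤ upd T (suc k) M (suc t) r
    mn t r with t ≟ suc k | suc t ≟ suc k
    ... | yes refl | no _     = ≤-trans (h r) (hi≤ r)
    ... | no _     | yes refl = ≤-trans (m≤m⊔n _ _) (l r)
    ... | no _     | no _     = mono t r
    st : ∀ t r → upd T (suc k) M (suc t) (suc r) ≤ upd T (suc k) M t r
    st t r with t ≟ suc k | suc t ≟ suc k
    ... | yes refl | no _     = ≤-trans (m≤n⊔m (T k r) _) (l r)
    ... | no _     | yes refl = ≤-trans (h (suc r)) (m⊓n≤n (T (2 + k) (suc r)) _)
    ... | no _     | no _     = strip t r
    nl : ∀ t r → R ≤ r → upd T (suc k) M t r ≡ 0
    nl t r le with t ≟ suc k
    ... | yes _ = n≤0⇒n≡0 (≤-trans (h r) (≤-trans (hi≤ r) (≤-reflexive (null (2 + k) r le))))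
    ... | no  _ = null t r le

  module _ {R} (ch : Chain R T) where
    open Chain ch

    lo≤mid : ∀ r → lo r ≤ T (suc k) r
    lo≤mid r = ⊔-lub (mono k r) (strip (suc k) r)

    mid≤hi : ∀ r → T (suc k) r ≤ hi r
    mid≤hi zero    = mono (suc k) zero
    mid≤hi (suc r) = ⊓-glb (mono (suc k) (suc r)) (strip k r)

    module _ {c} (good : Good c) where

      private
        mid≤ : ∀ r → lo r < c → T (suc k) r ≤ hi r ⊓ c
        mid≤ r lt = ⊓-glb (mid≤hi r) (good r lt)

        flip≤ : ∀ a b x → a ≤ x → x ≤ b → (a + b) ∸ x ≤ b
        flip≤ a b x a≤x x≤b = ≤-trans (∸-monoʳ-≤ (a + b) a≤x) (≤-reflexive (m+n∸m≡n a b))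

        flip≥ : ∀ a b x → x ≤ b → a ≤ (a + b) ∸ x
        flip≥ a b x x≤b = ≤-trans (≤-reflexive (sym (m+n∸n≡m a b))) (∸-monoʳ-≤ (a + b) x≤b)

      refl-lo : ∀ r → lo r ≤ refl-row c r
      refl-lo r with lo r <? c
      ... | yes p = flip≥ (lo r) _ _ (mid≤ r p)
      ... | no  _ = lo≤mid r

      refl-hi : ∀ r → refl-row c r ≤ hi r
      refl-hi r with lo r <? c
      ... | yes p = ≤-trans (flip≤ (lo r) _ _ (lo≤mid r) (mid≤ r p)) (m⊓n≤m _ _)
      ... | no  _ = mid≤hi r

      bk-chain : Chain R (bk c)
      bk-chain = lo≤hi⇒Chain ch (refl-row c) refl-lo refl-hi

      refl-same : ∀ r {c′} → c ≤ c′ → refl-row c r ≡ T (suc k) r ⊎ (refl-row c r ≤ c′ × T (suc k) r ≤ c′)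
      refl-same r c≤ with lo r <? c
      ... | yes p = inj₂ (≤-trans (≤-trans (flip≤ (lo r) _ _ (lo≤mid r) (mid≤ r p)) (m⊓n≤n (hi r) c)) c≤
                         , ≤-trans (good r p) c≤)
      ... | no  _ = inj₁ refl

      refl-H : ∀ {c′} → c ≤ c′ → ∀ t → H R (bk c t) c′ ≡ H R (T t) c′
      refl-H {c′} c≤ t = H-cong R (Chain.shape bk-chain t) (shape t) to from
        where
        to : ∀ r → c′ < bk c t r → c′ < T t r
        to r lt with t ≟ suc k
        ... | no _ = lt
        ... | yes refl with refl-same r c≤
        ...   | inj₁ e = subst (c′ <_) e lt
        ...   | inj₂ (a , b) = ⊥-elim (<-irrefl refl (≤-trans lt a))
        from : ∀ r → c′ < T t r → c′ < bk c t r
        from r lt with t ≟ suc k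
        ... | no _ = lt
        ... | yes refl with refl-same r c≤
        ...   | inj₁ e = subst (c′ <_) (sym e) lt
        ...   | inj₂ (a , b) = ⊥-elim (<-irrefl refl (≤-trans lt b))

      refl-S : ∀ {c′} → c ≤ c′ → ∀ t → S R (bk c t) c′ ≡ S R (T t) c′
      refl-S {c′} c≤ t = ∑-cong R λ r → go r
        where
        go : ∀ r → bk c t r ∸ c′ ≡ T t r ∸ c′
        go r with t ≟ suc k
        ... | no _ = refl
        ... | yes refl with refl-same r c≤
        ...   | inj₁ e = cong (_∸ c′) e
        ...   | inj₂ (a , b) = trans (m≤n⇒m∸n≡0 a) (sym (m≤n⇒m∸n≡0 b))

      private
        row-sum : ∀ r → refl-row c r + T (suc k) r ≡
                        (T (suc k) r ∸ c) + (T (suc k) r ∸ c) + ((lo r ⊓ c) + (hi r ⊓ c))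
        row-sum r with lo r <? c
        ... | yes p rewrite m≤n⇒m∸n≡0 (good r p) | m≤n⇒m⊓n≡m (<⇒≤ p) =
          m∸n+n≡m (≤-trans (mid≤ r p) (m≤n+m _ (lo r)))
        ... | no ¬p rewrite m≥n⇒m⊓n≡n (≮⇒≥ ¬p)
                          | m≥n⇒m⊓n≡n (≤-trans (≮⇒≥ ¬p) (≤-trans (lo≤mid r) (mid≤hi r))) =
          trans (cong₂ _+_ e e) (swap (T (suc k) r ∸ c) c)
          where
          e : T (suc k) r ≡ (T (suc k) r ∸ c) + c
          e = sym (m∸n+n≡m (≤-trans (≮⇒≥ ¬p) (lo≤mid r)))
          swap : ∀ x y → x + y + (x + y) ≡ x + x + (y + y)
          swap = solve-∀

        max-min : ∀ p q → (p ⊔ q) ⊓ c + (q ⊓ p) ⊓ c ≡ (p ⊓ c) + (q ⊓ c)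
        max-min p q with ≤-total p q
        ... | inj₁ le rewrite m≤n⇒m⊔n≡n le | m≥n⇒m⊓n≡n le = +-comm (q ⊓ c) (p ⊓ c)
        ... | inj₂ le rewrite m≥n⇒m⊔n≡m le | m≤n⇒m⊓n≡m le = refl

        -- The `lo` of a row and the `hi` of the next row are the maximum and the minimum of the
        -- same two numbers, so the sum telescopes; the unmatched `hi n` is carried along.
        telescope : ∀ n → ∑ n (λ r → (lo r ⊓ c) + (hi r ⊓ c)) + (hi n ⊓ c)
                        ≡ ∑ n (λ r → (T k r ⊓ c)) + ∑ n (λ r → T (2 + k) r ⊓ c) + (T (2 + k) n ⊓ c)
        telescope zero = refl
        telescope (suc n) = trans (ar₁ (∑ n _) (lo n ⊓ c) (hi n ⊓ c) (hi (suc n) ⊓ c))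
          (trans (cong₂ _+_ (telescope n) (max-min (T k n) (T (2 + k) (suc n))))
                 (ar₂ (∑ n (λ r → (T k r ⊓ c))) (∑ n (λ r → T (2 + k) r ⊓ c)) (T (2 + k) n ⊓ c) (T k n ⊓ c) (T (2 + k) (suc n) ⊓ c)))
          where
          ar₁ : ∀ s l h h′ → s + (l + h) + h′ ≡ (s + h) + (l + h′)
          ar₁ = solve-∀
          ar₂ : ∀ p q x y z → p + q + x + (y + z) ≡ p + y + (q + x) + z
          ar₂ = solve-∀

        split : ∀ (f : ℕ → ℕ) → ∑ R f ≡ ∑ R (λ r → f r ⊓ c) + S R f c
        split f = trans (∑-cong R (λ r → sym (m⊓n+n∸m≡n c (f r)))) (trans (∑-cong R (λ r → cong (_+ (f r ∸ c)) (⊓-comm c (f r)))) (∑-+ R _ _))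

      -- Left of column `c` the reflection interchanges the numbers of entries `k` and `k + 1`; the
      -- `S` terms take the kept columns out of this balance.
      bk-sum : ∑ R (bk c (suc k)) + ∑ R (T (suc k)) + (S R (T k) c + S R (T (2 + k)) c)
             ≡ ∑ R (T k) + ∑ R (T (2 + k)) + (S R (T (suc k)) c + S R (T (suc k)) c)
      bk-sum = begin
        ∑ R (bk c (suc k)) + ∑ R (T (suc k)) + (A + C)
          ≡⟨ cong (λ z → z + ∑ R (T (suc k)) + (A + C)) (∑-cong R (upd-at T (suc k) (refl-row c))) ⟩
        ∑ R (refl-row c) + ∑ R (T (suc k)) + (A + C)
          ≡⟨ cong (_+ (A + C)) (trans (sym (∑-+ R _ _)) (∑-cong R row-sum)) ⟩
        ∑ R (λ r → (T (suc k) r ∸ c) + (T (suc k) r ∸ c) + ((lo r ⊓ c) + (hi r ⊓ c))) + (A + C)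
          ≡⟨ cong (_+ (A + C)) (trans (∑-+ R _ _) (cong₂ _+_ (∑-+ R _ _) tele)) ⟩
        B + B + (∑ R (λ r → (T k r ⊓ c)) + ∑ R (λ r → T (2 + k) r ⊓ c)) + (A + C)
          ≡⟨ ar B (∑ R (λ r → T k r ⊓ c)) (∑ R (λ r → T (2 + k) r ⊓ c)) A C ⟩
        (∑ R (λ r → T k r ⊓ c) + A) + (∑ R (λ r → T (2 + k) r ⊓ c) + C) + (B + B)
          ≡⟨ sym (cong (_+ (B + B)) (cong₂ _+_ (split (T k)) (split (T (2 + k))))) ⟩
        ∑ R (T k) + ∑ R (T (2 + k)) + (B + B) ∎
        where
        open ≡-Reasoning
        A = S R (T k) c
        B = S R (T (suc k)) c
        C = S R (T (2 + k)) c
        ar : ∀ b p q a c → b + b + (p + q) + (a + c) ≡ (p + a) + (q + c) + (b + b)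
        ar = solve-∀
        tele : ∑ R (λ r → (lo r ⊓ c) + (hi r ⊓ c)) ≡ ∑ R (λ r → (T k r ⊓ c)) + ∑ R (λ r → T (2 + k) r ⊓ c)
        tele = +-cancelʳ-≡ 0 _ _ (subst₂ (λ x y → ∑ R (λ r → (lo r ⊓ c) + (hi r ⊓ c)) + x ≡
                 ∑ R (λ r → (T k r ⊓ c)) + ∑ R (λ r → T (2 + k) r ⊓ c) + y) e₁ e₂ (telescope R))
          where
          e₂ : T (2 + k) R ⊓ c ≡ 0
          e₂ rewrite null (2 + k) R ≤-refl = refl
          e₁ : hi R ⊓ c ≡ 0
          e₁ = n≤0⇒n≡0 (≤-trans (⊓-monoˡ-≤ c (hi≤ R)) (≤-reflexive e₂))

-- The reflection only depends on the outer layers, so it undoes itself.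
module _ (T T′ : ℕ → ℕ → ℕ) (k c : ℕ) where
  private
    module L = Layer T k
    module L′ = Layer T′ k

  lo-cong : (∀ r → T′ k r ≡ T k r) → (∀ r → T′ (2 + k) r ≡ T (2 + k) r) → ∀ r → L′.lo r ≡ L.lo r
  lo-cong e e″ r = cong₂ _⊔_ (e r) (e″ (suc r))

  hi-cong : (∀ r → T′ k r ≡ T k r) → (∀ r → T′ (2 + k) r ≡ T (2 + k) r) → ∀ r → L′.hi r ≡ L.hi r
  hi-cong e e″ zero    = e″ zero
  hi-cong e e″ (suc r) = cong₂ _⊓_ (e″ (suc r)) (e r)

module _ {R T} (ch : Chain R T) (k c : ℕ) (good : Layer.Good T k c) where
  private
    module L = Layer T k
    T′ = L.bk c
    module L′ = Layer T′ k

    e₀ : ∀ r → T′ k r ≡ T k r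
    e₀ = upd-off T (suc k) _ (λ ())
    e₂ : ∀ r → T′ (2 + k) r ≡ T (2 + k) r
    e₂ = upd-off T (suc k) _ (λ ())

  bk-invol : ∀ t r → L′.bk c t r ≡ T t r
  bk-invol t r with t ≟ suc k
  ... | no ne = upd-off T (suc k) _ ne r
  ... | yes refl = go
    where
    go : L′.refl-row c r ≡ T (suc k) r
    go with L′.lo r <? c
    ... | no ¬p = trans (upd-at T (suc k) _ r) (go′ (λ p → ¬p (subst (_< c) (sym (lo-cong T T′ k c e₀ e₂ r)) p)))
      where
      go′ : ¬ (L.lo r < c) → L.refl-row c r ≡ T (suc k) r
      go′ ¬q with L.lo r <? c
      ... | yes q = ⊥-elim (¬q q)
      ... | no  _ = refl
    ... | yes p = trans (cong₂ _∸_ (cong₂ (λ a b → a + b ⊓ c) (lo-cong T T′ k c e₀ e₂ r) (hi-cong T T′ k c e₀ e₂ r)) (upd-at T (suc k) _ r)) (go′ (subst (_< c) (lo-cong T T′ k c e₀ e₂ r) p))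
      where
      go′ : L.lo r < c → (L.lo r + (L.hi r ⊓ c)) ∸ L.refl-row c r ≡ T (suc k) r
      go′ q with L.lo r <? c
      ... | no ¬q = ⊥-elim (¬q q)
      ... | yes _ = m∸[m∸n]≡n (≤-trans (⊓-glb (L.mid≤hi ch r) (good r q)) (m≤n+m _ (L.lo r)))

-- Violations of the lattice condition

-- A column (of either tableau) is recorded by its heights over time; between consecutive times
-- it grows by at most one cell.
Steps : (ℕ → ℕ) → Set
Steps b = ∀ t → b t ≤ b (suc t) × b (suc t) ≤ suc (b t)

-- The column contains `k + 1` but not `k`, an entry `k` being a cell added between times `k` and
-- `k + 1`.
Flat : (ℕ → ℕ) → ℕ → Set
Flat a k = a (suc k) ≡ a k × a (2 + k) ≡ suc (a k)

-- As many entries `k` as `k + 1` among the cells counted by `s`.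
Balanced : (ℕ → ℕ) → ℕ → Set
Balanced s k = s k + s (2 + k) ≡ s (suc k) + s (suc k)

module Events (_◁_ : ℕ → ℕ → Set) where

  -- A violation at a single cell. `a` is its column, `b` and `b⁺` are the same column and the next
  -- one to the right in the other tableau, and `s` counts everything further right. The `k + 1` in
  -- row `a k` overshoots a balanced prefix. `other` makes a lone `k` or `k + 1` of column `b` come
  -- later in the reading: its row does not precede, and its right neighbour is not `k` or smaller.
  record E (k : ℕ) (a b b⁺ s : ℕ → ℕ) : Set where
    constructor mkE
    field
      flat  : Flat a k
      bal   : Balanced s k
      other : b (2 + k) ≡ suc (b k) → (a k ◁ b k) × b⁺ (suc k) ≤ b k

  E-cong : ∀ {k a b b⁺ s a′ b′ b⁺′ s′} → (∀ t → a t ≡ a′ t) → b k ≡ b′ k → b (2 + k) ≡ b′ (2 + k) →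
    (∀ t → b⁺ t ≡ b⁺′ t) → (∀ t → s t ≡ s′ t) → E k a b b⁺ s → E k a′ b′ b⁺′ s′
  E-cong {k} ea eb eb₂ eb⁺ es (mkE f l o)
    rewrite ea k | ea (suc k) | ea (2 + k) | eb | eb₂ | eb⁺ (suc k) | es k | es (suc k) | es (2 + k) = mkE f l o

  E? : (∀ x y → Dec (x ◁ y)) → ∀ k a b b⁺ s → Dec (E k a b b⁺ s)
  E? ◁? k a b b⁺ s with ((a (suc k) ≟ a k) ×-dec (a (2 + k) ≟ suc (a k)))
                       ×-dec ((s k + s (2 + k) ≟ s (suc k) + s (suc k))
                       ×-dec ((b (2 + k) ≟ suc (b k)) →-dec (◁? (a k) (b k) ×-dec (b⁺ (suc k) ≤? b k))))
  ... | yes (f , l , o) = yes (mkE f l o)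
  ... | no ¬p = no λ e → ¬p (E.flat e , E.bal e , E.other e)

open Events using (mkE)
module ET = Events _≤_
module EU = Events _<_

-- Both columns contain `k + 1` without `k`, and the columns to the right have one surplus `k`, so
-- the count is violated only once both are read. The cut then falls between two columns instead of
-- inside one.
record E2 (k : ℕ) (a b s : ℕ → ℕ) : Set where
  constructor mkE2
  field
    flatˡ : Flat a k
    flatʳ : Flat b k
    one   : suc (s k + s (2 + k)) ≡ s (suc k) + s (suc k)

E2-cong : ∀ {k a b s a′ b′ s′} → (∀ t → a t ≡ a′ t) → b k ≡ b′ k → b (suc k) ≡ b′ (suc k) →
  b (2 + k) ≡ b′ (2 + k) → (∀ t → s t ≡ s′ t) → E2 k a b s → E2 k a′ b′ s′
E2-cong {k} ea e₀ e₁ e₂ es (mkE2 f g l)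
  rewrite ea k | ea (suc k) | ea (2 + k) | e₀ | e₁ | e₂ | es k | es (suc k) | es (2 + k) = mkE2 f g l

E2-sym : ∀ {k a b s} → E2 k a b s → E2 k b a s
E2-sym (mkE2 f g l) = mkE2 g f l

E2? : ∀ k a b s → Dec (E2 k a b s)
E2? k a b s with ((a (suc k) ≟ a k) ×-dec (a (2 + k) ≟ suc (a k)))
                 ×-dec (((b (suc k) ≟ b k) ×-dec (b (2 + k) ≟ suc (b k)))
                 ×-dec (suc (s k + s (2 + k)) ≟ s (suc k) + s (suc k)))
... | yes (f , g , l) = yes (mkE2 f g l)
... | no ¬p = no λ e → ¬p (E2.flatˡ e , E2.flatʳ e , E2.one e)

-- Reflecting a tail at an event changes column c of the other tableau at time k + 1 only, and then
-- only affects events of larger rank.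
module Stability (_◁_ _◁′_ : ℕ → ℕ → Set) (f g : ℕ → ℕ)
  (◁⇒ : ∀ {x y} → x ◁ y → f x < g y) (g-mono : ∀ {x y} → x ≤ y → g x ≤ g y)
  {k : ℕ} {a b b⁺ s b′ : ℕ → ℕ} (stb : Steps b) (stb′ : Steps b′)
  (off : ∀ t → t ≢ suc k → b′ t ≡ b t) where

  private
    module M = Events _◁_
    module M′ = Events _◁′_

    not₁ : M.E k a b b⁺ s → ∀ {k′} → Flat a k′ → k′ ≢ suc k
    not₁ e (p , q) refl = 1+n≢n (trans (sym (proj₂ (M.E.flat e))) (trans p (proj₁ (M.E.flat e))))

    not₂ : M.E k a b b⁺ s → ∀ {k′} → Flat a k′ → suc k′ ≢ k
    not₂ e (p , q) refl = 1+n≢n (trans (sym q) (trans (proj₁ (M.E.flat e)) p))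

  same : M.E k a b b⁺ s → ∀ {k′} → M.E k′ a b′ b⁺ s → M.E k′ a b b⁺ s
  same e {k′} e′ = M.E-cong (λ _ → refl) (off k′ (not₁ e (M.E.flat e′)))
    (off (2 + k′) (λ eq → not₂ e (M.E.flat e′) (suc-injective eq))) (λ _ → refl) (λ _ → refl) e′

  two : M.E k a b b⁺ s → ∀ {k′} → E2 k′ a b′ s → E2 k′ a b s
  two e {k′} e′ = E2-cong (λ _ → refl) (off k′ (not₁ e (E2.flatˡ e′))) (off (suc k′) not₀)
    (off (2 + k′) (λ eq → not₂ e (E2.flatˡ e′) (suc-injective eq))) (λ _ → refl) e′
    where
    not₀ : suc k′ ≢ suc k
    not₀ refl = 1+n≢n (trans (E2.one e′) (sym (M.E.bal e)))

  -- If the reflection really alters the other column, this column holds exactly one of `k` and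
  -- `k + 1`, hence `a k ◁ b k`. An opposite event of rank at most that of the given one therefore
  -- has `b′ k′ < b k`, and then none of the times at which it inspects its column is `k + 1`.
  opp : M.E k a b b⁺ s → ∀ {k′ a⁺} → g (b′ k′) ≤ f (a k) → M′.E k′ b′ a a⁺ s → M′.E k′ b a a⁺ s
  opp e {k′} {a⁺} le e′ with b′ (suc k) ≟ b (suc k)
  ... | yes eq = M′.E-cong same-b refl refl (λ _ → refl) (λ _ → refl) e′
    where
    same-b : ∀ t → b′ t ≡ b t
    same-b t with t ≟ suc k
    ... | yes refl = eq
    ... | no ne = off t ne
  ... | no ne = transport e′
    where
    bk₀ : b′ k ≡ b k
    bk₀ = off k (λ ())
    bk₂ : b′ (2 + k) ≡ b (2 + k)
    bk₂ = off (2 + k) (λ ())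
    up : suc (b k) ≤ b (2 + k)
    up with b k <? b (suc k)
    ... | yes p = ≤-trans p (proj₁ (stb (suc k)))
    ... | no ¬p with b k <? b′ (suc k)
    ...   | yes q = ≤-trans q (≤-trans (proj₁ (stb′ (suc k))) (≤-reflexive bk₂))
    ...   | no ¬q = ⊥-elim (ne (trans (≤-antisym (≮⇒≥ ¬q) (≤-trans (≤-reflexive (sym bk₀)) (proj₁ (stb′ k))))
                                       (≤-antisym (proj₁ (stb k)) (≮⇒≥ ¬p))))
    down : b (2 + k) ≤ suc (b k)
    down with b (suc k) ≤? b k
    ... | yes p = ≤-trans (proj₂ (stb (suc k))) (s≤s p)
    ... | no ¬p with b′ (suc k) ≤? b k
    ...   | yes q = ≤-trans (≤-reflexive (sym bk₂)) (≤-trans (proj₂ (stb′ (suc k))) (s≤s q))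
    ...   | no ¬q = ⊥-elim (ne (trans (≤-antisym (≤-trans (proj₂ (stb′ k)) (s≤s (≤-reflexive bk₀))) (≰⇒> ¬q))
                                       (≤-antisym (≰⇒> ¬p) (proj₂ (stb k)))))
    a◁b : a k ◁ b k
    a◁b = proj₁ (M.E.other e (≤-antisym down up))
    bound : ∀ {x} → b k ≤ x → f (a k) < g x
    bound p = ≤-trans (◁⇒ a◁b) (g-mono p)
    clash : b k ≤ b′ k′ → ⊥
    clash p = <-irrefl refl (≤-trans (bound p) le)
    transport : M′.E k′ b′ a a⁺ s → M′.E k′ b a a⁺ s
    transport ev@(mkE (p , q) l o) with k′ ≟ suc k
    ... | yes refl = ⊥-elim (clash (≤-trans (≤-reflexive (sym bk₀)) (proj₁ (stb′ k))))
    ... | no n₀ with k′ ≟ k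
    ...   | yes refl = ⊥-elim (clash (≤-reflexive (sym bk₀)))
    ...   | no n₁ with suc k′ ≟ k
    ...     | yes refl = ⊥-elim (clash (≤-trans (≤-reflexive (sym bk₀)) (≤-reflexive p)))
    ...     | no n₂ = conv
      where
      e₀ = off k′ n₀
      e₁ = off (suc k′) (n₁ ∘ suc-injective)
      e₂ = off (2 + k′) (n₂ ∘ suc-injective)
      conv : M′.E k′ b a a⁺ s
      conv with mkE f′ l′ o′ ← ev = mkE (trans (sym e₁) (trans (proj₁ f′) e₀) , trans (sym e₂) (trans (proj₂ f′) (cong suc e₀))) l′
        (λ z → subst (_◁′ a k′) e₀ (proj₁ (o′ z)) , proj₂ (o′ z))

module _ {R T} (ch : Chain R T) (k c : ℕ) where
  open Chain ch

  -- No `k` is added to column `c`, so a row that extends beyond `c` at time `k + 1` already did so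
  -- at time `k`, and its `lo` lies beyond `c`.
  flat⇒good : H R (T (suc k)) c ≡ H R (T k) c → Layer.Good T k c
  flat⇒good e r lt = ≮⇒≥ λ c< → <-asym lt (≤-trans
    (H-below R (anti k) (subst (r <_) e (≰⇒> λ le → <-irrefl refl (≤-trans c< (H-above R (shape (suc k)) le)))))
    (m≤m⊔n (T k r) _))

  -- A row violating `Good` would contain a lone `k` in column `c` with a `k` to its right, which is
  -- exactly the exceptional case of the reading order.
  other⇒good : (H R (T (2 + k)) c ≡ suc (H R (T k) c) → H R (T (suc k)) (suc c) ≤ H R (T k) c) →
    Layer.Good T k (suc c)
  other⇒good o r lt = ≮⇒≥ λ c< → bad (≰⇒> λ le → <-irrefl refl (≤-trans c< (H-above R (shape (suc k)) le)))
    where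
    b₀ = H R (T k) c
    b₁ = H R (T (suc k)) c
    b₂ = H R (T (2 + k)) c
    b₁⁺ = H R (T (suc k)) (suc c)
    b₀≤r : b₀ ≤ r
    b₀≤r = ≮⇒≥ λ p → <-irrefl refl (≤-trans (H-below R (anti k) p) (≤-trans (m≤m⊔n (T k r) _) (≤-pred lt)))
    b₂≤ : b₂ ≤ suc r
    b₂≤ = ≮⇒≥ λ p → <-irrefl refl (≤-trans (H-below R (anti (2 + k)) p) (≤-trans (m≤n⊔m (T k r) _) (≤-pred lt)))
    bad : r < b₁⁺ → ⊥
    bad r< = <-irrefl refl (≤-trans r< (≤-trans (o eq) b₀≤r))
      where
      b₁⁺≤b₁ : b₁⁺ ≤ b₁
      b₁⁺≤b₁ = H-next R (shape (suc k)) c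
      r≤b₀ : r ≤ b₀
      r≤b₀ = ≤-pred (≤-trans r< (≤-trans b₁⁺≤b₁ (H-grow₁ k c)))
      eq : b₂ ≡ suc b₀
      eq = ≤-antisym (≤-trans b₂≤ (s≤s r≤b₀)) (≤-trans (s≤s b₀≤r) (≤-trans r< (≤-trans b₁⁺≤b₁ (H-grow (suc k) c))))

-- Events of a pair of tableaux and their reflections

data Kind : Set where
  left right both : Kind

-- The violating cell is kept. In its own tableau the reflection starts left of its column `c`; in
-- the other one it includes column `c`, where a lone `k` or `k + 1` is read later. For `both`,
-- column `c` is kept in each tableau.
thrˡ thrʳ : Kind → ℕ → ℕ
thrˡ left  c = c
thrˡ right c = suc c
thrˡ both  c = c
thrʳ left  c = suc c
thrʳ right c = c
thrʳ both  c = c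

Fun : Set
Fun = ℕ → ℕ → ℕ

module Pair (R : ℕ) where

  h : Fun → ℕ → ℕ → ℕ
  h T c t = H R (T t) c

  s : Fun → Fun → ℕ → ℕ → ℕ
  s T U c t = S R (T t) c + S R (U t) c

  size : Fun → Fun → ℕ → ℕ
  size T U t = ∑ R (T t) + ∑ R (U t)

  -- `ρ` encodes the reading order inside a column: rows from the top, and in each row `T` (even
  -- ranks) before `U` (odd ranks). Rank 0 suits `both`: such a reflection changes nothing in column
  -- `c`, and no reflection of another kind in column `c` creates such an event there.
  Event : Fun → Fun → ℕ → ℕ → ℕ → Kind → Set
  Event T U c ρ k left  = ET.E k (h T c) (h U c) (h U (suc c)) (s T U (suc c)) × ρ ≡ h T c k + h T c k
  Event T U c ρ k right = EU.E k (h U c) (h T c) (h T (suc c)) (s T U (suc c)) × ρ ≡ suc (h U c k + h U c k)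
  Event T U c ρ k both  = E2 k (h T c) (h U c) (s T U (suc c)) × ρ ≡ 0

  Event? : ∀ T U c ρ k d → Dec (Event T U c ρ k d)
  Event? T U c ρ k left  = ET.E? _≤?_ k _ _ _ _ ×-dec (ρ ≟ _)
  Event? T U c ρ k right = EU.E? _<?_ k _ _ _ _ ×-dec (ρ ≟ _)
  Event? T U c ρ k both  = E2? k _ _ _ ×-dec (ρ ≟ _)

  bkˡ bkʳ : Kind → ℕ → ℕ → Fun → Fun
  bkˡ d c k T = Layer.bk T k (thrˡ d c)
  bkʳ d c k U = Layer.bk U k (thrʳ d c)

  steps : ∀ {T} → Chain R T → ∀ c → Steps (h T c)
  steps ch c t = Chain.H-grow ch t c , Chain.H-grow₁ ch t c

  module _ {T U : Fun} (chT : Chain R T) (chU : Chain R U) where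

    goodˡ : ∀ d {c ρ k} → Event T U c ρ k d → Layer.Good T k (thrˡ d c)
    goodˡ left  (e , _) = flat⇒good chT _ _ (proj₁ (ET.E.flat e))
    goodˡ right (e , _) = other⇒good chT _ _ (λ z → proj₂ (EU.E.other e z))
    goodˡ both  (e , _) = flat⇒good chT _ _ (proj₁ (E2.flatˡ e))

    goodʳ : ∀ d {c ρ k} → Event T U c ρ k d → Layer.Good U k (thrʳ d c)
    goodʳ left  (e , _) = other⇒good chU _ _ (λ z → proj₂ (ET.E.other e z))
    goodʳ right (e , _) = flat⇒good chU _ _ (proj₁ (EU.E.flat e))
    goodʳ both  (e , _) = flat⇒good chU _ _ (proj₁ (E2.flatʳ e))

    -- `δ` is the excess of entries `k + 1` over `k` among the kept cells: 1 at an event, 0 when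
    -- everything is reflected.
    bk-size : ∀ k cˡ cʳ δ → Layer.Good T k cˡ → Layer.Good U k cʳ →
      δ + ((S R (T (suc k)) cˡ + S R (T (suc k)) cˡ) + (S R (U (suc k)) cʳ + S R (U (suc k)) cʳ)) ≡
        (S R (T k) cˡ + S R (T (2 + k)) cˡ) + (S R (U k) cʳ + S R (U (2 + k)) cʳ) →
      δ + (size (Layer.bk T k cˡ) (Layer.bk U k cʳ) (suc k) + size T U (suc k)) ≡ size T U k + size T U (2 + k)
    bk-size k cˡ cʳ δ gl gr defect = +-cancelʳ-≡ (D₀ + E₀) _ _
      (trans (ar₁ δ Mˡ Mʳ (∑ R (T (suc k))) (∑ R (U (suc k))) D₀ E₀)
      (trans (cong (δ +_) (cong₂ _+_ (Layer.bk-sum T k chT gl) (Layer.bk-sum U k chU gr)))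
      (trans (ar₂ δ (∑ R (T k)) (∑ R (T (2 + k))) (∑ R (U k)) (∑ R (U (2 + k))) D₁ E₁)
             (cong (∑ R (T k) + ∑ R (U k) + (∑ R (T (2 + k)) + ∑ R (U (2 + k))) +_) defect))))
      where
      Mˡ = ∑ R (Layer.bk T k cˡ (suc k))
      Mʳ = ∑ R (Layer.bk U k cʳ (suc k))
      D₀ = S R (T k) cˡ + S R (T (2 + k)) cˡ
      E₀ = S R (U k) cʳ + S R (U (2 + k)) cʳ
      D₁ = S R (T (suc k)) cˡ + S R (T (suc k)) cˡ
      E₁ = S R (U (suc k)) cʳ + S R (U (suc k)) cʳ
      ar₁ : ∀ d a b c e x y → d + (a + b + (c + e)) + (x + y) ≡ d + ((a + c + x) + (b + e + y))
      ar₁ = solve-∀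
      ar₂ : ∀ d p q u v x y → d + ((p + q + x) + (u + v + y)) ≡ p + u + (q + v) + (d + (x + y))
      ar₂ = solve-∀

    private
      stepT : ∀ t c → S R (T t) c ≡ S R (T t) (suc c) + h T c t
      stepT t = S-step R (Chain.anti chT t)
      stepU : ∀ t c → S R (U t) c ≡ S R (U t) (suc c) + h U c t
      stepU t = S-step R (Chain.anti chU t)

    s-step : ∀ t c → s T U c t ≡ s T U (suc c) t + (h T c t + h U c t)
    s-step t c = trans (cong₂ _+_ (stepT t c) (stepU t c)) (ar (S R (T t) (suc c)) (h T c t) (S R (U t) (suc c)) (h U c t))
      where
      ar : ∀ a b x y → a + b + (x + y) ≡ a + x + (b + y)
      ar = solve-∀

    event-size : ∀ d {c ρ k} → Event T U c ρ k d →
      suc (size (bkˡ d c k T) (bkʳ d c k U) (suc k) + size T U (suc k)) ≡ size T U k + size T U (2 + k)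
    event-size left {c} {k = k} e@(mkE (p , q) l _ , _) = bk-size k c (suc c) 1 (goodˡ left e) (goodʳ left e) defect
      where
      ar₁ : ∀ x a y → 1 + ((x + a + (x + a)) + (y + y)) ≡ ((x + y) + (x + y)) + (1 + (a + a))
      ar₁ = solve-∀
      ar₂ : ∀ x x′ y y′ a → ((x + y) + (x′ + y′)) + (1 + (a + a)) ≡ (x + a + (x′ + suc a)) + (y + y′)
      ar₂ = solve-∀
      defect : 1 + ((S R (T (suc k)) c + S R (T (suc k)) c) + (S R (U (suc k)) (suc c) + S R (U (suc k)) (suc c))) ≡
        (S R (T k) c + S R (T (2 + k)) c) + (S R (U k) (suc c) + S R (U (2 + k)) (suc c))
      defect rewrite stepT (suc k) c | stepT k c | stepT (2 + k) c | p | q =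
        trans (ar₁ (S R (T (suc k)) (suc c)) (h T c k) (S R (U (suc k)) (suc c)))
        (trans (cong (_+ (1 + (h T c k + h T c k))) (sym l))
               (ar₂ (S R (T k) (suc c)) _ (S R (U k) (suc c)) _ (h T c k)))
    event-size right {c} {k = k} e@(mkE (p , q) l _ , _) = bk-size k (suc c) c 1 (goodˡ right e) (goodʳ right e) defect
      where
      ar₁ : ∀ x a y → 1 + ((y + y) + (x + a + (x + a))) ≡ ((y + x) + (y + x)) + (1 + (a + a))
      ar₁ = solve-∀
      ar₂ : ∀ x x′ y y′ a → ((y + x) + (y′ + x′)) + (1 + (a + a)) ≡ (y + y′) + (x + a + (x′ + suc a))
      ar₂ = solve-∀
      defect : 1 + ((S R (T (suc k)) (suc c) + S R (T (suc k)) (suc c)) + (S R (U (suc k)) c + S R (U (suc k)) c)) ≡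
        (S R (T k) (suc c) + S R (T (2 + k)) (suc c)) + (S R (U k) c + S R (U (2 + k)) c)
      defect rewrite stepU (suc k) c | stepU k c | stepU (2 + k) c | p | q =
        trans (ar₁ (S R (U (suc k)) (suc c)) (h U c k) (S R (T (suc k)) (suc c)))
        (trans (cong (_+ (1 + (h U c k + h U c k))) (sym l))
               (ar₂ (S R (U k) (suc c)) _ (S R (T k) (suc c)) _ (h U c k)))
    event-size both {c} {k = k} e@(mkE2 (p , q) (p′ , q′) l , _) = bk-size k c c 1 (goodˡ both e) (goodʳ both e) defect
      where
      ar₁ : ∀ x a y b → 1 + ((x + a + (x + a)) + (y + b + (y + b))) ≡ ((x + y) + (x + y)) + (1 + (a + a + b + b))
      ar₁ = solve-∀
      ar₂ : ∀ x x′ y y′ a b → suc ((x + y) + (x′ + y′)) + (1 + (a + a + b + b)) ≡ (x + a + (x′ + suc a)) + (y + b + (y′ + suc b))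
      ar₂ = solve-∀
      defect : 1 + ((S R (T (suc k)) c + S R (T (suc k)) c) + (S R (U (suc k)) c + S R (U (suc k)) c)) ≡
        (S R (T k) c + S R (T (2 + k)) c) + (S R (U k) c + S R (U (2 + k)) c)
      defect rewrite stepU (suc k) c | stepU k c | stepU (2 + k) c | stepT (suc k) c | stepT k c | stepT (2 + k) c | p | q | p′ | q′ =
        trans (ar₁ (S R (T (suc k)) (suc c)) (h T c k) (S R (U (suc k)) (suc c)) (h U c k))
        (trans (cong (_+ (1 + (h T c k + h T c k + h U c k + h U c k))) (sym l))
               (ar₂ (S R (T k) (suc c)) _ (S R (U k) (suc c)) _ (h T c k) (h U c k)))

    private
      thrˡ≤ : ∀ d c → thrˡ d c ≤ suc c
      thrˡ≤ left  c = n≤1+n c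
      thrˡ≤ right c = ≤-refl
      thrˡ≤ both  c = n≤1+n c
      thrʳ≤ : ∀ d c → thrʳ d c ≤ suc c
      thrʳ≤ left  c = ≤-refl
      thrʳ≤ right c = n≤1+n c
      thrʳ≤ both  c = n≤1+n c

    module _ (d : Kind) {c ρ k : ℕ} (e : Event T U c ρ k d) where
      private
        T′ = bkˡ d c k T
        U′ = bkʳ d c k U
        gl = goodˡ d e
        gr = goodʳ d e

        chT′ : Chain R T′
        chT′ = Layer.bk-chain T k chT gl
        chU′ : Chain R U′
        chU′ = Layer.bk-chain U k chU gr

        hT : ∀ {c′} → thrˡ d c ≤ c′ → ∀ t → h T′ c′ t ≡ h T c′ t
        hT le = Layer.refl-H T k chT gl le
        hU : ∀ {c′} → thrʳ d c ≤ c′ → ∀ t → h U′ c′ t ≡ h U c′ t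
        hU le = Layer.refl-H U k chU gr le
        s≡ : ∀ {c′} → suc c ≤ c′ → ∀ t → s T′ U′ c′ t ≡ s T U c′ t
        s≡ le t = cong₂ _+_ (Layer.refl-S T k chT gl (≤-trans (thrˡ≤ d c) le) t)
                            (Layer.refl-S U k chU gr (≤-trans (thrʳ≤ d c) le) t)

        rank-eq : ∀ {ρ x y : ℕ} → x ≡ y → ρ ≡ x + x → ρ ≡ y + y
        rank-eq refl p = p
        rank-eq′ : ∀ {ρ x y : ℕ} → x ≡ y → ρ ≡ suc (x + x) → ρ ≡ suc (y + y)
        rank-eq′ refl p = p

        beyond : ∀ {c′} → thrˡ d c ≤ c′ → thrʳ d c ≤ c′ → c ≤ c′ → ∀ {ρ′ k′} d′ →
          Event T′ U′ c′ ρ′ k′ d′ → Event T U c′ ρ′ k′ d′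
        beyond {c′} l r q left (e′ , p) =
          ET.E-cong (hT l) (hU r _) (hU r _) (hU (m≤n⇒m≤1+n r)) (s≡ (s≤s q)) e′ , rank-eq (hT l _) p
        beyond {c′} l r q right (e′ , p) =
          EU.E-cong (hU r) (hT l _) (hT l _) (hT (m≤n⇒m≤1+n l)) (s≡ (s≤s q)) e′ , rank-eq′ (hU r _) p
        beyond {c′} l r q both (e′ , p) =
          E2-cong (hT l) (hU r _) (hU r _) (hU r _) (s≡ (s≤s q)) e′ , p

        offʳ : ∀ t → t ≢ suc k → h U′ c t ≡ h U c t
        offʳ t ne = H-cong R (Chain.shape chU′ t) (Chain.shape chU t)
          (λ r → subst (c <_) (upd-off U (suc k) _ ne r)) (λ r → subst (c <_) (sym (upd-off U (suc k) _ ne r)))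
        offˡ : ∀ t → t ≢ suc k → h T′ c t ≡ h T c t
        offˡ t ne = H-cong R (Chain.shape chT′ t) (Chain.shape chT t)
          (λ r → subst (c <_) (upd-off T (suc k) _ ne r)) (λ r → subst (c <_) (sym (upd-off T (suc k) _ ne r)))

        dbl : ∀ {x y} → x ≤ y → x + x < suc (y + y)
        dbl le = s≤s (+-mono-≤ le le)
        dbl′ : ∀ {x y} → x < y → suc (x + x) < y + y
        dbl′ {x} le = ≤-trans (≤-reflexive (ar x)) (+-mono-≤ le le)
          where
          ar : ∀ x → suc (suc (x + x)) ≡ suc x + suc x
          ar = solve-∀

      -- The event looks only at kept columns and, in a reflected column, only at the times `k` and
      -- `k + 2`. It is therefore found again after the reflection, which makes the latter an
      -- involution on the pairs showing this event.
      event-persists : Event T′ U′ c ρ k d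
      event-persists = go d refl
        where
        go : ∀ d₀ → d₀ ≡ d → Event T′ U′ c ρ k d
        go left refl = ET.E-cong (sym ∘ hT ≤-refl) (sym (offʳ k (λ ()))) (sym (offʳ (2 + k) (λ ())))
          (sym ∘ hU ≤-refl) (sym ∘ s≡ ≤-refl) (proj₁ e) , rank-eq (sym (hT ≤-refl k)) (proj₂ e)
        go right refl = EU.E-cong (sym ∘ hU ≤-refl) (sym (offˡ k (λ ()))) (sym (offˡ (2 + k) (λ ())))
          (sym ∘ hT ≤-refl) (sym ∘ s≡ ≤-refl) (proj₁ e) , rank-eq′ (sym (hU ≤-refl k)) (proj₂ e)
        go both refl = E2-cong (sym ∘ hT ≤-refl) (sym (hU ≤-refl _)) (sym (hU ≤-refl _)) (sym (hU ≤-refl _))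
          (sym ∘ s≡ ≤-refl) (proj₁ e) , proj₂ e

      no-new-events-right-of : ∀ {c′} → c < c′ → ∀ {ρ′ k′} d′ → Event T′ U′ c′ ρ′ k′ d′ → Event T U c′ ρ′ k′ d′
      no-new-events-right-of lt = beyond (≤-trans (thrˡ≤ d c) lt) (≤-trans (thrʳ≤ d c) lt) (<⇒≤ lt)

      private
        old-event : ∀ d₀ → d₀ ≡ d → ∀ {ρ′ k′} → ρ′ ≤ ρ → ∀ d′ → Event T′ U′ c ρ′ k′ d′ → Event T U c ρ′ k′ d′
        old-event left refl {ρ′} {k′} ρ≤ = go
          where
          module St = Stability _≤_ _<_ (λ x → x + x) (λ x → suc (x + x)) dbl (λ p → s≤s (+-mono-≤ p p))
            {k} {h T c} {h U c} {h U (suc c)} {s T U (suc c)} {h U′ c} (steps chU c) (steps chU′ c) offʳ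
          fix : ET.E k′ (h T′ c) (h U′ c) (h U′ (suc c)) (s T′ U′ (suc c)) → ET.E k′ (h T c) (h U′ c) (h U (suc c)) (s T U (suc c))
          fix = ET.E-cong (hT ≤-refl) refl refl (hU ≤-refl) (s≡ ≤-refl)
          go : ∀ d′ → Event T′ U′ c ρ′ k′ d′ → Event T U c ρ′ k′ d′
          go left  (e′ , p) = St.same (proj₁ e) (fix e′) , rank-eq (hT ≤-refl k′) p
          go both  (e′ , p) = St.two (proj₁ e) (E2-cong (hT ≤-refl) refl refl refl (s≡ ≤-refl) e′) , p
          go right (e′ , p) = res , trans p (cong (λ z → suc (z + z)) same-k′)
            where
            le : suc (h U′ c k′ + h U′ c k′) ≤ h T c k + h T c k
            le = subst₂ _≤_ p (proj₂ e) ρ≤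
            res : EU.E k′ (h U c) (h T c) (h T (suc c)) (s T U (suc c))
            res = St.opp (proj₁ e) le (EU.E-cong (λ _ → refl) (hT ≤-refl _) (hT ≤-refl _) (hT (n≤1+n c)) (s≡ ≤-refl) e′)
            same-k′ : h U′ c k′ ≡ h U c k′
            same-k′ = cases (k′ ≟ suc k)
              where
              cases : Dec (k′ ≡ suc k) → h U′ c k′ ≡ h U c k′
              cases (no ne) = offʳ k′ ne
              -- The columns might differ at time `k + 1`, but both events fix their height there as
              -- one less than at time `k + 3`, where nothing has changed.
              cases (yes refl) = suc-injective (trans (sym (proj₂ (EU.E.flat e′))) (trans (offʳ (3 + k) (λ ())) (proj₂ (EU.E.flat res))))
        old-event right refl {ρ′} {k′} ρ≤ = go
          where
          module St = Stability _<_ _≤_ (λ x → suc (x + x)) (λ x → x + x) dbl′ (λ p → +-mono-≤ p p)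
            {k} {h U c} {h T c} {h T (suc c)} {s T U (suc c)} {h T′ c} (steps chT c) (steps chT′ c) offˡ
          fix : EU.E k′ (h U′ c) (h T′ c) (h T′ (suc c)) (s T′ U′ (suc c)) → EU.E k′ (h U c) (h T′ c) (h T (suc c)) (s T U (suc c))
          fix = EU.E-cong (hU ≤-refl) refl refl (hT ≤-refl) (s≡ ≤-refl)
          go : ∀ d′ → Event T′ U′ c ρ′ k′ d′ → Event T U c ρ′ k′ d′
          go right (e′ , p) = St.same (proj₁ e) (fix e′) , rank-eq′ (hU ≤-refl k′) p
          go both  (e′ , p) = E2-sym (St.two (proj₁ e) (E2-cong (hU ≤-refl) refl refl refl (s≡ ≤-refl) (E2-sym e′))) , p
          go left (e′ , p) = res , trans p (cong (λ z → z + z) same-k′)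
            where
            le : h T′ c k′ + h T′ c k′ ≤ suc (h U c k + h U c k)
            le = subst₂ _≤_ p (proj₂ e) ρ≤
            res : ET.E k′ (h T c) (h U c) (h U (suc c)) (s T U (suc c))
            res = St.opp (proj₁ e) le (ET.E-cong (λ _ → refl) (hU ≤-refl _) (hU ≤-refl _) (hU (n≤1+n c)) (s≡ ≤-refl) e′)
            same-k′ : h T′ c k′ ≡ h T c k′
            same-k′ = cases (k′ ≟ suc k)
              where
              cases : Dec (k′ ≡ suc k) → h T′ c k′ ≡ h T c k′
              cases (no ne) = offˡ k′ ne
              cases (yes refl) = suc-injective (trans (sym (proj₂ (ET.E.flat e′))) (trans (offˡ (3 + k) (λ ())) (proj₂ (ET.E.flat res))))
        old-event both refl ρ≤ d′ = beyond ≤-refl ≤-refl ≤-refl d′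

      no-new-events-before : ∀ {ρ′ k′} → ρ′ ≤ ρ → ∀ d′ → Event T′ U′ c ρ′ k′ d′ → Event T U c ρ′ k′ d′
      no-new-events-before = old-event d refl

-- Lattice pairs and the absence of events

Concave : (ℕ → ℕ) → ℕ → Set
Concave s k = s k + s (2 + k) ≤ s (suc k) + s (suc k)

-- In column c, the entry k + 1 of T (in row r) is read before the entry k of U (in row q);
-- the entries k of T are the cells added between times k and k + 1.
record Bad (_◁_ : ℕ → ℕ → Set) (T U : Fun) (k c r q : ℕ) : Set where
  field
    rows  : r ◁ q
    T-out : T (suc k) r ≤ c
    T-in  : c < T (2 + k) r
    T-up  : ∀ {r′} → suc r′ ≡ r → c < T k r′
    U-out : U k q ≤ c
    U-end : U (suc k) q ≡ suc c
    U-low : U (2 + k) (suc q) ≤ c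

module _ (a : ℕ → ℕ) (k : ℕ) (st : Steps a) where

  growth : a k + a (2 + k) ≤ a (suc k) + a (suc k) ⊎ Flat a k
  growth with a (suc k) ≤? a k | a (2 + k) ≤? a (suc k)
  ... | _ | yes q = inj₁ (+-mono-≤ (proj₁ (st k)) q)
  ... | no p | no _ = inj₁ (≤-pred (≤-trans (+-mono-≤ (≰⇒> p) (proj₂ (st (suc k)))) (≤-reflexive (+-suc _ _))))
  ... | yes p | no q = inj₂ (e , trans (≤-antisym (proj₂ (st (suc k))) (≰⇒> q)) (cong suc e))
    where
    e : a (suc k) ≡ a k
    e = ≤-antisym p (proj₁ (st k))

  Flat-excess : Flat a k → a k + a (2 + k) ≡ suc (a (suc k) + a (suc k))
  Flat-excess (p , q) rewrite p | q = +-suc _ _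

  rise : a k + a (2 + k) < a (suc k) + a (suc k) → a (suc k) ≡ suc (a k) × a (2 + k) ≡ suc (a k)
  rise lt = e , trans (≤-antisym up (proj₁ (st (suc k)))) e
    where
    e : a (suc k) ≡ suc (a k)
    e = ≤-antisym (proj₂ (st k)) (+-cancelʳ-≤ (a (suc k)) _ _ (≤-trans (s≤s (+-monoʳ-≤ (a k) (proj₁ (st (suc k))))) lt))
    up : a (2 + k) ≤ a (suc k)
    up = +-cancelˡ-≤ (a (suc k)) _ _ (subst (λ z → z + a (2 + k) ≤ a (suc k) + a (suc k)) (sym e) lt)

  -- Parity: a column with exactly one of `k` and `k + 1` cannot be balanced.
  odd : a k + a (2 + k) ≡ a (suc k) + a (suc k) → a (2 + k) ≢ suc (a k)
  odd p q with a (suc k) ≤? a k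
  ... | yes le rewrite q | ≤-antisym le (proj₁ (st k)) = 1+n≢n (trans (sym (+-suc (a k) (a k))) p)
  ... | no ¬le rewrite q | ≤-antisym (proj₂ (st k)) (≰⇒> ¬le) =
    1+n≢n {a k + suc (a k)} (sym p)

module PairY (R : ℕ) where
  open Pair R

  NoEvents : Fun → Fun → Set
  NoEvents T U = ∀ c ρ k d → ¬ Event T U c ρ k d

  -- The lattice condition in terms of values instead of column heights, the form on which an
  -- exchange of values acts. `concave` tests after each complete column. The other two fields test
  -- inside a column, where the remaining danger is a lone `k + 1` read before a lone `k` of the
  -- other tableau.
  record Yam (T U : Fun) : Set where
    field
      concave : ∀ k c → Concave (s T U c) k
      noˡ     : ∀ k c r q → Balanced (s T U (suc c)) k → ¬ Bad _≤_ T U k c r q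
      noʳ     : ∀ k c r q → Balanced (s T U (suc c)) k → ¬ Bad _<_ U T k c r q

  module _ (_◁_ : ℕ → ℕ → Set) {T U : Fun} (chT : Chain R T) (chU : Chain R U) where
    private module M = Events _◁_
    module _ {σ : ℕ → ℕ} {k c : ℕ} where

      bad⇒event : ∀ {r q} → Balanced σ k → Bad _◁_ T U k c r q → M.E k (h T c) (h U c) (h U (suc c)) σ
      bad⇒event {r} {q} bal b = mkE (trans a₁ (sym a₀) , trans a₂ (cong suc (sym a₀))) bal
          (λ _ → subst₂ _◁_ (sym a₀) (sym b₀) rows , subst (h U (suc c) (suc k) ≤_) (sym b₀) b⁺)
        where
        open Bad b
        open Chain
        below-T : ∀ {r′} → r′ < r → c < T k r′
        below-T {r′} lt = go r refl lt
          where
          go : ∀ n → n ≡ r → r′ < n → c < T k r′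
          go (suc n) e lt = ≤-trans (T-up e) (antitone (anti chT k) (≤-pred lt))
        a₀ : h T c k ≡ r
        a₀ = H-unique R (shape chT k) below-T (≤-trans (mono chT k r) T-out)
        a₁ : h T c (suc k) ≡ r
        a₁ = H-unique R (shape chT (suc k)) (λ lt → ≤-trans (below-T lt) (mono chT k _)) T-out
        a₂ : h T c (2 + k) ≡ suc r
        a₂ = H-unique R (shape chT (2 + k)) (λ lt → ≤-trans T-in (antitone (anti chT (2 + k)) (≤-pred lt)))
               (≤-trans (strip chT (suc k) r) T-out)
        b₀ : h U c k ≡ q
        b₀ = H-unique R (shape chU k) below-U U-out
          where
          below-U : ∀ {r′} → r′ < q → c < U k r′
          below-U {r′} lt = ≤-trans (≤-reflexive (sym U-end)) (≤-trans (antitone (anti chU (suc k)) lt) (strip chU k r′))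
        b⁺ : h U (suc c) (suc k) ≤ q
        b⁺ = ≮⇒≥ λ lt → <-irrefl refl (≤-trans (H-below R (anti chU (suc k)) lt) (≤-reflexive U-end))

      event⇒bad : M.E k (h T c) (h U c) (h U (suc c)) σ → h U c (suc k) ≡ suc (h U c k) → h U c (2 + k) ≡ suc (h U c k) →
        Bad _◁_ T U k c (h T c k) (h U c k)
      event⇒bad (mkE (p , q) _ o) b₁ b₂ = record
        { rows  = proj₁ (o b₂)
        ; T-out = H-above R (shape chT (suc k)) (≤-reflexive p)
        ; T-in  = H-below R (anti chT (2 + k)) (≤-reflexive (sym q))
        ; T-up  = λ e → H-below R (anti chT k) (≤-reflexive e)
        ; U-out = H-above R (shape chU k) ≤-refl
        ; U-end = ≤-antisym (H-above R (shape chU (suc k)) (proj₂ (o b₂))) (H-below R (anti chU (suc k)) (≤-reflexive (sym b₁)))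
        ; U-low = H-above R (shape chU (2 + k)) (≤-reflexive b₂)
        }
        where open Chain

  module _ {T U : Fun} (chT : Chain R T) (chU : Chain R U) where

    module _ {k c : ℕ} where
      private
        a = h T c
        b = h U c
        σ = s T U (suc c)
        sa = steps chT c
        sb = steps chU c
        σ₂ = σ k + σ (2 + k)
        σ₁ = σ (suc k) + σ (suc k)
        a₂ = a k + a (2 + k)
        a₁ = a (suc k) + a (suc k)
        b₂ = b k + b (2 + k)
        b₁ = b (suc k) + b (suc k)

        expand : s T U c k + s T U c (2 + k) ≡ σ₂ + a₂ + b₂
        expand rewrite s-step chT chU k c | s-step chT chU (2 + k) c =
          ar (σ k) (σ (2 + k)) (a k) (a (2 + k)) (b k) (b (2 + k))
          where
          ar : ∀ x y p q u v → x + (p + u) + (y + (q + v)) ≡ x + y + (p + q) + (u + v)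
          ar = solve-∀

        expand₁ : s T U c (suc k) + s T U c (suc k) ≡ σ₁ + a₁ + b₁
        expand₁ rewrite s-step chT chU (suc k) c = ar (σ (suc k)) (a (suc k)) (b (suc k))
          where
          ar : ∀ x p u → x + (p + u) + (x + (p + u)) ≡ x + x + (p + p) + (u + u)
          ar = solve-∀

        combine : σ₂ + a₂ + b₂ ≤
          σ₁ + a₁ + b₁ → Concave (s T U c) k
        combine le = ≤-trans (≤-reflexive expand) (≤-trans le (≤-reflexive (sym expand₁)))

      -- Each of the two columns contributes an excess of at most one, and only if it is flat.
      -- Unless a surplus on the right or the other column absorbs it, the excess is an event.
      concave-step : (∀ ρ d → ¬ Event T U c ρ k d) → Concave σ k → Concave (s T U c) k
      concave-step no-ev le with growth a k sa | growth b k sb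
      ... | inj₁ p | inj₁ q = combine (+-mono-≤ (+-mono-≤ le p) q)
      ... | inj₂ f | inj₁ q with σ₂ ≟ σ₁ | b₂ ≟ b₁
      ...   | yes e | yes e′ = ⊥-elim (no-ev _ left (mkE f e (λ z → ⊥-elim (odd b k sb e′ z)) , refl))
      ...   | no ne | _ = combine (+-mono-≤ lem q)
        where
        lem : σ₂ + a₂ ≤ σ₁ + a₁
        lem rewrite Flat-excess a k sa f | +-suc σ₂ a₁ = +-monoˡ-≤ _ (≤∧≢⇒< le ne)
      ...   | yes _ | no ne = combine lem
        where
        lem : σ₂ + a₂ + b₂ ≤ σ₁ + a₁ + b₁
        lem rewrite Flat-excess a k sa f | +-suc σ₂ a₁
          = ≤-trans (≤-reflexive (sym (+-suc _ _))) (+-mono-≤ (+-monoˡ-≤ a₁ le) (≤∧≢⇒< q ne))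
      concave-step no-ev le | inj₁ p | inj₂ f with σ₂ ≟ σ₁ | a₂ ≟ a₁
      ...   | yes e | yes e′ = ⊥-elim (no-ev _ right (mkE f e (λ z → ⊥-elim (odd a k sa e′ z)) , refl))
      ...   | no ne | _ = combine lem
        where
        lem : σ₂ + a₂ + b₂ ≤ σ₁ + a₁ + b₁
        lem rewrite Flat-excess b k sb f | +-suc (σ₂ + a₂) b₁
          = +-monoˡ-≤ b₁ (+-mono-≤ (≤∧≢⇒< le ne) p)
      ...   | yes _ | no ne = combine lem
        where
        lem : σ₂ + a₂ + b₂ ≤ σ₁ + a₁ + b₁
        lem rewrite Flat-excess b k sb f | +-suc (σ₂ + a₂) b₁
          = +-monoˡ-≤ b₁ (≤-trans (≤-reflexive (sym (+-suc _ _))) (+-mono-≤ le (≤∧≢⇒< p ne)))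
      concave-step no-ev le | inj₂ f | inj₂ g with σ₂ ≟ σ₁ | suc σ₂ ≟ σ₁
      ...   | no _ | yes e = ⊥-elim (no-ev 0 both (mkE2 f g e , refl))
      ...   | no ne | no ne′ = combine lem
        where
        ar : ∀ x p u → x + suc p + suc u ≡ suc (suc x) + p + u
        ar = solve-∀
        lem : σ₂ + a₂ + b₂ ≤ σ₁ + a₁ + b₁
        lem rewrite Flat-excess a k sa f | Flat-excess b k sb g
          = ≤-trans (≤-reflexive (ar σ₂ a₁ b₁))
                    (+-monoˡ-≤ _ (+-monoˡ-≤ _ (≤∧≢⇒< (≤∧≢⇒< le ne) ne′)))
      -- Both columns overshoot a balanced prefix. The event belongs to the `k + 1` in the higher
      -- row, ties going to `T`; since the other column is flat, no `k` can stand right of its lone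
      -- entry.
      ...   | yes e | _ with a k ≤? b k
      ...     | yes a≤b = ⊥-elim (no-ev _ left (mkE f e (λ _ → a≤b , ≤-trans (H-next R (Chain.shape chU (suc k)) c) (≤-reflexive (proj₁ g))) , refl))
      ...     | no a≰b = ⊥-elim (no-ev _ right (mkE g e (λ _ → ≰⇒> a≰b , ≤-trans (H-next R (Chain.shape chT (suc k)) c) (≤-reflexive (proj₁ f))) , refl))

      private
        excess : Concave (s T U c) k → σ₂ + a₂ + b₂ ≤
          σ₁ + a₁ + b₁
        excess le = ≤-trans (≤-reflexive (sym expand)) (≤-trans le (≤-reflexive expand₁))

      -- At a `left` or `right` event one column overshoots by one; concavity after the column
      -- forces the other to contain `k` without `k + 1`, which is the configuration that `noˡ` or
      -- `noʳ` forbids. A `both` event contradicts concavity at once.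
      yam⇒¬event : Yam T U → ∀ ρ d → ¬ Event T U c ρ k d
      yam⇒¬event y ρ left (e@(mkE f l o) , _) with growth b k sb
      ... | inj₂ g = <-irrefl refl (≤-trans (≤-reflexive (ar σ₂ _ _)) main)
        where
        ar : ∀ x p u → suc (suc (x + p + u)) ≡ x + suc p + suc u
        ar = solve-∀
        main : σ₂ + suc a₁ + suc b₁ ≤ suc (σ₂ + a₁ + b₁)
        main = m≤n⇒m≤1+n (subst₂ (λ x y → σ₂ + x + y ≤ σ₂ + a₁ + b₁)
          (Flat-excess a k sa f) (Flat-excess b k sb g) (subst (λ z → σ₂ + a₂ + b₂ ≤ z + a₁ + b₁) (sym l) (excess (Yam.concave y k c))))
      ... | inj₁ _ = Yam.noˡ y k c _ _ l (event⇒bad _≤_ chT chU e (proj₁ r) (proj₂ r))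
        where
        ar : ∀ x p u → x + suc p + u ≡ x + p + suc u
        ar = solve-∀
        r : b (suc k) ≡ suc (b k) × b (2 + k) ≡ suc (b k)
        r = rise b k sb (+-cancelˡ-≤ (σ₂ + a₁) _ _
          (≤-trans (≤-reflexive (sym (ar σ₂ a₁ b₂)))
          (subst₂ (λ x z → σ₂ + x + b₂ ≤ z + a₁ + b₁)
             (Flat-excess a k sa f) (sym l) (excess (Yam.concave y k c)))))
      yam⇒¬event y ρ right (e@(mkE f l o) , _) with growth a k sa
      ... | inj₂ g = <-irrefl refl (≤-trans (≤-reflexive (ar σ₂ _ _)) main)
        where
        ar : ∀ x p u → suc (suc (x + p + u)) ≡ x + suc p + suc u
        ar = solve-∀
        main : σ₂ + suc a₁ + suc b₁ ≤ suc (σ₂ + a₁ + b₁)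
        main = m≤n⇒m≤1+n (subst₂ (λ x y → σ₂ + x + y ≤ σ₂ + a₁ + b₁)
          (Flat-excess a k sa g) (Flat-excess b k sb f) (subst (λ z → σ₂ + a₂ + b₂ ≤ z + a₁ + b₁) (sym l) (excess (Yam.concave y k c))))
      ... | inj₁ _ = Yam.noʳ y k c _ _ l (event⇒bad _<_ chU chT e (proj₁ r) (proj₂ r))
        where
        ar : ∀ x p u → x + suc p + u ≡ x + p + suc u
        ar = solve-∀
        ar′ : ∀ x p u → x + p + suc u ≡ x + u + suc p
        ar′ = solve-∀
        ar″ : ∀ x p u → x + p + u ≡ x + u + p
        ar″ = solve-∀
        r : a (suc k) ≡ suc (a k) × a (2 + k) ≡ suc (a k)
        r = rise a k sa (+-cancelˡ-≤ (σ₂ + b₁) _ _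
          (≤-trans (≤-reflexive (sym (ar′ σ₂ a₂ b₁)))
          (≤-trans (subst₂ (λ x z → σ₂ + a₂ + x ≤ z + a₁ + b₁)
             (Flat-excess b k sb f) (sym l) (excess (Yam.concave y k c)))
             (≤-reflexive (ar″ σ₂ _ _)))))
      yam⇒¬event y ρ both (mkE2 f g l , _) = <-irrefl refl (≤-trans (≤-reflexive (ar σ₂ _ _)) main)
        where
        ar : ∀ x p u → suc (suc x + p + u) ≡ x + suc p + suc u
        ar = solve-∀
        main : σ₂ + suc a₁ + suc b₁ ≤ suc σ₂ + a₁ + b₁
        main = subst₂ (λ x y → σ₂ + x + y ≤ suc σ₂ + a₁ + b₁)
          (Flat-excess a k sa f) (Flat-excess b k sb g) (subst (λ z → σ₂ + a₂ + b₂ ≤ z + a₁ + b₁) (sym l) (excess (Yam.concave y k c)))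

    yam⇒noEvents : Yam T U → NoEvents T U
    yam⇒noEvents y c ρ k d = yam⇒¬event y ρ d

    noEvents⇒yam : (C : ℕ) → (∀ t r → T t r ≤ C) → (∀ t r → U t r ≤ C) → (∀ c → c < C → ∀ ρ k d → ¬ Event T U c ρ k d) → Yam T U
    noEvents⇒yam C bT bU no-ev = record
      { concave = conc
      ; noˡ = λ k c r q bal bad → no-ev c (in-range (Bad.T-in bad) bT) _ k left (bad⇒event _≤_ chT chU bal bad , refl)
      ; noʳ = λ k c r q bal bad → no-ev c (in-range (Bad.T-in bad) bU) _ k right (bad⇒event _<_ chU chT bal bad , refl)
      }
      where
      in-range : ∀ {c x X} {F : Fun} → c < F x X → (∀ t r → F t r ≤ C) → c < C
      in-range lt b = ≤-trans lt (b _ _)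
      small : ∀ {F : Fun} → (∀ t r → F t r ≤ C) → ∀ {c} → C ≤ c → ∀ t → S R (F t) c ≡ 0
      small b le t = ∑-zero R (λ r → m≤n⇒m∸n≡0 (≤-trans (b t r) le))
      zeros : ∀ {c} → C ≤ c → ∀ t → s T U c t ≡ 0
      zeros le t rewrite small bT le t | small bU le t = refl
      conc : ∀ k c → Concave (s T U c) k
      conc k c = go (C ∸ c) c ≤-refl
        where
        -- Induction from right to left over the columns, with `n` as fuel; beyond the width `C`
        -- there is nothing to count.
        go : ∀ n c → C ∸ c ≤ n → Concave (s T U c) k
        go n c le with C ≤? c
        ... | yes p rewrite zeros p k | zeros p (suc k) | zeros p (2 + k) = z≤n
        go zero c le | no p = ⊥-elim (p (m∸n≡0⇒m≤n (n≤0⇒n≡0 le)))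
        go (suc n) c le | no p = concave-step (λ ρ d → no-ev c (≰⇒> p) ρ k d)
          (go n (suc c) (≤-pred (≤-trans (≤-reflexive (sym (+-∸-assoc 1 {C} {suc c} (≰⇒> p)))) le)))

-- Exchanging two tableaux along linked positions

module Reach {V : Set} where

  -- Kleene's recursion, as in the Floyd-Warshall algorithm: `ws` lists the vertices allowed as
  -- intermediate stops. It makes reachability decidable by structural recursion, without a bound on
  -- path lengths.
  Path : (V → V → Set) → List V → V → V → Set
  Path E []       u v = u ≡ v ⊎ E u v
  Path E (w ∷ ws) u v = Path E ws u v ⊎ (Path E ws u w × Path E ws w v)

  path? : ∀ {E} → (∀ u v → Dec (u ≡ v)) → (∀ u v → Dec (E u v)) → ∀ ws u v → Dec (Path E ws u v)
  path? ≟v E? []       u v = ≟v u v ⊎-dec E? u v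
  path? ≟v E? (w ∷ ws) u v = path? ≟v E? ws u v ⊎-dec (path? ≟v E? ws u w ×-dec path? ≟v E? ws w v)

  step : ∀ {E} ws {u v} → u ≡ v ⊎ E u v → Path E ws u v
  step []       p = p
  step (w ∷ ws) p = inj₁ (step ws p)

  -- Concatenation. When both halves pass through the head vertex, the loop between the two visits
  -- is cut out.
  via : ∀ {E} {ws u v w} → w ∈ ws → Path E ws u w → Path E ws w v → Path E ws u v
  via (here refl) p q = inj₂ (to p , from q)
    where
    to : _ → _
    to (inj₁ x)       = x
    to (inj₂ (x , _)) = x
    from : _ → _
    from (inj₁ x)       = x
    from (inj₂ (_ , x)) = x
  via (there i) (inj₁ p)       (inj₁ q)       = inj₁ (via i p q)
  via (there i) (inj₁ p)       (inj₂ (q , r)) = inj₂ (via i p q , r)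
  via (there i) (inj₂ (p , q)) (inj₁ r)       = inj₂ (p , via i q r)
  via (there i) (inj₂ (p , _)) (inj₂ (_ , r)) = inj₂ (p , r)

  invariant : ∀ {E} (Q : V → Set) → (∀ {u v} → E u v → Q u → Q v) → ∀ ws {u v} → Path E ws u v → Q u → Q v
  invariant Q e []       (inj₁ refl)    q = q
  invariant Q e []       (inj₂ x)       q = e x q
  invariant Q e (w ∷ ws) (inj₁ p)       q = invariant Q e ws p q
  invariant Q e (w ∷ ws) (inj₂ (p , r)) q = invariant Q e ws r (invariant Q e ws p q)

  map-path : ∀ {E E′} → (∀ {u v} → E u v → E′ u v) → ∀ ws {u v} → Path E ws u v → Path E′ ws u v
  map-path f []       (inj₁ p)       = inj₁ p
  map-path f []       (inj₂ p)       = inj₂ (f p)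
  map-path f (w ∷ ws) (inj₁ p)       = inj₁ (map-path f ws p)
  map-path f (w ∷ ws) (inj₂ (p , q)) = inj₂ (map-path f ws p , map-path f ws q)

mx mn : Fun → Fun → Fun
mx T U t r = T t r ⊔ U t r
mn T U t r = T t r ⊓ U t r

swapˡ swapʳ : (ℕ → ℕ → Bool) → Fun → Fun → Fun
swapˡ W T U t r = if W t r then U t r else T t r
swapʳ W T U t r = if W t r then T t r else U t r

module Swap (R : ℕ) (W : ℕ → ℕ → Bool) {T U : Fun} (chT : Chain R T) (chU : Chain R U) where
  open Pair R
  open PairY R

  T′ U′ : Fun
  T′ = swapˡ W T U
  U′ = swapʳ W T U

  swap-mx : ∀ t r → mx T′ U′ t r ≡ mx T U t r
  swap-mx t r with W t r
  ... | true  = ⊔-comm (U t r) (T t r)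
  ... | false = refl

  swap-mn : ∀ t r → mn T′ U′ t r ≡ mn T U t r
  swap-mn t r with W t r
  ... | true  = ⊓-comm (U t r) (T t r)
  ... | false = refl

  swap-+ : ∀ (f : ℕ → ℕ) t r → f (T′ t r) + f (U′ t r) ≡ f (T t r) + f (U t r)
  swap-+ f t r with W t r
  ... | true  = +-comm (f (U t r)) (f (T t r))
  ... | false = refl

  swap-∑ : ∀ (f : ℕ → ℕ) t → ∑ R (λ r → f (T′ t r)) + ∑ R (λ r → f (U′ t r)) ≡ ∑ R (λ r → f (T t r)) + ∑ R (λ r → f (U t r))
  swap-∑ f t = trans (sym (∑-+ R _ _)) (trans (∑-cong R (swap-+ f t)) (∑-+ R _ _))

  swap-s : ∀ c t → s T′ U′ c t ≡ s T U c t
  swap-s c = swap-∑ (_∸ c)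

  module _
    (neg  : ∀ t r → W t r ≡ true → T t r < U t r)
    (vert : ∀ t r → mn T U (suc t) r < mx T U t r → W t r ≡ W (suc t) r)
    (diag : ∀ t r → mn T U t r < mx T U (suc t) (suc r) → W t r ≡ W (suc t) (suc r))
    where

    private
      ≤mx : ∀ b t r → (if b then U t r else T t r) ≤ mx T U t r
      ≤mx true  t r = m≤n⊔m _ _
      ≤mx false t r = m≤m⊔n _ _
      mn≤ : ∀ b t r → mn T U t r ≤ (if b then U t r else T t r)
      mn≤ true  t r = m⊓n≤n _ _
      mn≤ false t r = m⊓n≤m _ _
      if-not : ∀ b {x y : ℕ} → (if b then x else y) ≡ (if not b then y else x)
      if-not true  = refl
      if-not false = refl

      -- Where `W` may differ at the two positions, the larger value at the one is at most the
      -- smaller value at the other, so every choice satisfies the inequality; where `W` agrees, the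
      -- two inequalities are kept or trade places.
      pick : ∀ {t r t′ r′} → T t r ≤ T t′ r′ → U t r ≤ U t′ r′ →
        (mn T U t′ r′ < mx T U t r → W t r ≡ W t′ r′) →
        T′ t r ≤ T′ t′ r′ × U′ t r ≤ U′ t′ r′
      pick {t} {r} {t′} {r′} p q e with mx T U t r ≤? mn T U t′ r′
      ... | yes le = ≤-trans (≤mx (W t r) t r) (≤-trans le (mn≤ (W t′ r′) t′ r′)) ,
                     subst₂ _≤_ (sym (if-not (W t r))) (sym (if-not (W t′ r′)))
                       (≤-trans (≤mx (not (W t r)) t r) (≤-trans le (mn≤ (not (W t′ r′)) t′ r′)))
      ... | no nle with W t r | W t′ r′ | e (≰⇒> nle)
      ...   | true  | true  | _ = q , p
      ...   | false | false | _ = p , q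

      nul : ∀ b t r → R ≤ r → (if b then U t r else T t r) ≡ 0
      nul true  t r le = Chain.null chU t r le
      nul false t r le = Chain.null chT t r le

    private
      vert′ : ∀ t r → T′ t r ≤ T′ (suc t) r × U′ t r ≤ U′ (suc t) r
      vert′ t r = pick (Chain.mono chT t r) (Chain.mono chU t r) (vert t r)
      diag′ : ∀ t r → T′ (suc t) (suc r) ≤ T′ t r × U′ (suc t) (suc r) ≤ U′ t r
      diag′ t r = pick (Chain.strip chT t r) (Chain.strip chU t r) (sym ∘ diag t r)

    swap-chainˡ : Chain R T′
    swap-chainˡ = record
      { mono = λ t r → proj₁ (vert′ t r) ; strip = λ t r → proj₁ (diag′ t r) ; null = λ t r → nul (W t r) t r }

    swap-chainʳ : Chain R U′
    swap-chainʳ = record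
      { mono = λ t r → proj₂ (vert′ t r) ; strip = λ t r → proj₂ (diag′ t r)
      ; null = λ t r le → trans (if-not (W t r)) (nul (not (W t r)) t r le) }

    private
      module C = Chain swap-chainˡ
      module D = Chain swap-chainʳ

      bothˡ : ∀ (Q : ℕ → Set) {t r} → Q (T′ t r) → Q (U′ t r) → Q (T t r)
      bothˡ Q {t} {r} p q with W t r
      ... | true  = q
      ... | false = p
      bothʳ : ∀ (Q : ℕ → Set) {t r} → Q (T′ t r) → Q (U′ t r) → Q (U t r)
      bothʳ Q {t} {r} p q with W t r
      ... | true  = p
      ... | false = q

      unswapped : ∀ t r → T′ t r < U′ t r → W t r ≡ false
      unswapped t r lt with W t r in eq
      ... | true  = ⊥-elim (<-asym lt (neg t r eq))
      ... | false = refl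

      plainˡ : ∀ {t r} → W t r ≡ false → T′ t r ≡ T t r
      plainˡ e rewrite e = refl
      plainʳ : ∀ {t r} → W t r ≡ false → U′ t r ≡ U t r
      plainʳ e rewrite e = refl
      crossˡ : ∀ {t r} → W t r ≡ true → T′ t r ≡ U t r
      crossˡ e rewrite e = refl
      crossʳ : ∀ {t r} → W t r ≡ true → U′ t r ≡ T t r
      crossʳ e rewrite e = refl

    -- The clauses of `Bad` at times `k` and `k + 2` turn out to hold for both tableaux, so they are
    -- blind to the exchange. Only the positions in rows `r` and `q` at time `k + 1` have to be
    -- examined.
    swap-yam : Yam T U → Yam T′ U′
    swap-yam y = record { concave = conc ; noˡ = left-ok ; noʳ = right-ok }
      where
      conc : ∀ k c → Concave (s T′ U′ c) k
      conc k c rewrite swap-s c k | swap-s c (suc k) | swap-s c (2 + k) = Yam.concave y k c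

      bal : ∀ {k c} → Balanced (s T′ U′ (suc c)) k → Balanced (s T U (suc c)) k
      bal {k} {c} e rewrite swap-s (suc c) k | swap-s (suc c) (suc k) | swap-s (suc c) (2 + k) = e

      left-ok : ∀ k c r q → Balanced (s T′ U′ (suc c)) k → ¬ Bad _≤_ T′ U′ k c r q
      left-ok k c r q e b = Yam.noˡ y k c r q (bal {k} {c} e) (record
        { rows  = rows
        ; T-out = subst (_≤ c) (plainˡ w-r) T-out
        ; T-in  = bothˡ (c <_) T-in (≤-trans c<Ur (D.mono (suc k) r))
        ; T-up  = λ { refl → bothˡ (c <_) (T-up refl) (≤-trans c<Ur (D.strip k _)) }
        ; U-out = bothʳ (_≤ c) (≤-trans (C.mono k q) Tq≤c) U-out
        ; U-end = trans (sym (plainʳ w-q)) U-end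
        ; U-low = bothʳ (_≤ c) (≤-trans (C.strip (suc k) q) Tq≤c) U-low
        })
        where
        open Bad b
        c<Uq : c < U′ (suc k) q
        c<Uq = ≤-reflexive (sym U-end)
        c<Ur : c < U′ (suc k) r
        c<Ur = ≤-trans c<Uq (antitone (D.anti (suc k)) rows)
        Tq≤c : T′ (suc k) q ≤ c
        Tq≤c = ≤-trans (antitone (C.anti (suc k)) rows) T-out
        -- Here `T′ < U′`, whereas an exchanged position carries its larger value in the first
        -- tableau.
        w-r : W (suc k) r ≡ false
        w-r = unswapped (suc k) r (≤-trans (s≤s T-out) c<Ur)
        w-q : W (suc k) q ≡ false
        w-q = unswapped (suc k) q (≤-trans (s≤s Tq≤c) c<Uq)

      right-ok : ∀ k c q r → Balanced (s T′ U′ (suc c)) k → ¬ Bad _<_ U′ T′ k c q r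
      right-ok k c q r e b = finish (W (suc k) q) refl
        where
        open Bad b renaming (T-out to U-out′; T-in to U-in; T-up to U-up; U-out to T-out; U-end to T-end; U-low to T-low)
        c<T : ∀ {x} → x ≤ r → c < T′ (suc k) x
        c<T le = ≤-trans (≤-reflexive (sym T-end)) (antitone (C.anti (suc k)) le)
        U≤c : ∀ {x} → q ≤ x → U′ (suc k) x ≤ c
        U≤c le = ≤-trans (antitone (D.anti (suc k)) le) U-out′
        -- In all rows from `q` to `r` one has `U′ ≤ c < T′` at time `k + 1`. Rows `x` and `x + 1`
        -- are then tied together through the position `(k , x)`, so that `W` is constant on this
        -- stretch.
        link : ∀ x → q ≤ x → suc x ≤ r → W (suc k) x ≡ W (suc k) (suc x)
        link x l h = trans
          (sym (vert k x (subst₂ _<_ (swap-mn (suc k) x) (swap-mx k x)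
            (≤-trans (s≤s (≤-trans (m⊓n≤n _ _) (U≤c l))) (≤-trans (c<T h) (≤-trans (C.strip k x) (m≤m⊔n _ _)))))))
          (diag k x (subst₂ _<_ (swap-mn k x) (swap-mx (suc k) (suc x))
            (≤-trans (s≤s (≤-trans (m⊓n≤n _ _) (≤-trans (D.mono k x) (U≤c l)))) (≤-trans (c<T h) (m≤m⊔n _ _)))))
        links : ∀ {x} → q ≤′ x → x ≤ r → W (suc k) q ≡ W (suc k) x
        links ≤′-refl       _ = refl
        links (≤′-step {x} l) h = trans (links l (<⇒≤ h)) (link x (≤′⇒≤ l) h)
        W-same : W (suc k) q ≡ W (suc k) r
        W-same = links (≤⇒≤′ (<⇒≤ rows)) ≤-refl
        q≤r : q ≤ r
        q≤r = <⇒≤ rows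
        finish : ∀ w → W (suc k) q ≡ w → ⊥
        finish false eq = Yam.noʳ y k c q r (bal {k} {c} e) (record
          { rows  = rows
          ; T-out = subst (_≤ c) (plainʳ eq) U-out′
          ; T-in  = bothʳ (c <_) (≤-trans (c<T q≤r) (C.mono (suc k) q)) U-in
          ; T-up  = λ { refl → bothʳ (c <_) (≤-trans (c<T q≤r) (C.strip k _)) (U-up refl) }
          ; U-out = bothˡ (_≤ c) T-out (≤-trans (D.mono k r) (U≤c q≤r))
          ; U-end = trans (sym (plainˡ (trans (sym W-same) eq))) T-end
          ; U-low = bothˡ (_≤ c) T-low (≤-trans (D.strip (suc k) r) (U≤c q≤r))
          })
        -- Undoing the exchange reverses the roles of the two tableaux: a strict violation with `U′`
        -- first becomes a weak one with `T` first.
        finish true eq = Yam.noˡ y k c q r (bal {k} {c} e) (record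
          { rows  = q≤r
          ; T-out = subst (_≤ c) (crossʳ eq) U-out′
          ; T-in  = bothˡ (c <_) (≤-trans (c<T q≤r) (C.mono (suc k) q)) U-in
          ; T-up  = λ { refl → bothˡ (c <_) (≤-trans (c<T q≤r) (C.strip k _)) (U-up refl) }
          ; U-out = bothʳ (_≤ c) T-out (≤-trans (D.mono k r) (U≤c q≤r))
          ; U-end = trans (sym (crossˡ (trans (sym W-same) eq))) T-end
          ; U-low = bothʳ (_≤ c) T-low (≤-trans (D.strip (suc k) r) (U≤c q≤r))
          })

-- The set to be swapped: the components, in the graph of forced coincidences, of the boundary
-- positions where the first tableau is strictly smaller.
module Flip (R m : ℕ) (lam mu nu rho : ℕ → ℕ) where

  V : Set
  V = ℕ × ℕ

  open Reach {V}

  _≟V_ : ∀ (u v : V) → Dec (u ≡ v)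
  _≟V_ = ≡-dec _≟_ _≟_

  verts : List V
  verts = cartesianProduct (upTo (suc m)) (upTo R)

  Seed : V → Set
  Seed (t , r) = (t ≡ 0 × mu r < rho r) ⊎ (t ≡ m × lam r < nu r)

  seed? : ∀ v → Dec (Seed v)
  seed? (t , r) = ((t ≟ 0) ×-dec (mu r <? rho r)) ⊎-dec ((t ≟ m) ×-dec (lam r <? nu r))

  module Graph (T U : Fun) where

    Link : V → V → Set
    Link (t , r) (t′ , r′) = t′ ≡ suc t ×
      ((r′ ≡ r × mn T U t′ r′ < mx T U t r) ⊎ (r′ ≡ suc r × mn T U t r < mx T U t′ r′))

    Edge : V → V → Set
    Edge u v = Link u v ⊎ Link v u

    link? : ∀ u v → Dec (Link u v)
    link? (t , r) (t′ , r′) = (t′ ≟ suc t) ×-dec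
      (((r′ ≟ r) ×-dec (mn T U t′ r′ <? mx T U t r)) ⊎-dec ((r′ ≟ suc r) ×-dec (mn T U t r <? mx T U t′ r′)))

    edge? : ∀ u v → Dec (Edge u v)
    edge? u v = link? u v ⊎-dec link? v u

    In : V → Set
    In v = Any (λ p → Seed p × Path Edge verts p v) verts

    in? : ∀ v → Dec (In v)
    in? v = any? (λ p → seed? p ×-dec path? _≟V_ edge? verts p v) verts

    -- Times after `m` are identified with `m`, since the shapes no longer change; this keeps the
    -- graph finite.
    Wset : ℕ → ℕ → Bool
    Wset t r = does (in? (t ⊓ m , r))

  open Graph

  module _ {T U T′ U′} (ex : ∀ t r → mx T U t r ≡ mx T′ U′ t r) (en : ∀ t r → mn T U t r ≡ mn T′ U′ t r) where
    private
      link-cong : ∀ {u v} → Link T U u v → Link T′ U′ u v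
      link-cong {t , r} {t′ , r′} (e , inj₁ (e′ , lt)) = e , inj₁ (e′ , subst₂ _<_ (en t′ r′) (ex t r) lt)
      link-cong {t , r} {t′ , r′} (e , inj₂ (e′ , lt)) = e , inj₂ (e′ , subst₂ _<_ (en t r) (ex t′ r′) lt)

    edge-cong : ∀ {u v} → Edge T U u v → Edge T′ U′ u v
    edge-cong (inj₁ l) = inj₁ (link-cong l)
    edge-cong (inj₂ l) = inj₂ (link-cong l)

  in-cong : ∀ {T U T′ U′} → (∀ t r → mx T U t r ≡ mx T′ U′ t r) → (∀ t r → mn T U t r ≡ mn T′ U′ t r) →
    ∀ {v} → In T U v → In T′ U′ v
  in-cong ex en = Any.map (λ (s , p) → s , map-path (edge-cong ex en) verts p)

  W-cong : ∀ {T U T′ U′} → (∀ t r → mx T U t r ≡ mx T′ U′ t r) → (∀ t r → mn T U t r ≡ mn T′ U′ t r) →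
    ∀ t r → Wset T U t r ≡ Wset T′ U′ t r
  W-cong {T} {U} {T′} {U′} ex en t r with in? T U (t ⊓ m , r) | in? T′ U′ (t ⊓ m , r)
  ... | yes _ | yes _ = refl
  ... | no _  | no _  = refl
  ... | yes p | no q  = ⊥-elim (q (in-cong ex en p))
  ... | no p  | yes q = ⊥-elim (p (in-cong (λ t r → sym (ex t r)) (λ t r → sym (en t r)) q))

  module _ {T U : Fun} (chT : Chain R T) (chU : Chain R U)
    (startT : ∀ r → T 0 r ≡ mu r) (startU : ∀ r → U 0 r ≡ rho r)
    (endT : ∀ t r → m ≤ t → T t r ≡ lam r) (endU : ∀ t r → m ≤ t → U t r ≡ nu r) where
    private
      W = Wset T U

      Neg : V → Set
      Neg (t , r) = T t r < U t r

      -- If the sign changed along a link, a single tableau would supply the larger value on one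
      -- side and the smaller on the other, and its own inequality would contradict the link.
      neg-link : ∀ {u v} → Link T U u v → Neg u → Neg v
      neg-link {t , r} {_ , _} (refl , inj₁ (refl , lt)) n = ≰⇒> λ le →
        <-irrefl refl (≤-trans lt (≤-trans (≤-reflexive (m≤n⇒m⊔n≡n (<⇒≤ n)))
          (≤-trans (Chain.mono chU t r) (≤-reflexive (sym (m≥n⇒m⊓n≡n le))))))
      neg-link {t , r} {_ , _} (refl , inj₂ (refl , lt)) n = ≰⇒> λ le →
        <-irrefl refl (≤-trans lt (≤-trans (≤-reflexive (m≥n⇒m⊔n≡m le))
          (≤-trans (Chain.strip chT t r) (≤-reflexive (sym (m≤n⇒m⊓n≡m (<⇒≤ n)))))))

      neg-link⁻ : ∀ {u v} → Link T U v u → Neg u → Neg v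
      neg-link⁻ {_ , _} {t , r} (refl , inj₁ (refl , lt)) n = ≰⇒> λ le →
        <-irrefl refl (≤-trans lt (≤-trans (≤-reflexive (m≥n⇒m⊔n≡m le))
          (≤-trans (Chain.mono chT t r) (≤-reflexive (sym (m≤n⇒m⊓n≡m (<⇒≤ n)))))))
      neg-link⁻ {_ , _} {t , r} (refl , inj₂ (refl , lt)) n = ≰⇒> λ le →
        <-irrefl refl (≤-trans lt (≤-trans (≤-reflexive (m≤n⇒m⊔n≡n (<⇒≤ n)))
          (≤-trans (Chain.strip chU t r) (≤-reflexive (sym (m≥n⇒m⊓n≡n le))))))

      neg-edge : ∀ {u v} → Edge T U u v → Neg u → Neg v
      neg-edge {u} {v} (inj₁ l) = neg-link {u} {v} l
      neg-edge {u} {v} (inj₂ l) = neg-link⁻ {u} {v} l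

      seed-neg : ∀ {v} → Seed v → Neg v
      seed-neg {_ , r} (inj₁ (refl , lt)) = subst₂ _<_ (sym (startT r)) (sym (startU r)) lt
      seed-neg {_ , r} (inj₂ (refl , lt)) = subst₂ _<_ (sym (endT m r ≤-refl)) (sym (endU m r ≤-refl)) lt

      in-neg : ∀ {v} → In T U v → Neg v
      in-neg i with find i
      ... | p , _ , s , path = invariant Neg (λ {u} {v} → neg-edge {u} {v}) verts path (seed-neg s)

      vert∈ : ∀ {t r} → t ≤ m → r < R → (t , r) ∈ verts
      vert∈ t≤ r< = ∈-cartesianProduct⁺ (∈-upTo⁺ (s≤s t≤)) (∈-upTo⁺ r<)

      in-row : ∀ {t r} → Neg (t , r) → r < R
      in-row {t} {r} n = ≰⇒> λ le → <-irrefl refl (≤-trans n (≤-trans (≤-reflexive (Chain.null chU t r le)) z≤n))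

      in-edge : ∀ {t r v} → t ≤ m → Edge T U (t , r) v → In T U (t , r) → In T U v
      in-edge {t} {r} {v} t≤ e i = Any.map (λ (s , p) → s , via (vert∈ t≤ (in-row (in-neg i))) p (step verts (inj₂ e))) i

      seed-in : ∀ {t r} → t ≤ m → Seed (t , r) → In T U (t , r)
      seed-in t≤ s = lose (vert∈ t≤ (in-row (seed-neg s))) (s , step verts (inj₁ refl))

      ⊓-same : ∀ {t} → m ≤ t → t ⊓ m ≡ suc t ⊓ m
      ⊓-same le = trans (m≥n⇒m⊓n≡n le) (sym (m≥n⇒m⊓n≡n (m≤n⇒m≤1+n le)))

      dec-eq : ∀ {A B : Set} → (a? : Dec A) → (b? : Dec B) → (A → B) → (B → A) → does a? ≡ does b?
      dec-eq (yes _) (yes _) _ _ = refl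
      dec-eq (no _)  (no _)  _ _ = refl
      dec-eq (yes a) (no b)  f _ = ⊥-elim (b (f a))
      dec-eq (no a)  (yes b) _ g = ⊥-elim (a (g b))

      W⇒in : ∀ {t r} → W t r ≡ true → In T U (t ⊓ m , r)
      W⇒in {t} {r} e with in? T U (t ⊓ m , r)
      ... | yes i = i

      frozen : ∀ {F : Fun} {g : ℕ → ℕ} → (∀ t r → m ≤ t → F t r ≡ g r) → ∀ t r → F (t ⊓ m) r ≡ F t r
      frozen {F} e t r with ≤-total t m
      ... | inj₁ le = cong (λ z → F z r) (m≤n⇒m⊓n≡m le)
      ... | inj₂ le rewrite m≥n⇒m⊓n≡n le = trans (e m r ≤-refl) (sym (e t r le))

      W-end : ∀ t r → m ≤ t → W t r ≡ does (lam r <? nu r)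
      W-end t r le rewrite m≥n⇒m⊓n≡n le = dec-eq (in? T U (m , r)) (lam r <? nu r)
        (λ i → subst₂ _<_ (endT m r ≤-refl) (endU m r ≤-refl) (in-neg i))
        (λ lt → seed-in ≤-refl (inj₂ (refl , lt)))

      W-start : ∀ r → W 0 r ≡ does (mu r <? rho r)
      W-start r = dec-eq (in? T U (0 , r)) (mu r <? rho r)
        (λ i → subst₂ _<_ (startT r) (startU r) (in-neg i))
        (λ lt → seed-in z≤n (inj₁ (refl , lt)))

    W-neg : ∀ t r → W t r ≡ true → T t r < U t r
    W-neg t r e = subst₂ _<_ (frozen endT t r) (frozen endU t r) (in-neg (W⇒in {t} {r} e))

    W-vert : ∀ t r → mn T U (suc t) r < mx T U t r → W t r ≡ W (suc t) r
    W-vert t r lt with m ≤? t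
    ... | yes le rewrite ⊓-same le = refl
    ... | no nle rewrite m≤n⇒m⊓n≡m (<⇒≤ (≰⇒> nle)) | m≤n⇒m⊓n≡m (≰⇒> nle) =
      dec-eq (in? T U (t , r)) (in? T U (suc t , r))
        (in-edge (<⇒≤ (≰⇒> nle)) (inj₁ (refl , inj₁ (refl , lt))))
        (in-edge (≰⇒> nle) (inj₂ (refl , inj₁ (refl , lt))))

    W-diag : ∀ t r → mn T U t r < mx T U (suc t) (suc r) → W t r ≡ W (suc t) (suc r)
    W-diag t r lt with m ≤? t
    -- Both positions are frozen at time `m`, in different rows, where the graph offers no edge; the
    -- comparison of the final shapes takes its place.
    ... | yes le = trans (W-end t r le) (trans (dec-eq (lam r <? nu r) (lam (suc r) <? nu (suc r)) to from) (sym (W-end (suc t) (suc r) (m≤n⇒m≤1+n le))))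
      where
      lt′ : lam r ⊓ nu r < lam (suc r) ⊔ nu (suc r)
      lt′ = subst₂ _<_ (cong₂ _⊓_ (endT t r le) (endU t r le))
        (cong₂ _⊔_ (endT (suc t) (suc r) (m≤n⇒m≤1+n le)) (endU (suc t) (suc r) (m≤n⇒m≤1+n le))) lt
      lam-anti : lam (suc r) ≤ lam r
      lam-anti = subst₂ _≤_ (endT t (suc r) le) (endT t r le) (Chain.anti chT t r)
      nu-anti : nu (suc r) ≤ nu r
      nu-anti = subst₂ _≤_ (endU t (suc r) le) (endU t r le) (Chain.anti chU t r)
      to : lam r < nu r → lam (suc r) < nu (suc r)
      to p = ≰⇒> λ q → <-irrefl refl (≤-trans lt′ (≤-trans (≤-reflexive (m≥n⇒m⊔n≡m q))
        (≤-trans lam-anti (≤-reflexive (sym (m≤n⇒m⊓n≡m (<⇒≤ p)))))))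
      from : lam (suc r) < nu (suc r) → lam r < nu r
      from p = ≰⇒> λ q → <-irrefl refl (≤-trans lt′ (≤-trans (≤-reflexive (m≤n⇒m⊔n≡n (<⇒≤ p)))
        (≤-trans nu-anti (≤-reflexive (sym (m≥n⇒m⊓n≡n q))))))
    ... | no nle rewrite m≤n⇒m⊓n≡m (<⇒≤ (≰⇒> nle)) | m≤n⇒m⊓n≡m (≰⇒> nle) =
      dec-eq (in? T U (t , r)) (in? T U (suc t , suc r))
        (in-edge (<⇒≤ (≰⇒> nle)) (inj₁ (refl , inj₂ (refl , lt))))
        (in-edge (≰⇒> nle) (inj₂ (refl , inj₂ (refl , lt))))

    private
      sorted : ∀ {x y} (d : Dec (x < y)) → (if does d then y else x) ≡ x ⊔ y × (if does d then x else y) ≡ x ⊓ y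
      sorted (yes p) = sym (m≤n⇒m⊔n≡n (<⇒≤ p)) , sym (m≤n⇒m⊓n≡m (<⇒≤ p))
      sorted (no ¬p) = sym (m≥n⇒m⊔n≡m (≮⇒≥ ¬p)) , sym (m≥n⇒m⊓n≡n (≮⇒≥ ¬p))

    flip-startˡ : ∀ r → swapˡ W T U 0 r ≡ mu r ⊔ rho r
    flip-startˡ r rewrite W-start r | startT r | startU r = proj₁ (sorted (mu r <? rho r))

    flip-startʳ : ∀ r → swapʳ W T U 0 r ≡ mu r ⊓ rho r
    flip-startʳ r rewrite W-start r | startT r | startU r = proj₂ (sorted (mu r <? rho r))

    flip-endˡ : ∀ t r → m ≤ t → swapˡ W T U t r ≡ lam r ⊔ nu r
    flip-endˡ t r le rewrite W-end t r le | endT t r le | endU t r le = proj₁ (sorted (lam r <? nu r))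

    flip-endʳ : ∀ t r → m ≤ t → swapʳ W T U t r ≡ lam r ⊓ nu r
    flip-endʳ t r le rewrite W-end t r le | endT t r le | endU t r le = proj₂ (sorted (lam r <? nu r))

  -- The graph depends on the unordered pair of values only, so it can be recovered after the swap.
  flip-injective : ∀ {T₁ U₁ T₂ U₂} →
    (∀ t r → swapˡ (Wset T₁ U₁) T₁ U₁ t r ≡ swapˡ (Wset T₂ U₂) T₂ U₂ t r) →
    (∀ t r → swapʳ (Wset T₁ U₁) T₁ U₁ t r ≡ swapʳ (Wset T₂ U₂) T₂ U₂ t r) →
    ∀ t r → T₁ t r ≡ T₂ t r × U₁ t r ≡ U₂ t r
  flip-injective {T₁} {U₁} {T₂} {U₂} eˡ eʳ t r =
    undo (W-cong (unordered T₁ U₁ T₂ U₂ _⊔_ ⊔-comm eˡ eʳ) (unordered T₁ U₁ T₂ U₂ _⊓_ ⊓-comm eˡ eʳ) t r) (eˡ t r) (eʳ t r)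
    where
    swap-op : ∀ (_∙_ : ℕ → ℕ → ℕ) → (∀ x y → x ∙ y ≡ y ∙ x) → ∀ W T U t r →
      swapˡ W T U t r ∙ swapʳ W T U t r ≡ T t r ∙ U t r
    swap-op _∙_ comm W T U t r with W t r
    ... | true  = comm (U t r) (T t r)
    ... | false = refl
    unordered : ∀ T₁ U₁ T₂ U₂ (_∙_ : ℕ → ℕ → ℕ) → (∀ x y → x ∙ y ≡ y ∙ x) →
      (∀ t r → swapˡ (Wset T₁ U₁) T₁ U₁ t r ≡ swapˡ (Wset T₂ U₂) T₂ U₂ t r) →
      (∀ t r → swapʳ (Wset T₁ U₁) T₁ U₁ t r ≡ swapʳ (Wset T₂ U₂) T₂ U₂ t r) →
      ∀ t r → T₁ t r ∙ U₁ t r ≡ T₂ t r ∙ U₂ t r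
    unordered T₁ U₁ T₂ U₂ _∙_ comm p q t r = trans (sym (swap-op _∙_ comm (Wset T₁ U₁) T₁ U₁ t r))
      (trans (cong₂ _∙_ (p t r) (q t r)) (swap-op _∙_ comm (Wset T₂ U₂) T₂ U₂ t r))
    undo : ∀ {t r} → Wset T₁ U₁ t r ≡ Wset T₂ U₂ t r →
      swapˡ (Wset T₁ U₁) T₁ U₁ t r ≡ swapˡ (Wset T₂ U₂) T₂ U₂ t r →
      swapʳ (Wset T₁ U₁) T₁ U₁ t r ≡ swapʳ (Wset T₂ U₂) T₂ U₂ t r → T₁ t r ≡ T₂ t r × U₁ t r ≡ U₂ t r
    undo {t} {r} e p q with Wset T₁ U₁ t r | Wset T₂ U₂ t r
    undo refl p q | true  | true  = q , p
    undo refl p q | false | false = p , q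

-- Sign-reversing cancellation

set⇒↭ : {A : Set} {xs ys : List A} → Unique xs → Unique ys → (∀ {z} → z ∈ xs → z ∈ ys) → (∀ {z} → z ∈ ys → z ∈ xs) → xs ↭ ys
set⇒↭ u v to from = ∼bag⇒↭ (unique∧set⇒bag u v (mk⇔ to from))

unique-map : {A B : Set} (f : A → B) {xs : List A} → (∀ {x y} → x ∈ xs → y ∈ xs → f x ≡ f y → x ≡ y) → Unique xs → Unique (map f xs)
unique-map f {[]}     inj [] = []
unique-map f {x ∷ xs} inj (ne ∷ u) =
  All.map⁺ (All.tabulate (λ i e → All.lookup ne i (inj (here refl) (there i) e))) ∷
  unique-map f (λ i j → inj (there i) (there j)) u

bijection⇒↭ : {A B : Set} (f : A → B) {xs : List A} {ys : List B} → Unique xs → Unique ys →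
  (∀ {x} → x ∈ xs → f x ∈ ys) → (∀ {x y} → x ∈ xs → y ∈ xs → f x ≡ f y → x ≡ y) →
  (∀ {y} → y ∈ ys → ∃ λ x → x ∈ xs × f x ≡ y) → map f xs ↭ ys
bijection⇒↭ f {xs} {ys} u v to inj sur = set⇒↭ (unique-map f inj u) v fwd bwd
  where
  fwd : ∀ {z} → z ∈ map f xs → z ∈ ys
  fwd i with ∈-map⁻ f i
  ... | x , x∈ , refl = to x∈
  bwd : ∀ {z} → z ∈ ys → z ∈ map f xs
  bwd i with sur i
  ... | x , x∈ , refl = ∈-map⁺ f x∈

injection⇒↭ : {A B : Set} → (∀ (x y : B) → Dec (x ≡ y)) → (f : A → B) {xs : List A} {ys : List B} → Unique xs → Unique ys →
  (∀ {x} → x ∈ xs → f x ∈ ys) → (∀ {x y} → x ∈ xs → y ∈ xs → f x ≡ f y → x ≡ y) →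
  ∃ λ rest → (∀ {y} → y ∈ rest → y ∈ ys) × ys ↭ map f xs ++ rest
injection⇒↭ _≟_ f {xs} {ys} u v to inj = rest , proj₁ ∘ ∈-filter⁻ out? , set⇒↭ v
    (Unique.++⁺ (unique-map f inj u) (Unique.filter⁺ out? v) (λ (i , j) → proj₂ (∈-filter⁻ out? {xs = ys} j) i)) fwd bwd
  where
  out? : ∀ y → Dec (y ∉ map f xs)
  out? y = ¬? (any? (y ≟_) (map f xs))
  rest = filter out? ys
  fwd : ∀ {z} → z ∈ ys → z ∈ map f xs ++ rest
  fwd {z} i with any? (z ≟_) (map f xs)
  ... | yes j = ∈-++⁺ˡ j
  ... | no ¬j = ∈-++⁺ʳ (map f xs) (∈-filter⁺ out? i ¬j)
  bwd : ∀ {z} → z ∈ map f xs ++ rest → z ∈ ys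
  bwd i with ∈-++⁻ (map f xs) i
  ... | inj₂ j = proj₁ (∈-filter⁻ out? j)
  ... | inj₁ j with ∈-map⁻ f j
  ...   | x , x∈ , refl = to x∈

Σℤ : {A : Set} → (A → ℤ) → List A → ℤ
Σℤ f []       = 0ℤ
Σℤ f (x ∷ xs) = f x ⊕ Σℤ f xs

Σℤ-↭ : {A : Set} (f : A → ℤ) {xs ys : List A} → xs ↭ ys → Σℤ f xs ≡ Σℤ f ys
Σℤ-↭ f ↭.refl = refl
Σℤ-↭ f (↭.prep x p) = cong (f x ⊕_) (Σℤ-↭ f p)
Σℤ-↭ f (↭.swap x y p) rewrite Σℤ-↭ f p = trans (sym (ℤ.+-assoc (f x) (f y) _))
  (trans (cong (_⊕ _) (ℤ.+-comm (f x) (f y))) (ℤ.+-assoc (f y) (f x) _))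
Σℤ-↭ f (↭.trans p q) = trans (Σℤ-↭ f p) (Σℤ-↭ f q)

Σℤ-cong : {A : Set} {f g : A → ℤ} (xs : List A) → (∀ {x} → x ∈ xs → f x ≡ g x) → Σℤ f xs ≡ Σℤ g xs
Σℤ-cong []       e = refl
Σℤ-cong (x ∷ xs) e = cong₂ _⊕_ (e (here refl)) (Σℤ-cong xs (e ∘ there))

Σℤ-map : {A B : Set} (f : B → ℤ) (g : A → B) (xs : List A) → Σℤ f (map g xs) ≡ Σℤ (f ∘ g) xs
Σℤ-map f g []       = refl
Σℤ-map f g (x ∷ xs) = cong (f (g x) ⊕_) (Σℤ-map f g xs)

Σℤ-++ : {A : Set} (f : A → ℤ) (xs ys : List A) → Σℤ f (xs ++ ys) ≡ Σℤ f xs ⊕ Σℤ f ys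
Σℤ-++ f []       ys = sym (ℤ.+-identityˡ _)
Σℤ-++ f (x ∷ xs) ys rewrite Σℤ-++ f xs ys = sym (ℤ.+-assoc (f x) _ _)

Σℤ-concatMap : {A B : Set} (f : B → ℤ) (g : A → List B) (xs : List A) → Σℤ f (concatMap g xs) ≡ Σℤ (Σℤ f ∘ g) xs
Σℤ-concatMap f g []       = refl
Σℤ-concatMap f g (x ∷ xs) rewrite Σℤ-++ f (g x) (concatMap g xs) | Σℤ-concatMap f g xs = refl

Σℤ-neg : {A : Set} (f : A → ℤ) (xs : List A) → Σℤ (λ x → ℤ.- f x) xs ≡ ℤ.- Σℤ f xs
Σℤ-neg f []       = refl
Σℤ-neg f (x ∷ xs) rewrite Σℤ-neg f xs = sym (ℤ.neg-distrib-+ (f x) _)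

Σℤ-+ : {A : Set} (f g : A → ℤ) (xs : List A) → Σℤ (λ x → f x ⊕ g x) xs ≡ Σℤ f xs ⊕ Σℤ g xs
Σℤ-+ f g []       = refl
Σℤ-+ f g (x ∷ xs) rewrite Σℤ-+ f g xs = ar (f x) (g x) (Σℤ f xs) (Σℤ g xs)
  where
  ar : ∀ a b c d → a ⊕ b ⊕ (c ⊕ d) ≡ a ⊕ c ⊕ (b ⊕ d)
  ar = ℤSolver.solve-∀

Σℤ-0 : {A : Set} {f : A → ℤ} (xs : List A) → (∀ {x} → x ∈ xs → f x ≡ 0ℤ) → Σℤ f xs ≡ 0ℤ
Σℤ-0 []       e = refl
Σℤ-0 (x ∷ xs) e rewrite e (here refl) | Σℤ-0 xs (e ∘ there) = refl

Σℤ-*ˡ : {A : Set} (c : ℤ) (f : A → ℤ) (xs : List A) → Σℤ (λ x → c ℤ.* f x) xs ≡ c ℤ.* Σℤ f xs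
Σℤ-*ˡ c f []       = sym (ℤ.*-zeroʳ c)
Σℤ-*ˡ c f (x ∷ xs) rewrite Σℤ-*ˡ c f xs = sym (ℤ.*-distribˡ-+ c (f x) _)

Σℤ-comm : {A B : Set} (f : A → B → ℤ) (xs : List A) (ys : List B) →
  Σℤ (λ x → Σℤ (f x) ys) xs ≡ Σℤ (λ y → Σℤ (λ x → f x y) xs) ys
Σℤ-comm f []       ys = sym (Σℤ-0 ys (λ _ → refl))
Σℤ-comm f (x ∷ xs) ys rewrite Σℤ-comm f xs ys = sym (Σℤ-+ (f x) _ ys)

Σℤ-filter : {A : Set} {P : A → Set} (P? : ∀ x → Dec (P x)) (f : A → ℤ) (xs : List A) →
  Σℤ f xs ≡ Σℤ f (filter P? xs) ⊕ Σℤ f (filter (¬? ∘ P?) xs)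
Σℤ-filter P? f [] = refl
Σℤ-filter P? f (x ∷ xs) with P? x
... | yes _ = trans (cong (f x ⊕_) (Σℤ-filter P? f xs)) (sym (ℤ.+-assoc (f x) _ _))
... | no _  = trans (cong (f x ⊕_) (Σℤ-filter P? f xs)) (ℤ-left-comm (f x) (Σℤ f (filter P? xs)) (Σℤ f (filter (¬? ∘ P?) xs)))
  where
  ℤ-left-comm : ∀ a b c → a ⊕ (b ⊕ c) ≡ b ⊕ (a ⊕ c)
  ℤ-left-comm = ℤSolver.solve-∀

self-negative : ∀ (x : ℤ) → x ≡ ℤ.- x → x ≡ 0ℤ
self-negative (ℤ.+ zero) _ = refl
self-negative (ℤ.+ suc n) ()
self-negative ℤ.-[1+ n ] ()

sign-reversing : {A : Set} (ι : A → A) (f : A → ℤ) {xs : List A} → Unique xs → (∀ {x} → x ∈ xs → ι x ∈ xs) →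
  (∀ {x} → x ∈ xs → ι (ι x) ≡ x) → (∀ {x} → x ∈ xs → f (ι x) ≡ ℤ.- f x) → Σℤ f xs ≡ 0ℤ
sign-reversing ι f {xs} u cl inv neg = self-negative _ (begin
  Σℤ f xs               ≡⟨ Σℤ-↭ f (↭-sym perm) ⟩
  Σℤ f (map ι xs)       ≡⟨ Σℤ-map f ι xs ⟩
  Σℤ (f ∘ ι) xs         ≡⟨ Σℤ-cong xs neg ⟩
  Σℤ (λ x → ℤ.- f x) xs ≡⟨ Σℤ-neg f xs ⟩
  ℤ.- Σℤ f xs           ∎)
  where
  open ≡-Reasoning
  perm : map ι xs ↭ xs
  perm = bijection⇒↭ ι u u cl (λ i j e → trans (sym (inv i)) (trans (cong ι e) (inv j)))
    (λ {y} i → ι y , cl i , inv i)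

-- Elements exhibiting one of the features are cancelled feature by feature; the features are
-- listed in reverse order of elimination, _≼_ relating a feature to those eliminated before it.
module Elimination {X I : Set} (Ev : I → X → Set) (Ev? : ∀ i x → Dec (Ev i x)) (ι : I → X → X) (f : X → ℤ)
  (_≼_ : I → I → Set) {xs : List X} (u : Unique xs)
  (closed : ∀ {i x} → x ∈ xs → Ev i x → ι i x ∈ xs × Ev i (ι i x) × ι i (ι i x) ≡ x × f (ι i x) ≡ ℤ.- f x)
  (stable : ∀ {i i′ x} → x ∈ xs → Ev i x → i′ ≼ i → Ev i′ (ι i x) → Ev i′ x) where

  clear? : ∀ js x → Dec (All (λ i → ¬ Ev i x) js)
  clear? js x = all? (λ i → ¬? (Ev? i x)) js

  -- The elements left over by the earlier features and showing `j` cancel among themselves: by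
  -- `stable`, `ι j` brings back none of the earlier features, so it maps this set to itself.
  eliminate : ∀ js → AllPairs (λ i i′ → i′ ≼ i) js → Σℤ f xs ≡ Σℤ f (filter (clear? js) xs)
  eliminate [] [] = cong (Σℤ f) (sym (all-kept xs))
    where
    all-kept : ∀ xs → filter (clear? []) xs ≡ xs
    all-kept []       = refl
    all-kept (x ∷ xs) = cong (x ∷_) (all-kept xs)
  eliminate (j ∷ js) (le ∷ ps) = begin
    Σℤ f xs                                                      ≡⟨ eliminate js ps ⟩
    Σℤ f ys                                                      ≡⟨ Σℤ-filter (Ev? j) f ys ⟩
    Σℤ f (filter (Ev? j) ys) ⊕ Σℤ f (filter (¬? ∘ Ev? j) ys)   ≡⟨ cong (_⊕ Σℤ f (filter (¬? ∘ Ev? j) ys)) zero-part ⟩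
    0ℤ ⊕ Σℤ f (filter (¬? ∘ Ev? j) ys)                         ≡⟨ ℤ.+-identityˡ _ ⟩
    Σℤ f (filter (¬? ∘ Ev? j) ys)                                ≡⟨ Σℤ-↭ f rest ⟩
    Σℤ f (filter (clear? (j ∷ js)) xs)                           ∎
    where
    open ≡-Reasoning
    ys = filter (clear? js) xs
    uy : Unique ys
    uy = Unique.filter⁺ (clear? js) u
    mem : ∀ {x} → x ∈ filter (Ev? j) ys → x ∈ xs × All (λ i → ¬ Ev i x) js × Ev j x
    mem i with ∈-filter⁻ (Ev? j) {xs = ys} i
    ... | i′ , e with ∈-filter⁻ (clear? js) {xs = xs} i′
    ...   | i″ , c = i″ , c , e
    zero-part : Σℤ f (filter (Ev? j) ys) ≡ 0ℤ
    zero-part = sign-reversing (ι j) f (Unique.filter⁺ (Ev? j) uy) cl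
      (λ i → let (x∈ , _ , e) = mem i in proj₁ (proj₂ (proj₂ (closed x∈ e))))
      (λ i → let (x∈ , _ , e) = mem i in proj₂ (proj₂ (proj₂ (closed x∈ e))))
      where
      cl : ∀ {x} → x ∈ filter (Ev? j) ys → ι j x ∈ filter (Ev? j) ys
      cl i with mem i
      ... | x∈ , c , e with closed x∈ e
      ...   | x′∈ , e′ , _ = ∈-filter⁺ (Ev? j) (∈-filter⁺ (clear? js) x′∈
                (All.tabulate λ {i′} k ev → All.lookup c k (stable x∈ e (All.lookup le k) ev))) e′
    rest : filter (¬? ∘ Ev? j) ys ↭ filter (clear? (j ∷ js)) xs
    rest = set⇒↭ (Unique.filter⁺ (¬? ∘ Ev? j) uy) (Unique.filter⁺ (clear? (j ∷ js)) u) to from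
      where
      to : ∀ {z} → z ∈ filter (¬? ∘ Ev? j) ys → z ∈ filter (clear? (j ∷ js)) xs
      to i with ∈-filter⁻ (¬? ∘ Ev? j) {xs = ys} i
      ... | i′ , e with ∈-filter⁻ (clear? js) {xs = xs} i′
      ...   | i″ , c = ∈-filter⁺ (clear? (j ∷ js)) i″ (e ∷ c)
      from : ∀ {z} → z ∈ filter (clear? (j ∷ js)) xs → z ∈ filter (¬? ∘ Ev? j) ys
      from i with ∈-filter⁻ (clear? (j ∷ js)) {xs = xs} i
      ... | i′ , e ∷ c = ∈-filter⁺ (¬? ∘ Ev? j) (∈-filter⁺ (clear? js) i′ c) e

allPairs-× : ∀ {A B : Set} {P : A → A → Set} {Q : B → B → Set} {xs ys} → AllPairs P xs → AllPairs Q ys →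
  AllPairs (λ (x , y) (x′ , y′) → P x x′ ⊎ (x ≡ x′ × Q y y′)) (cartesianProduct xs ys)
allPairs-× [] q = []
allPairs-× {xs = x ∷ xs} {ys} (p ∷ ps) q = AllPairs.++⁺
  (AllPairs.map⁺ (AllPairs.map (λ r → inj₂ (refl , r)) q)) (allPairs-× ps q)
  (All.map⁺ (All.tabulate λ {y} _ → All.tabulate λ {v} i → inj₁ (All.lookup p (proj₁ (∈-cartesianProduct⁻ xs ys i)))))

allPairs-⊤ : {A : Set} (xs : List A) → AllPairs (λ _ _ → ⊤) xs
allPairs-⊤ []       = []
allPairs-⊤ (x ∷ xs) = All.tabulate (λ _ → tt) ∷ allPairs-⊤ xs

unique-concatMap : {A B : Set} (F : A → List B) {xs : List A} → Unique xs → (∀ {x} → x ∈ xs → Unique (F x)) →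
  (∀ {x y z} → x ∈ xs → y ∈ xs → z ∈ F x → z ∈ F y → x ≡ y) → Unique (concatMap F xs)
unique-concatMap F {[]} [] _ _ = []
unique-concatMap F {x ∷ xs} (ne ∷ u) uF dis = Unique.++⁺ (uF (here refl))
  (unique-concatMap F u (uF ∘ there) (λ i j → dis (there i) (there j)))
  (λ (i , j) → let (y , y∈ , z∈) = find (∈-concatMap⁻ F {xs = xs} j) in All.lookup ne y∈ (dis (here refl) (there y∈) i z∈))

-- Alternants and Schur expansions

-- Antisymmetry of x ↦ f (x - δ), δ = (m-1, …, 1, 0), under exchange of adjacent coordinates.
Alternating : (List ℕ → ℤ) → Set
Alternating f = ∀ p x y s → f (p ++ x ∷ suc y ∷ s) ≡ ⊖ f (p ++ y ∷ suc x ∷ s)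

ind : {A : Set} → Dec A → ℤ → ℤ
ind (yes _) z = z
ind (no _)  z = 0ℤ

-- Expansion along the first row of the alternant indexed by G + m and the alternants in f.
expand : (List ℕ → ℤ) → ℕ → List ℕ → ℤ
expand f G []      = 0ℤ
expand f G (x ∷ β) = ind (x ℕ.≟ G) (f β) ⊕ ⊖ expand (λ u → f (suc x ∷ u)) (suc G) β

expand-cong : ∀ {f g : List ℕ → ℤ} → (∀ u → f u ≡ g u) → ∀ G β → expand f G β ≡ expand g G β
expand-cong e G []      = refl
expand-cong e G (x ∷ β) = cong₂ (λ a b → ind (x ℕ.≟ G) a ⊕ ⊖ b) (e β) (expand-cong (λ u → e (suc x ∷ u)) (suc G) β)

ind-neg : {A : Set} (d : Dec A) (z : ℤ) → ind d (⊖ z) ≡ ⊖ ind d z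
ind-neg (yes _) z = refl
ind-neg (no _)  z = refl

expand-neg : ∀ (f : List ℕ → ℤ) G β → expand (λ u → ⊖ f u) G β ≡ ⊖ expand f G β
expand-neg f G []      = refl
expand-neg f G (x ∷ β) rewrite ind-neg (x ℕ.≟ G) (f β) | expand-neg (λ u → f (suc x ∷ u)) (suc G) β =
  sym (ℤ.neg-distrib-+ (ind (x ℕ.≟ G) (f β)) _)

ind-suc : ∀ y G (z : ℤ) → ind (suc y ℕ.≟ suc G) z ≡ ind (y ℕ.≟ G) z
ind-suc y G z with suc y ℕ.≟ suc G | y ℕ.≟ G
... | yes _ | yes _ = refl
... | no _  | no _  = refl
... | yes p | no q  = ⊥-elim (q (ℕ.suc-injective p))
... | no p  | yes q = ⊥-elim (p (cong suc q))

-- For the two leading coordinates, the terms matching one of them with `G` change places up to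
-- sign, and the remaining terms change sign because `f` does.
expand-alternating : ∀ {f} → Alternating f → ∀ G → Alternating (expand f G)
expand-alternating {f} alt G [] x y s rewrite ind-suc y G (f (suc x ∷ s)) | ind-suc x G (f (suc y ∷ s)) =
  trans (cong (λ z → ind (x ℕ.≟ G) (f (suc y ∷ s)) ⊕ ⊖ (ind (y ℕ.≟ G) (f (suc x ∷ s)) ⊕ ⊖ z))
    (trans (expand-cong (λ u → alt [] (suc x) (suc y) u) (2 ℕ.+ G) s) (expand-neg (λ u → f (suc y ∷ suc (suc x) ∷ u)) (2 ℕ.+ G) s)))
  (ar (ind (x ℕ.≟ G) (f (suc y ∷ s))) (ind (y ℕ.≟ G) (f (suc x ∷ s))) _)
  where
  ar : ∀ a b c → a ⊕ ⊖ (b ⊕ ⊖ (⊖ c)) ≡ ⊖ (b ⊕ ⊖ (a ⊕ ⊖ c))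
  ar = ℤSolver.solve-∀
expand-alternating {f} alt G (z ∷ p) x y s
  rewrite alt p x y s | ind-neg (z ℕ.≟ G) (f (p ++ y ∷ suc x ∷ s))
        | expand-alternating {λ u → f (suc z ∷ u)} (λ q → alt (suc z ∷ q)) (suc G) p x y s =
  sym (ℤ.neg-distrib-+ (ind (z ℕ.≟ G) (f (p ++ y ∷ suc x ∷ s))) _)

expand-zero : ∀ f G β → All (ℕ._< G) β → expand f G β ≡ 0ℤ
expand-zero f G []      [] = refl
expand-zero f G (x ∷ β) (x< ∷ a) with x ℕ.≟ G
... | yes refl = ⊥-elim (ℕ.<-irrefl refl x<)
... | no _ rewrite expand-zero (λ u → f (suc x ∷ u)) (suc G) β (All.map ℕ.m<n⇒m<1+n a) = refl

box : ℕ → ℕ → List (List ℕ)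
box zero    n = [ [] ]
box (suc m) n = concatMap (λ b → map (b ∷_) (box m n)) (upTo (suc n))

∈-box : ∀ {n β} → All (ℕ._≤ n) β → β ∈ box (length β) n
∈-box [] = here refl
∈-box {n} {b ∷ β} (b≤ ∷ a) = ∈-concatMap⁺ (λ b → map (b ∷_) (box (length β) n))
  (lose (∈-upTo⁺ (s≤s b≤)) (∈-map⁺ (b ∷_) (∈-box a)))

box-length : ∀ m n {β} → β ∈ box m n → length β ≡ m
box-length zero    n (here refl) = refl
box-length (suc m) n i with find (∈-concatMap⁻ (λ b → map (b ∷_) (box m n)) {xs = upTo (suc n)} i)
... | b , _ , j with ∈-map⁻ (b ∷_) j
...   | β , k , refl = cong suc (box-length m n k)

unique-box : ∀ m n → Unique (box m n)
unique-box zero    n = [] ∷ []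
unique-box (suc m) n = unique-concatMap _ (Unique.upTo⁺ (suc n))
  (λ _ → Unique.map⁺ (λ { refl → refl }) (unique-box m n)) dis
  where
  dis : ∀ {x y z} → x ∈ upTo (suc n) → y ∈ upTo (suc n) → z ∈ map (x ∷_) (box m n) → z ∈ map (y ∷_) (box m n) → x ≡ y
  dis {x} {y} _ _ i j with ∈-map⁻ (x ∷_) i | ∈-map⁻ (y ∷_) j
  ... | _ , _ , refl | _ , _ , refl = refl

Σℤ-box : ∀ m n (F : List ℕ → ℤ) → Σℤ F (box (suc m) n) ≡ Σℤ (λ b → Σℤ (λ β → F (b ∷ β)) (box m n)) (upTo (suc n))
Σℤ-box m n F = trans (Σℤ-concatMap F (λ b → map (b ∷_) (box m n)) (upTo (suc n))) (Σℤ-cong (upTo (suc n)) (λ {b} _ → Σℤ-map F (b ∷_) (box m n)))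

Σℤ-pick : ∀ (F : ℕ → ℤ) G {xs} → Unique xs → G ∈ xs → Σℤ (λ b → ind (b ℕ.≟ G) (F b)) xs ≡ F G
Σℤ-pick F G {x ∷ xs} (ne ∷ u) i with x ℕ.≟ G
... | yes refl = trans (cong (F x ⊕_) (Σℤ-0 xs none)) (ℤ.+-identityʳ (F x))
  where
  none : ∀ {b} → b ∈ xs → ind (b ℕ.≟ x) (F b) ≡ 0ℤ
  none {b} j with b ℕ.≟ x
  ... | yes refl = ⊥-elim (All.lookup ne j refl)
  ... | no _ = refl
Σℤ-pick F G {x ∷ xs} (ne ∷ u) (here refl) | no ¬p = ⊥-elim (¬p refl)
Σℤ-pick F G {x ∷ xs} (ne ∷ u) (there i) | no _ = trans (ℤ.+-identityˡ _) (Σℤ-pick F G u i)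

Symmetric : ∀ {A : Set} → ℕ → (List ℕ → A) → Set
Symmetric m h = ∀ p x y s → length (p ++ x ∷ y ∷ s) ≡ m → h (p ++ x ∷ y ∷ s) ≡ h (p ++ y ∷ x ∷ s)

move-front : ∀ {A : Set} {m} {h : List ℕ → A} → Symmetric m h → ∀ q p x s → length (q ++ p ++ x ∷ s) ≡ m →
  h (q ++ p ++ x ∷ s) ≡ h (q ++ x ∷ p ++ s)
move-front sy q []      x s e = refl
move-front {m = m} {h} sy q (y ∷ p) x s e = begin
  h (q ++ y ∷ p ++ x ∷ s)       ≡⟨ cong h (sym (++-assoc q [ y ] _)) ⟩
  h ((q ++ [ y ]) ++ p ++ x ∷ s) ≡⟨ move-front {h = h} sy (q ++ [ y ]) p x s (trans (cong length (++-assoc q [ y ] _)) e) ⟩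
  h ((q ++ [ y ]) ++ x ∷ p ++ s) ≡⟨ cong h (++-assoc q [ y ] _) ⟩
  h (q ++ y ∷ x ∷ p ++ s)       ≡⟨ sy q y x (p ++ s) (trans (same-length) e) ⟩
  h (q ++ x ∷ y ∷ p ++ s)       ∎
  where
  open ≡-Reasoning
  tail-length : ∀ p → length (x ∷ p ++ s) ≡ length (p ++ x ∷ s)
  tail-length p = trans (cong suc (length-++ p)) (sym (trans (length-++ p) (ℕ.+-suc (length p) (length s))))
  same-length : length (q ++ y ∷ x ∷ p ++ s) ≡ length (q ++ y ∷ p ++ x ∷ s)
  same-length = trans (length-++ q) (trans (cong (λ z → length q ℕ.+ suc z) (tail-length p)) (sym (length-++ q)))

-- Induction on the number of variables and, inside it, downward on the first exponent `G`. An
-- alternating `ε` in one variable less is lifted to `expand ε G`. In the pairing with `h`, terms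
-- with a later coordinate above `G` vanish by symmetry and the downward induction, which leaves the
-- pairing of `ε` with the slice of `h` at `G`.
alternating-vanish : ∀ m n (h : List ℕ → ℤ) → Symmetric m h →
  (∀ β → length β ≡ m → ¬ All (ℕ._≤ n) β → h β ≡ 0ℤ) →
  (∀ ε → Alternating ε → Σℤ (λ β → h β ⊛ ε β) (box m n) ≡ 0ℤ) → ∀ β → length β ≡ m → h β ≡ 0ℤ
alternating-vanish zero n h sy bd pair [] refl = trans (sym (ℤ.*-identityʳ (h []))) (trans (sym (ℤ.+-identityʳ _)) (pair ε alt))
  where
  ε : List ℕ → ℤ
  ε []      = 1ℤ
  ε (_ ∷ _) = 0ℤ
  alt : Alternating ε
  alt []      x y s = refl
  alt (_ ∷ _) x y s = refl
alternating-vanish (suc m) n h sy bd pair (g ∷ β) e = down (suc n ℕ.∸ g) g ℕ.≤-refl β (ℕ.suc-injective e)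
  where
  down : ∀ j G → suc n ℕ.∸ G ℕ.≤ j → ∀ β → length β ≡ m → h (G ∷ β) ≡ 0ℤ
  down j G le β e with suc n ℕ.≤? G
  ... | yes p = bd (G ∷ β) (cong suc e) (λ { (q ∷ _) → ℕ.<-irrefl refl (ℕ.≤-trans p q) })
  down zero    G le β e | no p = ⊥-elim (p (ℕ.m∸n≡0⇒m≤n (ℕ.n≤0⇒n≡0 le)))
  down (suc j) G le β e | no p = alternating-vanish m n (λ β → h (G ∷ β)) (λ q x y s l → sy (G ∷ q) x y s (cong suc l))
      (λ β l na → bd (G ∷ β) (cong suc l) (λ { (_ ∷ a) → na a })) pair′ β e
    where
    higher : ∀ {g} → G ℕ.< g → ∀ β → length β ≡ m → h (g ∷ β) ≡ 0ℤ
    higher {g} lt = down j g (ℕ.≤-pred (ℕ.≤-trans (s≤s (ℕ.∸-monoʳ-≤ (suc n) lt))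
      (ℕ.≤-trans (ℕ.≤-reflexive (sym (ℕ.+-∸-assoc 1 {suc n} {suc G} (ℕ.≰⇒> p)))) le)))
    kill : ∀ f b β → length β ≡ m → h (b ∷ β) ⊛ expand f (suc G) β ≡ 0ℤ
    kill f b β l with all? (ℕ._<? suc G) β
    ... | yes a rewrite expand-zero f (suc G) β a = ℤ.*-zeroʳ (h (b ∷ β))
    ... | no ¬a with find (All.¬All⇒Any¬ (ℕ._<? suc G) β ¬a)
    ...   | x , x∈ , x≮ with ∈-∃++ x∈
    -- Symmetry moves the coordinate exceeding `G` to the front, where `higher` applies.
    ...     | q , s , refl = cong (_⊛ expand f (suc G) (q ++ x ∷ s)) (trans (move-front {h = h} sy [] (b ∷ q) x s (cong suc l))
                (higher (ℕ.≮⇒≥ x≮) (b ∷ q ++ s) (trans (cong suc (length-++ q)) (trans (sym (ℕ.+-suc (length q) (length s))) (trans (sym (length-++ q)) l)))))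
    pair′ : ∀ ε → Alternating ε → Σℤ (λ β → h (G ∷ β) ⊛ ε β) (box m n) ≡ 0ℤ
    pair′ ε alt = begin
      Σℤ (λ β → h (G ∷ β) ⊛ ε β) (box m n)
        ≡⟨ sym (Σℤ-pick (λ b → Σℤ (λ β → h (b ∷ β) ⊛ ε β) (box m n)) G (Unique.upTo⁺ (suc n)) (∈-upTo⁺ (ℕ.≰⇒> p))) ⟩
      Σℤ (λ b → ind (b ℕ.≟ G) (Σℤ (λ β → h (b ∷ β) ⊛ ε β) (box m n))) (upTo (suc n))
        ≡⟨ Σℤ-cong (upTo (suc n)) (λ {b} _ → trans (ind-Σ (b ℕ.≟ G) _ (box m n)) (Σℤ-cong (box m n) (λ {β} i → term b β (box-length m n i)))) ⟩
      Σℤ (λ b → Σℤ (λ β → h (b ∷ β) ⊛ expand ε G (b ∷ β)) (box m n)) (upTo (suc n))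
        ≡⟨ sym (Σℤ-box m n (λ β → h β ⊛ expand ε G β)) ⟩
      Σℤ (λ β → h β ⊛ expand ε G β) (box (suc m) n)
        ≡⟨ pair (expand ε G) (expand-alternating alt G) ⟩
      0ℤ ∎
      where
      open ≡-Reasoning
      ind-Σ : ∀ {A : Set} (d : Dec A) (F : List ℕ → ℤ) xs → ind d (Σℤ F xs) ≡ Σℤ (λ x → ind d (F x)) xs
      ind-Σ (yes _) F xs = refl
      ind-Σ (no _)  F xs = sym (Σℤ-0 xs (λ _ → refl))
      ind-* : ∀ {A : Set} (d : Dec A) a b → ind d (a ⊛ b) ≡ a ⊛ ind d b
      ind-* (yes _) a b = refl
      ind-* (no _)  a b = sym (ℤ.*-zeroʳ a)
      ar : ∀ a b c → a ⊛ (b ⊕ ⊖ c) ≡ a ⊛ b ⊕ ⊖ (a ⊛ c)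
      ar = ℤSolver.solve-∀
      term : ∀ b β → length β ≡ m → ind (b ℕ.≟ G) (h (b ∷ β) ⊛ ε β) ≡ h (b ∷ β) ⊛ expand ε G (b ∷ β)
      term b β l = begin
        ind (b ℕ.≟ G) (h (b ∷ β) ⊛ ε β)      ≡⟨ ind-* (b ℕ.≟ G) (h (b ∷ β)) (ε β) ⟩
        h (b ∷ β) ⊛ ind (b ℕ.≟ G) (ε β)      ≡⟨ sym (ℤ.+-identityʳ _) ⟩
        h (b ∷ β) ⊛ ind (b ℕ.≟ G) (ε β) ⊕ 0ℤ ≡⟨ cong (λ z → h (b ∷ β) ⊛ ind (b ℕ.≟ G) (ε β) ⊕ ⊖ z) (sym (kill (λ u → ε (suc b ∷ u)) b β l)) ⟩
        h (b ∷ β) ⊛ ind (b ℕ.≟ G) (ε β) ⊕ ⊖ (h (b ∷ β) ⊛ expand (λ u → ε (suc b ∷ u)) (suc G) β)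
          ≡⟨ sym (ar (h (b ∷ β)) (ind (b ℕ.≟ G) (ε β)) _) ⟩
        h (b ∷ β) ⊛ expand ε G (b ∷ β) ∎

-- Tableaux as lists of shapes

at-beyond : ∀ xs {j} → length xs ≤ j → at xs j ≡ 0
at-beyond []       _        = refl
at-beyond (x ∷ xs) (s≤s le) = at-beyond xs le

at-ext : ∀ xs ys → length xs ≡ length ys → (∀ j → at xs j ≡ at ys j) → xs ≡ ys
at-ext []       []       _ _ = refl
at-ext (x ∷ xs) (y ∷ ys) l e = cong₂ _∷_ (e 0) (at-ext xs ys (suc-injective l) (e ∘ suc))

∑-front : ∀ n f → ∑ (suc n) f ≡ f 0 + ∑ n (f ∘ suc)
∑-front zero    f = +-comm 0 (f 0)
∑-front (suc n) f rewrite sym (+-assoc (f 0) (∑ n (f ∘ suc)) (f (suc n))) = cong (_+ f (suc n)) (∑-front n f)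

sum≡∑ : ∀ R xs → length xs ≤ R → sum xs ≡ ∑ R (at xs)
sum≡∑ R [] _ = sym (∑-zero R (λ _ → refl))
sum≡∑ (suc R) (x ∷ xs) (s≤s le) = trans (cong (x +_) (sum≡∑ R xs le)) (sym (∑-front R (at (x ∷ xs))))

row : ℕ → (ℕ → ℕ) → List ℕ
row R f = applyUpTo f R

at-row : ∀ R f {j} → j < R → at (row R f) j ≡ f j
at-row (suc R) f {zero}  _        = refl
at-row (suc R) f {suc j} (s≤s lt) = at-row R (f ∘ suc) lt

at-row-null : ∀ R f → (∀ j → R ≤ j → f j ≡ 0) → ∀ j → at (row R f) j ≡ f j
at-row-null R f nul j with j <? R
... | yes lt = at-row R f lt
... | no nlt = trans (at-beyond (row R f) (≤-trans (≤-reflexive (length-applyUpTo f R)) (≮⇒≥ nlt))) (sym (nul j (≮⇒≥ nlt)))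

row-cong : ∀ R {f g : ℕ → ℕ} → (∀ j → f j ≡ g j) → row R f ≡ row R g
row-cong zero    e = refl
row-cong (suc R) e = cong₂ _∷_ (e 0) (row-cong R (e ∘ suc))

row-at : ∀ xs → row (length xs) (at xs) ≡ xs
row-at []       = refl
row-at (x ∷ xs) = cong (x ∷_) (row-at xs)

get : List ℕ → List (List ℕ) → ℕ → List ℕ
get μ []      t       = μ
get μ (κ ∷ x) zero    = μ
get μ (κ ∷ x) (suc t) = get κ x t

get-zero : ∀ μ x → get μ x 0 ≡ μ
get-zero μ []      = refl
get-zero μ (κ ∷ x) = refl

fn : List ℕ → List (List ℕ) → Fun
fn μ x t r = at (get μ x t) r

tab : ℕ → ℕ → Fun → List (List ℕ)
tab R zero    F = []
tab R (suc m) F = row R (F 1) ∷ tab R m (F ∘ suc)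

tab-cong : ∀ R m {F G : Fun} → (∀ t r → F t r ≡ G t r) → tab R m F ≡ tab R m G
tab-cong R zero    e = refl
tab-cong R (suc m) e = cong₂ _∷_ (row-cong R (e 1)) (tab-cong R m (e ∘ suc))

record Tab (m : ℕ) (lam mu : ℕ → ℕ) (F : Fun) : Set where
  field
    start : ∀ r → F 0 r ≡ mu r
    end   : ∀ t r → m ≤ t → F t r ≡ lam r
    mono  : ∀ t r → F t r ≤ F (suc t) r
    strip : ∀ t r → F (suc t) (suc r) ≤ F t r

  bounded : ∀ t r → F t r ≤ lam r
  bounded t r = ≤-trans (go (m ∸ t) t (m≤n+m∸n m t)) ≤-refl
    where
    go : ∀ n t → m ≤ t + n → F t r ≤ lam r
    go zero    t le = ≤-reflexive (end t r (≤-trans le (≤-reflexive (+-identityʳ t))))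
    go (suc n) t le = ≤-trans (mono t r) (go n (suc t) (≤-trans le (≤-reflexive (+-suc t n))))

  chain : ∀ {R} → (∀ r → R ≤ r → lam r ≡ 0) → Chain R F
  chain nul = record { mono = mono ; strip = strip ; null = λ t r le → n≤0⇒n≡0 (≤-trans (bounded t r) (≤-reflexive (nul r le))) }

Cont : List ℕ → (ℕ → ℕ) → Set
Cont α w = ∀ t → w (suc t) ≡ at α t + w t

tab-fn : ∀ R μ x → All (λ κ → length κ ≡ R) x → tab R (length x) (fn μ x) ≡ x
tab-fn R μ []      []       = refl
tab-fn R μ (κ ∷ x) (l ∷ ls) = cong₂ _∷_
  (trans (row-cong R (λ r → cong (λ z → at z r) (get-zero κ x))) (subst (λ n → row n (at κ) ≡ κ) l (row-at κ)))
  (tab-fn R κ x ls)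

fn-tab : ∀ {R m lam F} μ → (∀ r → R ≤ r → lam r ≡ 0) → Tab m lam (at μ) F → ∀ t r → fn μ (tab R m F) t r ≡ F t r
fn-tab {m = zero}  μ nul T t r = trans (sym (Tab.start T r)) (trans (Tab.end T 0 r z≤n) (sym (Tab.end T t r z≤n)))
fn-tab {m = suc m} μ nul T zero r = sym (Tab.start T r)
fn-tab {R} {suc m} {lam} {F} μ nul T (suc t) r = fn-tab (row R (F 1)) nul shifted t r
  where
  open Tab T
  shifted : Tab m lam (at (row R (F 1))) (F ∘ suc)
  shifted = record
    { start = λ r → sym (at-row-null R (F 1) (λ j le → n≤0⇒n≡0 (≤-trans (bounded 1 j) (≤-reflexive (nul j le)))) r)
    ; end = λ t r le → end (suc t) r (s≤s le) ; mono = mono ∘ suc ; strip = strip ∘ suc }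

tab-lengths : ∀ R m F → All (λ κ → length κ ≡ R) (tab R m F)
tab-lengths R zero    F = []
tab-lengths R (suc m) F = length-applyUpTo (F 1) R ∷ tab-lengths R m (F ∘ suc)

∈-range⁻ : ∀ {a b k} → k ∈ range a b → a ≤ k × k ≤ b
∈-range⁻ {a} {b} i with ∈-filter⁻ (a ≤?_) {xs = upTo (suc b)} i
... | j , le = le , ≤-pred (∈-upTo⁻ j)

∈-range⁺ : ∀ {a b k} → a ≤ k → k ≤ b → k ∈ range a b
∈-range⁺ {a} l h = ∈-filter⁺ (a ≤?_) (∈-upTo⁺ (s≤s h)) l

∈-prefix⁻ : ∀ {A : Set} (F : A → List (List A)) {xs z} → z ∈ concatMap (λ k → map (k ∷_) (F k)) xs →
  ∃ λ k → ∃ λ w → k ∈ xs × w ∈ F k × z ≡ k ∷ w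
∈-prefix⁻ F {xs} i with find (∈-concatMap⁻ (λ k → map (k ∷_) (F k)) {xs = xs} i)
... | k , k∈ , j with ∈-map⁻ (k ∷_) j
...   | w , w∈ , e = k , w , k∈ , w∈ , e

∈-prefix⁺ : ∀ {A : Set} (F : A → List (List A)) {xs k w} → k ∈ xs → w ∈ F k → (k ∷ w) ∈ concatMap (λ k → map (k ∷_) (F k)) xs
∈-prefix⁺ F {k = k} k∈ w∈ = ∈-concatMap⁺ (λ k → map (k ∷_) (F k)) (lose k∈ (∈-map⁺ (k ∷_) w∈))

unique-prefix : ∀ {A : Set} (F : A → List (List A)) {xs} → Unique xs → (∀ k → Unique (F k)) →
  Unique (concatMap (λ k → map (k ∷_) (F k)) xs)
unique-prefix F u uF = unique-concatMap (λ k → map (k ∷_) (F k)) u (λ {k} _ → Unique.map⁺ (λ { refl → refl }) (uF k)) dis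
  where
  dis : ∀ {x y z} → _ → _ → z ∈ map (x ∷_) (F x) → z ∈ map (y ∷_) (F y) → x ≡ y
  dis {x} {y} _ _ i j with ∈-map⁻ (x ∷_) i | ∈-map⁻ (y ∷_) j
  ... | _ , _ , refl | _ , _ , refl = refl

-- `ls` and `κ` are tails beginning at row `j`, while `μ` keeps its absolute indices; `cap` is the
-- horizontal-strip bound for the first of these rows.
record Strip (μ ls : List ℕ) (j cap : ℕ) (κ : List ℕ) : Set where
  field
    len  : length κ ≡ length ls
    lo   : ∀ i → i < length ls → at μ (i + j) ≤ at κ i
    hi   : ∀ i → at κ i ≤ at ls i
    top  : at κ 0 ≤ cap
    next : ∀ i → at κ (suc i) ≤ at μ (i + j)

strip⁻ : ∀ μ ls j cap {κ} → κ ∈ stripsGen μ ls j cap → Strip μ ls j cap κ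
strip⁻ μ [] j cap (here refl) = record { len = refl ; lo = λ _ () ; hi = λ _ → z≤n ; top = z≤n ; next = λ _ → z≤n }
strip⁻ μ (l ∷ ls) j cap i with ∈-prefix⁻ (λ _ → stripsGen μ ls (suc j) (at μ j)) {range (at μ j) (l ⊓ cap)} i
... | k , w , k∈ , w∈ , refl with ∈-range⁻ {b = l ⊓ cap} k∈ | strip⁻ μ ls (suc j) (at μ j) w∈
...   | lk , kh | S = record
  { len = cong suc (len S)
  ; lo = λ { zero _ → lk ; (suc i) (s≤s lt) → subst (λ z → at μ z ≤ at w i) (+-suc i j) (lo S i lt) }
  ; hi = λ { zero → ≤-trans kh (m⊓n≤m l cap) ; (suc i) → hi S i }
  ; top = ≤-trans kh (m⊓n≤n l cap)
  ; next = λ { zero → top S ; (suc i) → subst (λ z → at w (suc i) ≤ at μ z) (+-suc i j) (next S i) } }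
  where open Strip

strip⁺ : ∀ μ ls j cap {κ} → Strip μ ls j cap κ → κ ∈ stripsGen μ ls j cap
strip⁺ μ [] j cap {[]} S = here refl
strip⁺ μ [] j cap {_ ∷ _} S with Strip.len S
... | ()
strip⁺ μ (l ∷ ls) j cap {[]} S with Strip.len S
... | ()
strip⁺ μ (l ∷ ls) j cap {k ∷ w} S = ∈-prefix⁺ (λ _ → stripsGen μ ls (suc j) (at μ j))
  (∈-range⁺ (lo 0 (s≤s z≤n)) (⊓-glb (hi 0) top))
  (strip⁺ μ ls (suc j) (at μ j) (record
    { len = suc-injective len
    ; lo = λ i lt → subst (λ z → at μ z ≤ at w i) (sym (+-suc i j)) (lo (suc i) (s≤s lt))
    ; hi = hi ∘ suc ; top = next 0
    ; next = λ i → subst (λ z → at w (suc i) ≤ at μ z) (sym (+-suc i j)) (next (suc i)) }))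
  where open Strip S

unique-stripsGen : ∀ μ ls j cap → Unique (stripsGen μ ls j cap)
unique-stripsGen μ []       j cap = [] ∷ []
unique-stripsGen μ (l ∷ ls) j cap = unique-prefix (λ _ → stripsGen μ ls (suc j) (at μ j))
  (Unique.filter⁺ (at μ j ≤?_) (Unique.upTo⁺ (suc (l ⊓ cap)))) (λ _ → unique-stripsGen μ ls (suc j) (at μ j))

padEq⁻ : ∀ xs ys → padEqᵇ xs ys ≡ true → ∀ j → at xs j ≡ at ys j
padEq⁻ xs ys e j with j <? length xs + length ys
... | yes lt = go (upTo (length xs + length ys)) e (∈-upTo⁺ lt)
  where
  go : ∀ js → foldr (λ j b → (at xs j ≡ᵇ at ys j) and b) true js ≡ true → ∀ {j} → j ∈ js → at xs j ≡ at ys j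
  go (k ∷ js) e i with at xs k ≡ᵇ at ys k in eq
  go (k ∷ js) e (here refl) | true = ≡ᵇ⇒≡ _ _ (subst IsTrue (sym eq) _)
  go (k ∷ js) e (there i)   | true = go js e i
... | no nlt = trans (at-beyond xs (≤-trans (m≤m+n _ _) (≮⇒≥ nlt))) (sym (at-beyond ys (≤-trans (m≤n+m _ (length xs)) (≮⇒≥ nlt))))

padEq⁺ : ∀ xs ys → (∀ j → at xs j ≡ at ys j) → padEqᵇ xs ys ≡ true
padEq⁺ xs ys e = go (upTo (length xs + length ys))
  where
  refl-≡ᵇ : ∀ n → (n ≡ᵇ n) ≡ true
  refl-≡ᵇ zero    = refl
  refl-≡ᵇ (suc n) = refl-≡ᵇ n
  go : ∀ js → foldr (λ j b → (at xs j ≡ᵇ at ys j) and b) true js ≡ true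
  go []       = refl
  go (j ∷ js) rewrite e j | refl-≡ᵇ (at ys j) = go js

-- The recursion of `kostka` with the chains themselves in place of their number, so that equalities
-- of counts can come from bijections.
enum : List ℕ → List ℕ → List ℕ → List (List (List ℕ))
enum λ′ μ []      = if padEqᵇ λ′ μ then [ [] ] else []
enum λ′ μ (a ∷ α) = concatMap (λ κ → map (κ ∷_) (enum λ′ κ α)) (strips λ′ μ a)

length-concatMap : ∀ {A B : Set} (F : A → List B) xs → length (concatMap F xs) ≡ sum (map (length ∘ F) xs)
length-concatMap F []       = refl
length-concatMap F (x ∷ xs) = trans (length-++ (F x)) (cong (length (F x) +_) (length-concatMap F xs))

sum-map-cong : ∀ {A : Set} {f g : A → ℕ} → (∀ x → f x ≡ g x) → ∀ xs → sum (map f xs) ≡ sum (map g xs)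
sum-map-cong e []       = refl
sum-map-cong e (x ∷ xs) = cong₂ _+_ (e x) (sum-map-cong e xs)

length-enum : ∀ λ′ μ α → length (enum λ′ μ α) ≡ kostka λ′ μ α
length-enum λ′ μ [] with padEqᵇ λ′ μ
... | true  = refl
... | false = refl
length-enum λ′ μ (a ∷ α) = trans (length-concatMap _ (strips λ′ μ a))
  (sum-map-cong (λ κ → trans (length-map (κ ∷_) (enum λ′ κ α)) (length-enum λ′ κ α)) (strips λ′ μ a))

unique-enum : ∀ λ′ μ α → Unique (enum λ′ μ α)
unique-enum λ′ μ [] with padEqᵇ λ′ μ
... | true  = [] ∷ []
... | false = []
unique-enum λ′ μ (a ∷ α) = unique-prefix (λ κ → enum λ′ κ α)
  (Unique.filter⁺ (λ κ → sum κ ≟ a + sum μ) (unique-stripsGen μ λ′ 0 (at λ′ 0))) (λ κ → unique-enum λ′ κ α)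

module _ {λ′ : List ℕ} (part : IsPartition λ′) where
  private
    R = length λ′

  enum⁻ : ∀ {μ} α {x} → length μ ≤ R → x ∈ enum λ′ μ α →
    Tab (length α) (at λ′) (at μ) (fn μ x) × Cont α (λ t → ∑ R (fn μ x t)) ×
    length x ≡ length α × All (λ κ → length κ ≡ R) x
  enum⁻ {μ} [] l i with padEqᵇ λ′ μ in eq
  enum⁻ {μ} [] l (here refl) | true =
    record { start = λ _ → refl ; end = λ t r _ → sym (padEq⁻ λ′ μ eq r) ; mono = λ _ _ → ≤-refl
           ; strip = λ t r → subst₂ _≤_ (padEq⁻ λ′ μ eq (suc r)) (padEq⁻ λ′ μ eq r) (part r) } ,
    (λ _ → refl) , refl , []
  enum⁻ {μ} (a ∷ α) l i with ∈-prefix⁻ (λ κ → enum λ′ κ α) {strips λ′ μ a} i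
  ... | κ , x , κ∈ , x∈ , refl with ∈-filter⁻ (λ κ → sum κ ≟ a + sum μ) {xs = stripsGen μ λ′ 0 (at λ′ 0)} κ∈
  ...   | κ∈′ , sm with strip⁻ μ λ′ 0 (at λ′ 0) κ∈′
  ...     | S with enum⁻ α (≤-reflexive (Strip.len S)) x∈
  ...       | T , C , lx , ls = record
    { start = λ _ → refl
    ; end = λ { (suc t) r (s≤s le) → Tab.end T t r le }
    ; mono = λ { zero r → subst (λ z → at μ r ≤ at z r) (sym (get-zero κ x)) (low r) ; (suc t) r → Tab.mono T t r }
    ; strip = λ { zero r → subst (λ z → at z (suc r) ≤ at μ r) (sym (get-zero κ x)) (subst (λ z → at κ (suc r) ≤ at μ z) (+-identityʳ r) (Strip.next S r))
                ; (suc t) r → Tab.strip T t r } }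
    , (λ { zero → trans (cong (λ z → ∑ R (at z)) (get-zero κ x))
                   (trans (sym (sum≡∑ R κ (≤-reflexive (Strip.len S)))) (trans sm (cong (a +_) (sum≡∑ R μ l))))
         ; (suc t) → C t })
    , cong suc lx , Strip.len S ∷ ls
    where
    low : ∀ r → at μ r ≤ at κ r
    low r with r <? R
    ... | yes lt = subst (λ z → at μ z ≤ at κ r) (+-identityʳ r) (Strip.lo S r lt)
    ... | no nlt rewrite at-beyond μ (≤-trans l (≮⇒≥ nlt)) = z≤n

  enum⁺ : ∀ {μ} α {F} → length μ ≤ R → Tab (length α) (at λ′) (at μ) F →
    Cont α (λ t → ∑ R (F t)) → tab R (length α) F ∈ enum λ′ μ α
  enum⁺ {μ} [] l T C rewrite padEq⁺ λ′ μ (λ j → trans (sym (Tab.end T 0 j z≤n)) (Tab.start T j)) = here refl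
  enum⁺ {μ} (a ∷ α) {F} l T C = ∈-prefix⁺ (λ κ → enum λ′ κ α)
    (∈-filter⁺ (λ κ → sum κ ≟ a + sum μ) (strip⁺ μ λ′ 0 (at λ′ 0) st) sm)
    (enum⁺ α (≤-reflexive (length-applyUpTo (F 1) R)) T′ (C ∘ suc))
    where
    open Tab T
    κ = row R (F 1)
    nul : ∀ j → R ≤ j → F 1 j ≡ 0
    nul j le = n≤0⇒n≡0 (≤-trans (bounded 1 j) (≤-reflexive (at-beyond λ′ le)))
    at-κ : ∀ j → at κ j ≡ F 1 j
    at-κ = at-row-null R (F 1) nul
    st : Strip μ λ′ 0 (at λ′ 0) κ
    st = record
      { len = length-applyUpTo (F 1) R
      ; lo = λ i _ → subst₂ _≤_ (trans (start i) (cong (at μ) (sym (+-identityʳ i)))) (sym (at-κ i)) (mono 0 i)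
      ; hi = λ i → subst (_≤ at λ′ i) (sym (at-κ i)) (bounded 1 i)
      ; top = subst (_≤ at λ′ 0) (sym (at-κ 0)) (bounded 1 0)
      ; next = λ i → subst₂ _≤_ (sym (at-κ (suc i))) (trans (start i) (cong (at μ) (sym (+-identityʳ i)))) (strip 0 i) }
    sm : sum κ ≡ a + sum μ
    sm = trans (sum≡∑ R κ (≤-reflexive (length-applyUpTo (F 1) R))) (trans (∑-cong R at-κ)
      (trans (C 0) (cong (a +_) (trans (∑-cong R start) (sym (sum≡∑ R μ l))))))
    T′ : Tab (length α) (at λ′) (at κ) (F ∘ suc)
    T′ = record { start = sym ∘ at-κ ; end = λ t r le → end (suc t) r (s≤s le) ; mono = mono ∘ suc ; strip = strip ∘ suc }

below⁻ : ∀ α {β} → β ∈ below α → length β ≡ length α × (∀ t → at β t ≤ at α t)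
below⁻ [] (here refl) = refl , λ _ → z≤n
below⁻ (a ∷ α) i with ∈-prefix⁻ (λ _ → below α) {upTo (suc a)} i
... | b , β , b∈ , β∈ , refl with below⁻ α β∈
...   | l , le = cong suc l , λ { zero → ≤-pred (∈-upTo⁻ b∈) ; (suc t) → le t }

below⁺ : ∀ α {β} → length β ≡ length α → (∀ t → at β t ≤ at α t) → β ∈ below α
below⁺ []      {[]}    l le = here refl
below⁺ (a ∷ α) {b ∷ β} l le = ∈-prefix⁺ (λ _ → below α) (∈-upTo⁺ (s≤s (le 0))) (below⁺ α (suc-injective l) (le ∘ suc))

unique-below : ∀ α → Unique (below α)
unique-below []      = [] ∷ []
unique-below (a ∷ α) = unique-prefix (λ _ → below α) (Unique.upTo⁺ (suc a)) (λ _ → unique-below α)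

at-∸ : ∀ α β → length β ≡ length α → ∀ t → at (zipWith _∸_ α β) t ≡ at α t ∸ at β t
at-∸ []      []      _ t       = refl
at-∸ (a ∷ α) (b ∷ β) l zero    = refl
at-∸ (a ∷ α) (b ∷ β) l (suc t) = at-∸ α β (suc-injective l) t

length-∸ : ∀ α β → length β ≡ length α → length (zipWith _∸_ α β) ≡ length α
length-∸ []      []      _ = refl
length-∸ (a ∷ α) (b ∷ β) l = cong suc (length-∸ α β (suc-injective l))

pairs : List ℕ → List ℕ → List ℕ → List ℕ → List ℕ → List (List (List ℕ) × List (List ℕ))
pairs λ′ μ ν ρ α = concatMap (λ β → cartesianProduct (enum λ′ μ β) (enum ν ρ (zipWith _∸_ α β))) (below α)

length-pairs : ∀ λ′ μ ν ρ α → length (pairs λ′ μ ν ρ α) ≡ (skewSchur λ′ μ · skewSchur ν ρ) α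
length-pairs λ′ μ ν ρ α = trans (length-concatMap _ (below α)) (sum-map-cong (λ β →
  trans (length-cp (enum λ′ μ β) _) (cong₂ _*_ (length-enum λ′ μ β) (length-enum ν ρ (zipWith _∸_ α β)))) (below α))
  where
  length-cp : ∀ {A B : Set} (xs : List A) (ys : List B) → length (cartesianProduct xs ys) ≡ length xs * length ys
  length-cp []       ys = refl
  length-cp (x ∷ xs) ys = trans (length-++ (map (x ,_) ys)) (cong₂ _+_ (length-map (x ,_) ys) (length-cp xs ys))

module PairEnum (R : ℕ) (λ′ μ ν ρ : List ℕ) (pλ : IsPartition λ′) (pν : IsPartition ν)
  (lλ : length λ′ ≡ R) (lν : length ν ≡ R) (lμ : length μ ≤ R) (lρ : length ρ ≤ R) where

  open Pair R

  Obj : Set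
  Obj = List (List ℕ) × List (List ℕ)

  fˡ fʳ : Obj → Fun
  fˡ (x , y) = fn μ x
  fʳ (x , y) = fn ρ y

  obj : ℕ → Fun → Fun → Obj
  obj m F G = tab R m F , tab R m G

  wt : ℕ → Fun → Fun → List ℕ
  wt m F G = row m (λ t → size F G (suc t) ∸ size F G t)

  record PairTab (m : ℕ) (F G : Fun) : Set where
    field
      tabˡ : Tab m (at λ′) (at μ) F
      tabʳ : Tab m (at ν) (at ρ) G

    chˡ : Chain R F
    chˡ = Tab.chain tabˡ (λ r le → at-beyond λ′ (≤-trans (≤-reflexive lλ) le))
    chʳ : Chain R G
    chʳ = Tab.chain tabʳ (λ r le → at-beyond ν (≤-trans (≤-reflexive lν) le))

    size-mono : ∀ t → size F G t ≤ size F G (suc t)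
    size-mono t = +-mono-≤ (∑-mono R (Tab.mono tabˡ t)) (∑-mono R (Tab.mono tabʳ t))

    size-end : ∀ t → m ≤ t → size F G (suc t) ≡ size F G t
    size-end t le = cong₂ _+_
      (∑-cong R (λ r → trans (Tab.end tabˡ (suc t) r (m≤n⇒m≤1+n le)) (sym (Tab.end tabˡ t r le))))
      (∑-cong R (λ r → trans (Tab.end tabʳ (suc t) r (m≤n⇒m≤1+n le)) (sym (Tab.end tabʳ t r le))))

    at-wt : ∀ t → at (wt m F G) t ≡ size F G (suc t) ∸ size F G t
    at-wt = at-row-null m _ (λ t le → trans (cong (_∸ size F G t) (size-end t le)) (n∸n≡0 (size F G t)))

  length-wt : ∀ m F G → length (wt m F G) ≡ m
  length-wt m F G = length-applyUpTo _ m

  pairs⁻ : ∀ α {p} → p ∈ pairs λ′ μ ν ρ α →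
    PairTab (length α) (fˡ p) (fʳ p) × wt (length α) (fˡ p) (fʳ p) ≡ α × obj (length α) (fˡ p) (fʳ p) ≡ p
  pairs⁻ α {p} i with find (∈-concatMap⁻ _ {xs = below α} i)
  ... | β , β∈ , j with below⁻ α β∈ | ∈-cartesianProduct⁻ (enum λ′ μ β) (enum ν ρ (zipWith _∸_ α β)) j
  ...   | lβ , β≤ | x∈ , y∈ with enum⁻ pλ β (≤-trans lμ (≤-reflexive (sym lλ))) x∈
                              | enum⁻ pν (zipWith _∸_ α β) (≤-trans lρ (≤-reflexive (sym lν))) y∈
  ...     | Tx , Cx , lx , ax | Ty , Cy , ly , ay = P , at-ext _ _ (length-wt (length α) _ _) at-eq , cong₂ _,_
              (trans (cong (λ z → tab R z (fˡ p)) (sym (trans lx lβ))) (tab-fn R μ (proj₁ p) (subst (λ z → All (λ κ → length κ ≡ z) _) lλ ax)))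
              (trans (cong (λ z → tab R z (fʳ p)) (sym (trans ly lγ))) (tab-fn R ρ (proj₂ p) (subst (λ z → All (λ κ → length κ ≡ z) _) lν ay)))
    where
    lγ = length-∸ α β lβ
    P : PairTab (length α) (fˡ p) (fʳ p)
    P = record { tabˡ = subst (λ z → Tab z _ _ _) lβ Tx ; tabʳ = subst (λ z → Tab z _ _ _) lγ Ty }
    Cx′ : ∀ t → ∑ R (fˡ p (suc t)) ≡ at β t + ∑ R (fˡ p t)
    Cx′ = subst (λ z → ∀ t → ∑ z (fˡ p (suc t)) ≡ at β t + ∑ z (fˡ p t)) lλ Cx
    Cy′ : ∀ t → ∑ R (fʳ p (suc t)) ≡ at (zipWith _∸_ α β) t + ∑ R (fʳ p t)
    Cy′ = subst (λ z → ∀ t → ∑ z (fʳ p (suc t)) ≡ at (zipWith _∸_ α β) t + ∑ z (fʳ p t)) lν Cy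
    ar : ∀ a x b y → (a + x) + (b + y) ≡ (a + b) + (x + y)
    ar = solve-∀
    at-eq : ∀ t → at (wt (length α) (fˡ p) (fʳ p)) t ≡ at α t
    at-eq t = begin
      at (wt (length α) (fˡ p) (fʳ p)) t ≡⟨ PairTab.at-wt P t ⟩
      size (fˡ p) (fʳ p) (suc t) ∸ size (fˡ p) (fʳ p) t ≡⟨ cong (_∸ size (fˡ p) (fʳ p) t)
          (trans (cong₂ _+_ (Cx′ t) (trans (Cy′ t) (cong (_+ ∑ R (fʳ p t)) (at-∸ α β lβ t))))
                 (ar (at β t) (∑ R (fˡ p t)) (at α t ∸ at β t) (∑ R (fʳ p t)))) ⟩
      (at β t + (at α t ∸ at β t) + size (fˡ p) (fʳ p) t) ∸ size (fˡ p) (fʳ p) t ≡⟨ m+n∸n≡m _ (size (fˡ p) (fʳ p) t) ⟩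
      at β t + (at α t ∸ at β t) ≡⟨ m+[n∸m]≡n (β≤ t) ⟩
      at α t ∎
      where open ≡-Reasoning

  pairs⁺ : ∀ {m F G} → PairTab m F G → obj m F G ∈ pairs λ′ μ ν ρ (wt m F G)
  pairs⁺ {m} {F} {G} P = ∈-concatMap⁺ (λ β → cartesianProduct (enum λ′ μ β) (enum ν ρ (zipWith _∸_ α β)))
    (lose {x = β} (below⁺ α (trans lβ (sym (length-wt m F G))) β≤) (∈-cartesianProduct⁺ x∈ y∈))
    where
    open PairTab P
    α = wt m F G
    d : Fun → ℕ → ℕ
    d H t = ∑ R (H (suc t)) ∸ ∑ R (H t)
    β = row m (d F)
    γ = zipWith _∸_ α β
    lβ : length β ≡ m
    lβ = length-applyUpTo _ m
    lγ : length γ ≡ m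
    lγ = trans (length-∸ α β (trans lβ (sym (length-wt m F G)))) (length-wt m F G)
    mF : ∀ t → ∑ R (F t) ≤ ∑ R (F (suc t))
    mF t = ∑-mono R (Tab.mono tabˡ t)
    mG : ∀ t → ∑ R (G t) ≤ ∑ R (G (suc t))
    mG t = ∑-mono R (Tab.mono tabʳ t)
    at-β : ∀ t → at β t ≡ d F t
    at-β = at-row-null m (d F) (λ t le → trans (cong (_∸ ∑ R (F t)) (∑-cong R (λ r → trans (Tab.end tabˡ (suc t) r (m≤n⇒m≤1+n le)) (sym (Tab.end tabˡ t r le))))) (n∸n≡0 (∑ R (F t))))
    split : ∀ a b c e → b ≤ a → e ≤ c → (a + c) ∸ (b + e) ≡ (a ∸ b) + (c ∸ e)
    split a b c e p q = trans (sym (∸-+-assoc (a + c) b e)) (trans (cong (_∸ e) (+-∸-comm c p)) (+-∸-assoc (a ∸ b) q))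
    at-α : ∀ t → at α t ≡ d F t + d G t
    at-α t = trans (at-wt t) (split (∑ R (F (suc t))) (∑ R (F t)) _ _ (mF t) (mG t))
    β≤ : ∀ t → at β t ≤ at α t
    β≤ t = ≤-trans (≤-reflexive (at-β t)) (≤-trans (m≤m+n _ _) (≤-reflexive (sym (at-α t))))
    at-γ : ∀ t → at γ t ≡ d G t
    at-γ t = trans (at-∸ α β (trans lβ (sym (length-wt m F G))) t) (trans (cong₂ _∸_ (at-α t) (at-β t)) (m+n∸m≡n (d F t) _))
    x∈ : tab R m F ∈ enum λ′ μ β
    x∈ = subst₂ (λ a b → tab a b F ∈ enum λ′ μ β) lλ lβ (enum⁺ pλ β (≤-trans lμ (≤-reflexive (sym lλ)))
      (subst (λ z → Tab z _ _ _) (sym lβ) tabˡ)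
      (λ t → subst (λ z → ∑ z (F (suc t)) ≡ at β t + ∑ z (F t)) (sym lλ)
        (trans (sym (m∸n+n≡m (mF t))) (cong (_+ ∑ R (F t)) (sym (at-β t))))))
    y∈ : tab R m G ∈ enum ν ρ γ
    y∈ = subst₂ (λ a b → tab a b G ∈ enum ν ρ γ) lν lγ (enum⁺ pν γ (≤-trans lρ (≤-reflexive (sym lν)))
      (subst (λ z → Tab z _ _ _) (sym lγ) tabʳ)
      (λ t → subst (λ z → ∑ z (G (suc t)) ≡ at γ t + ∑ z (G t)) (sym lν)
        (trans (sym (m∸n+n≡m (mG t))) (cong (_+ ∑ R (G t)) (sym (at-γ t))))))

  obj-fˡ : ∀ {m F G} → PairTab m F G → ∀ t r → fˡ (obj m F G) t r ≡ F t r
  obj-fˡ P = fn-tab μ (λ r le → at-beyond λ′ (≤-trans (≤-reflexive lλ) le)) (PairTab.tabˡ P)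

  obj-fʳ : ∀ {m F G} → PairTab m F G → ∀ t r → fʳ (obj m F G) t r ≡ G t r
  obj-fʳ P = fn-tab ρ (λ r le → at-beyond ν (≤-trans (≤-reflexive lν) le)) (PairTab.tabʳ P)

  unique-pairs : ∀ α → Unique (pairs λ′ μ ν ρ α)
  unique-pairs α = unique-concatMap _ (unique-below α)
    (λ {β} _ → Unique.cartesianProduct⁺ (unique-enum λ′ μ β) (unique-enum ν ρ (zipWith _∸_ α β))) dis
    where
    dis : ∀ {β β′ p} → β ∈ below α → β′ ∈ below α → p ∈ cartesianProduct (enum λ′ μ β) (enum ν ρ (zipWith _∸_ α β)) →
      p ∈ cartesianProduct (enum λ′ μ β′) (enum ν ρ (zipWith _∸_ α β′)) → β ≡ β′
    dis {β} {β′} β∈ β′∈ i j = at-ext β β′ (trans (proj₁ (below⁻ α β∈)) (sym (proj₁ (below⁻ α β′∈))))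
      (λ t → +-cancelʳ-≡ _ _ _ (trans (sym (cont β i t)) (cont β′ j t)))
      where
      cont : ∀ β {p} → p ∈ cartesianProduct (enum λ′ μ β) (enum ν ρ (zipWith _∸_ α β)) →
        ∀ t → ∑ (length λ′) (fn μ (proj₁ p) (suc t)) ≡ at β t + ∑ (length λ′) (fn μ (proj₁ p) t)
      cont β k = proj₁ (proj₂ (enum⁻ pλ β (≤-trans lμ (≤-reflexive (sym lλ))) (proj₁ (∈-cartesianProduct⁻ (enum λ′ μ β) _ k))))

H-ext : ∀ R {f g : ℕ → ℕ} → (∀ r → f r ≡ g r) → ∀ c → H R f c ≡ H R g c
H-ext zero    e c = refl
H-ext (suc R) {f} {g} e c with c <? f R | c <? g R
... | yes _ | yes _ = refl
... | no _  | no _  = H-ext R e c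
... | yes p | no q  = ⊥-elim (q (subst (c <_) (e R) p))
... | no p  | yes q = ⊥-elim (p (subst (c <_) (sym (e R)) q))

H≤ : ∀ R f c → H R f c ≤ R
H≤ zero    f c = z≤n
H≤ (suc R) f c with c <? f R
... | yes _ = ≤-refl
... | no _  = m≤n⇒m≤1+n (H≤ R f c)

_≗₂_ : Fun → Fun → Set
F ≗₂ G = ∀ t r → F t r ≡ G t r

module _ {T T′ : Fun} (e : T ≗₂ T′) (k : ℕ) where
  private
    module L = Layer T k
    module L′ = Layer T′ k

  bk-cong : ∀ c → L.bk c ≗₂ L′.bk c
  bk-cong c t r with t ≟ suc k
  ... | no _ = e t r
  ... | yes refl with L.lo r <? c | L′.lo r <? c
  ...   | yes _ | yes _ = cong₂ _∸_ (cong₂ (λ a b → a + b ⊓ c) (lo-cong T′ T k c (e k) (e (2 + k)) r) (hi-cong T′ T k c (e k) (e (2 + k)) r)) (e (suc k) r)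
  ...   | no _  | no _  = e (suc k) r
  ...   | yes p | no q  = ⊥-elim (q (subst (_< c) (lo-cong T′ T k c (e k) (e (2 + k)) r) p))
  ...   | no p  | yes q = ⊥-elim (p (subst (_< c) (sym (lo-cong T′ T k c (e k) (e (2 + k)) r)) q))

module PairCong (R : ℕ) {T U T′ U′ : Fun} (eT : T ≗₂ T′) (eU : U ≗₂ U′) where
  open Pair R
  open PairY R

  private
    hT : ∀ c t → h T c t ≡ h T′ c t
    hT c t = H-ext R (eT t) c
    hU : ∀ c t → h U c t ≡ h U′ c t
    hU c t = H-ext R (eU t) c

  s-cong : ∀ c t → s T U c t ≡ s T′ U′ c t
  s-cong c t = cong₂ _+_ (∑-cong R (λ r → cong (_∸ c) (eT t r))) (∑-cong R (λ r → cong (_∸ c) (eU t r)))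

  size-cong : ∀ t → size T U t ≡ size T′ U′ t
  size-cong t = cong₂ _+_ (∑-cong R (eT t)) (∑-cong R (eU t))

  event-cong : ∀ {c ρ k} d → Event T U c ρ k d → Event T′ U′ c ρ k d
  event-cong {c} {ρ} {k} left (e , p) = ET.E-cong (hT c) (hU c _) (hU c _) (hU (suc c)) (s-cong (suc c)) e , trans p (cong (λ z → z + z) (hT c k))
  event-cong {c} {ρ} {k} right (e , p) = EU.E-cong (hU c) (hT c _) (hT c _) (hT (suc c)) (s-cong (suc c)) e , trans p (cong (λ z → suc (z + z)) (hU c k))
  event-cong {c} both (e , p) = E2-cong (hT c) (hU c _) (hU c _) (hU c _) (s-cong (suc c)) e , p

  bad-cong : ∀ {_◁_ : ℕ → ℕ → Set} {k c r q} → Bad _◁_ T U k c r q → Bad _◁_ T′ U′ k c r q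
  bad-cong {k = k} {c} {r} {q} b = record
    { rows = rows ; T-out = subst (_≤ c) (eT _ _) T-out ; T-in = subst (c <_) (eT _ _) T-in
    ; T-up = λ z → subst (c <_) (eT _ _) (T-up z) ; U-out = subst (_≤ c) (eU _ _) U-out
    ; U-end = trans (sym (eU _ _)) U-end ; U-low = subst (_≤ c) (eU _ _) U-low }
    where open Bad b

yam-cong : ∀ R {T U T′ U′} → T ≗₂ T′ → U ≗₂ U′ → PairY.Yam R T U → PairY.Yam R T′ U′
yam-cong R {T} {U} {T′} {U′} eT eU y = record
  { concave = λ k c → subst₂ _≤_ (cong₂ _+_ (s-cong c k) (s-cong c (2 + k))) (cong₂ _+_ (s-cong c (suc k)) (s-cong c (suc k))) (concave k c)
  ; noˡ = λ k c r q b bad → noˡ k c r q (bal {k} {c} b) (PairCong.bad-cong R (λ t r → sym (eT t r)) (λ t r → sym (eU t r)) bad)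
  ; noʳ = λ k c r q b bad → noʳ k c r q (bal {k} {c} b) (PairCong.bad-cong R (λ t r → sym (eU t r)) (λ t r → sym (eT t r)) bad) }
  where
  open PairCong R eT eU
  open PairY.Yam y
  bal : ∀ {k c} → Balanced (Pair.s R T′ U′ (suc c)) k → Balanced (Pair.s R T U (suc c)) k
  bal {k} {c} b = trans (cong₂ _+_ (s-cong (suc c) k) (s-cong (suc c) (2 + k))) (trans b (sym (cong₂ _+_ (s-cong (suc c) (suc k)) (s-cong (suc c) (suc k)))))

Σℤ-const : ∀ {A : Set} (f : A → ℤ) (c : ℤ) xs → (∀ {x} → x ∈ xs → f x ≡ c) → Σℤ f xs ≡ ℤ.+ length xs ⊛ c
Σℤ-const f c []       e = sym (ℤ.*-zeroˡ c)
Σℤ-const f c (x ∷ xs) e = trans (cong₂ _⊕_ (e (here refl)) (Σℤ-const f c xs (e ∘ there))) (sym (ℤ.suc-* (ℤ.+ length xs) c))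

at-++ : ∀ p z → at (p ++ z) (length p) ≡ at z 0
at-++ []      z = refl
at-++ (x ∷ p) z = at-++ p z

at-++₁ : ∀ p a z → at (p ++ a ∷ z) (suc (length p)) ≡ at z 0
at-++₁ []      a z = refl
at-++₁ (x ∷ p) a z = at-++₁ p a z

at-++-off : ∀ p x y x′ y′ z {t} → t ≢ length p → t ≢ suc (length p) → at (p ++ x ∷ y ∷ z) t ≡ at (p ++ x′ ∷ y′ ∷ z) t
at-++-off []      x y x′ y′ z {zero}        n₀ n₁ = ⊥-elim (n₀ refl)
at-++-off []      x y x′ y′ z {suc zero}    n₀ n₁ = ⊥-elim (n₁ refl)
at-++-off []      x y x′ y′ z {suc (suc t)} n₀ n₁ = refl
at-++-off (a ∷ p) x y x′ y′ z {zero}        n₀ n₁ = refl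
at-++-off (a ∷ p) x y x′ y′ z {suc t}       n₀ n₁ = at-++-off p x y x′ y′ z (n₀ ∘ cong suc) (n₁ ∘ cong suc)

-- `z`, `a`, `b` are the sizes at times `k`, `k + 1`, `k + 2`, and `a′` is the reflected middle
-- size: the old number of entries `k + 1` is `δ` more than the new number of entries `k`.
flip-diff : ∀ δ {a a′ b z} → z ≤ a′ → δ + (a′ + a) ≡ z + b → b ∸ a ≡ δ + (a′ ∸ z)
flip-diff δ {a} {a′} {b} {z} z≤ eq = trans (cong (_∸ a) b≡) (m+n∸n≡m (δ + (a′ ∸ z)) a)
  where
  ar : ∀ d z x a → d + (z + x + a) ≡ z + (d + x + a)
  ar = solve-∀
  b≡ : b ≡ δ + (a′ ∸ z) + a
  b≡ = +-cancelˡ-≡ z _ _ (trans (sym eq) (trans (cong (λ v → δ + (v + a)) (sym (m+[n∸m]≡n z≤))) (ar δ z (a′ ∸ z) a)))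

dot-split : ∀ k α α′ → length α ≡ length α′ → suc k < length α → (∀ t → t ≢ k → t ≢ suc k → at α t ≡ at α′ t) →
  at α (suc k) ≡ suc (at α′ k) → at α′ (suc k) ≡ suc (at α k) →
  ∃ λ p → ∃ λ x → ∃ λ y → ∃ λ z → α ≡ p ++ x ∷ suc y ∷ z × α′ ≡ p ++ y ∷ suc x ∷ z
dot-split k [] _ l () e e₁ e₂
dot-split zero (x ∷ []) _ l (s≤s ()) e e₁ e₂
dot-split zero (x ∷ y ∷ z) (x′ ∷ y′ ∷ z′) l lt e e₁ e₂ = [] , x , x′ , z , cong (λ w → x ∷ w ∷ z) e₁ ,
  cong₂ (λ w v → x′ ∷ w ∷ v) e₂ (sym (at-ext z z′ (suc-injective (suc-injective l)) (λ t → e (2 + t) (λ ()) (λ ()))))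
dot-split (suc k) (a ∷ α) (a′ ∷ α′) l (s≤s lt) e e₁ e₂
  with dot-split k α α′ (suc-injective l) lt (λ t n₀ n₁ → e (suc t) (n₀ ∘ suc-injective) (n₁ ∘ suc-injective)) e₁ e₂ | e 0 (λ ()) (λ ())
... | p , x , y , z , q , q′ | refl = a ∷ p , x , y , z , cong (a ∷_) q , cong (a ∷_) q′

-- Signed sums over pairs of tableaux

module Expansion (R : ℕ) (λ′ μ ν ρ : List ℕ) (pλ : IsPartition λ′) (pν : IsPartition ν)
  (lλ : length λ′ ≡ R) (lν : length ν ≡ R) (lμ : length μ ≤ R) (lρ : length ρ ≤ R) where

  open PairEnum R λ′ μ ν ρ pλ pν lλ lν lμ lρ public
  open Pair R
  open PairY R

  N : List ℕ → ℕ
  N α = length (pairs λ′ μ ν ρ α)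

  total : ℕ
  total = ∑ R (at λ′) + ∑ R (at ν)

  width : ℕ
  width = at λ′ 0 ⊔ at ν 0

  module _ {m F G} (P : PairTab m F G) where
    open PairTab P

    size≤total : ∀ t → size F G t ≤ total
    size≤total t = +-mono-≤ (∑-mono R (Tab.bounded tabˡ t)) (∑-mono R (Tab.bounded tabʳ t))

    at-wt≤ : ∀ t → at (wt m F G) t ≤ total
    at-wt≤ t = ≤-trans (≤-reflexive (at-wt t)) (≤-trans (m∸n≤m _ (size F G t)) (size≤total (suc t)))

    widthˡ : ∀ t r → F t r ≤ width
    widthˡ t r = ≤-trans (Tab.bounded tabˡ t r) (≤-trans (antitone pλ {0} z≤n) (m≤m⊔n _ _))

    widthʳ : ∀ t r → G t r ≤ width
    widthʳ t r = ≤-trans (Tab.bounded tabʳ t r) (≤-trans (antitone pν {0} z≤n) (m≤n⊔m (at λ′ 0) _))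

  all-at : ∀ α {n} → (∀ t → at α t ≤ n) → All (_≤ n) α
  all-at []      _ = []
  all-at (a ∷ α) b = b 0 ∷ all-at α (b ∘ suc)

  N-bounded : ∀ {n} → total ≤ n → ∀ β → ¬ All (_≤ n) β → N β ≡ 0
  N-bounded le β na with pairs λ′ μ ν ρ β in eq
  ... | [] = refl
  ... | p ∷ _ with pairs⁻ β {p} (subst (p ∈_) (sym eq) (here refl))
  ...   | P , w , _ = ⊥-elim (na (all-at β (λ t → ≤-trans (subst (λ z → at z t ≤ total) w (at-wt≤ P t)) le)))

  obj-cong : ∀ m {F G F′ G′} → F ≗₂ F′ → G ≗₂ G′ → obj m F G ≡ obj m F′ G′
  obj-cong m eF eG = cong₂ _,_ (tab-cong R m eF) (tab-cong R m eG)

  wt-cong : ∀ m {F G F′ G′} → F ≗₂ F′ → G ≗₂ G′ → wt m F G ≡ wt m F′ G′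
  wt-cong m eF eG = row-cong m (λ t → cong₂ _∸_ (PairCong.size-cong R eF eG (suc t)) (PairCong.size-cong R eF eG t))

  module _ (m n : ℕ) where

    objs : List Obj
    objs = concatMap (pairs λ′ μ ν ρ) (box m n)

    weight : Obj → List ℕ
    weight p = wt m (fˡ p) (fʳ p)

    objs⁻ : ∀ {p} → p ∈ objs → PairTab m (fˡ p) (fʳ p) × obj m (fˡ p) (fʳ p) ≡ p
    objs⁻ {p} i with find (∈-concatMap⁻ (pairs λ′ μ ν ρ) {xs = box m n} i)
    ... | β , β∈ , j with pairs⁻ β {p} j | box-length m n β∈
    ...   | P , _ , e | refl = P , e

    objs⁺ : total ≤ n → ∀ {F G} → PairTab m F G → obj m F G ∈ objs
    objs⁺ le {F} {G} P = ∈-concatMap⁺ (pairs λ′ μ ν ρ) (lose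
      (subst (λ z → wt m F G ∈ box z n) (length-wt m F G) (∈-box (all-at _ (λ t → ≤-trans (at-wt≤ P t) le)))) (pairs⁺ P))

    weight-pairs : ∀ {β p} → length β ≡ m → p ∈ pairs λ′ μ ν ρ β → weight p ≡ β
    weight-pairs {β} {p} refl i = proj₁ (proj₂ (pairs⁻ β {p} i))

    unique-objs : Unique objs
    unique-objs = unique-concatMap (pairs λ′ μ ν ρ) (unique-box m n) (λ {β} _ → unique-pairs β)
      (λ {β} {β′} {p} β∈ β′∈ i j → trans (sym (weight-pairs {β} {p} (box-length m n β∈) i)) (weight-pairs {β′} {p} (box-length m n β′∈) j))

    pairing : ∀ ε → Σℤ (λ β → ℤ.+ N β ⊛ ε β) (box m n) ≡ Σℤ (ε ∘ weight) objs
    pairing ε = sym (trans (Σℤ-concatMap (ε ∘ weight) (pairs λ′ μ ν ρ) (box m n)) (Σℤ-cong (box m n) (λ {β} β∈ →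
      Σℤ-const (ε ∘ weight) (ε β) (pairs λ′ μ ν ρ β) (λ {p} i → cong ε (weight-pairs {β} {p} (box-length m n β∈) i)))))

  module _ (m : ℕ) where

    reflect : ℕ → ℕ → ℕ → Obj → Obj
    reflect k cˡ cʳ p = obj m (Layer.bk (fˡ p) k cˡ) (Layer.bk (fʳ p) k cʳ)

    module Reflect {k cˡ cʳ} (k< : suc k < m) {p : Obj} (P : PairTab m (fˡ p) (fʳ p)) (e : obj m (fˡ p) (fʳ p) ≡ p)
      (gl : Layer.Good (fˡ p) k cˡ) (gr : Layer.Good (fʳ p) k cʳ) where
      open PairTab P
      F = fˡ p
      G = fʳ p
      F′ = Layer.bk F k cˡ
      G′ = Layer.bk G k cʳ

      private
        tab-bk : ∀ T c {lam mu} → Tab m lam mu T → Chain R (Layer.bk T k c) → Tab m lam mu (Layer.bk T k c)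
        tab-bk T c tb ch = record
          { start = λ r → trans (upd-off T (suc k) (Layer.refl-row T k c) (λ ()) r) (Tab.start tb r)
          ; end = λ t r le → trans (upd-off T (suc k) (Layer.refl-row T k c) (λ { refl → <-irrefl refl (≤-trans k< le) }) r) (Tab.end tb t r le)
          ; mono = Chain.mono ch ; strip = Chain.strip ch }

      P′ : PairTab m F′ G′
      P′ = record { tabˡ = tab-bk F cˡ tabˡ (Layer.bk-chain F k chˡ gl) ; tabʳ = tab-bk G cʳ tabʳ (Layer.bk-chain G k chʳ gr) }

      eF : fˡ (obj m F′ G′) ≗₂ F′
      eF = obj-fˡ P′
      eG : fʳ (obj m F′ G′) ≗₂ G′
      eG = obj-fʳ P′

      invol : reflect k cˡ cʳ (reflect k cˡ cʳ p) ≡ p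
      invol = trans (obj-cong m (λ t r → trans (bk-cong eF k cˡ t r) (bk-invol chˡ k cˡ gl t r))
                                (λ t r → trans (bk-cong eG k cʳ t r) (bk-invol chʳ k cʳ gr t r))) e

      size-off : ∀ {t} → t ≢ suc k → size F′ G′ t ≡ size F G t
      size-off ne = cong₂ _+_ (∑-cong R (upd-off F (suc k) _ ne)) (∑-cong R (upd-off G (suc k) _ ne))

      size-before : size F′ G′ k ≡ size F G k
      size-before = size-off (λ ())

      size-after : size F′ G′ (2 + k) ≡ size F G (2 + k)
      size-after = size-off (λ ())

      at-wt-off : ∀ t → t ≢ k → t ≢ suc k → at (wt m F G) t ≡ at (wt m F′ G′) t
      at-wt-off t n₀ n₁ = trans (at-wt t) (trans (sym (cong₂ _∸_ (size-off (n₀ ∘ suc-injective)) (size-off n₁))) (sym (PairTab.at-wt P′ t)))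

  -- An event needs a cell added between times `k + 1` and `k + 2`, and the shapes are constant from
  -- time `m` on.
  interior : ∀ {m F G} → PairTab m F G → ∀ {c q k} d → Event F G c q k d → suc k < m
  interior {m} {F} {G} P {c} {q} {k} d ev = ≰⇒> λ le → absurd le d ev
    where
    open PairTab P
    same : ∀ {T lam mu} → Tab m lam mu T → m ≤ suc k → h T c (2 + k) ≡ h T c (suc k)
    same T le = H-ext R (λ r → trans (Tab.end T (2 + k) r (m≤n⇒m≤1+n le)) (sym (Tab.end T (suc k) r le))) c
    rise≢ : ∀ {a : ℕ → ℕ} → Flat a k → a (2 + k) ≢ a (suc k)
    rise≢ (p , q) e = 1+n≢n (trans (sym q) (trans e p))
    absurd : m ≤ suc k → ∀ d → ¬ Event F G c q k d
    absurd le left  (e , _) = rise≢ {h F c} (ET.E.flat e) (same tabˡ le)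
    absurd le right (e , _) = rise≢ {h G c} (EU.E.flat e) (same tabʳ le)
    absurd le both  (e , _) = rise≢ {h F c} (E2.flatˡ e) (same tabˡ le)

  Idx : Set
  Idx = ℕ × ℕ × ℕ × Kind

  Ev : Idx → Obj → Set
  Ev (c , q , k , d) p = Event (fˡ p) (fʳ p) c q k d

  Ev? : ∀ i p → Dec (Ev i p)
  Ev? (c , q , k , d) p = Event? (fˡ p) (fʳ p) c q k d

  module SignReversal (m n : ℕ) (le-n : total ≤ n) (ε : List ℕ → ℤ) (alt : Alternating ε) where

    ι : Idx → Obj → Obj
    ι (c , q , k , d) = reflect m k (thrˡ d c) (thrʳ d c)

    -- The order of elimination: columns from right to left, and each column in reading order.
    -- Neither the time nor the kind enters.
    _≼_ : Idx → Idx → Set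
    (c′ , q′ , _) ≼ (c , q , _) = c < c′ ⊎ (c ≡ c′ × q′ ≤ q)

    module Step {p : Obj} (P : PairTab m (fˡ p) (fʳ p)) (e : obj m (fˡ p) (fʳ p) ≡ p)
      (c q k : ℕ) (d : Kind) (ev : Event (fˡ p) (fʳ p) c q k d) where
      open PairTab P
      k< : suc k < m
      k< = interior P d ev
      open Reflect m k< {p} P e (goodˡ chˡ chʳ d ev) (goodʳ chˡ chʳ d ev) public

      persists : Event (fˡ (obj m F′ G′)) (fʳ (obj m F′ G′)) c q k d
      persists = PairCong.event-cong R (λ t r → sym (eF t r)) (λ t r → sym (eG t r)) d (event-persists chˡ chʳ d ev)

      private
        w = wt m F G
        w′ = wt m F′ G′

        rel : suc (size F′ G′ (suc k) + size F G (suc k)) ≡ size F G k + size F G (2 + k)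
        rel = event-size chˡ chʳ d ev

        s₀≤ : size F G k ≤ size F′ G′ (suc k)
        s₀≤ = subst (_≤ size F′ G′ (suc k)) size-before (PairTab.size-mono P′ k)

        e₁ : at w (suc k) ≡ suc (at w′ k)
        e₁ = trans (at-wt (suc k)) (trans (flip-diff 1 s₀≤ rel)
          (cong suc (sym (trans (PairTab.at-wt P′ k) (cong (size F′ G′ (suc k) ∸_) size-before)))))

        e₂ : at w′ (suc k) ≡ suc (at w k)
        e₂ = trans (PairTab.at-wt P′ (suc k)) (trans (cong (_∸ size F′ G′ (suc k)) size-after)
          (trans (flip-diff 1 (size-mono k) (trans (cong suc (+-comm (size F G (suc k)) (size F′ G′ (suc k)))) rel)) (cong suc (sym (at-wt k)))))

        neg′ : (∃ λ a → ∃ λ x → ∃ λ y → ∃ λ z → w ≡ a ++ x ∷ suc y ∷ z × w′ ≡ a ++ y ∷ suc x ∷ z) → ε w′ ≡ ⊖ ε w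
        neg′ (a , x , y , z , p₁ , p₂) = trans (cong ε p₂) (trans (alt a y x z) (cong (λ v → ⊖ ε v) (sym p₁)))

      neg : ε (weight m n (obj m F′ G′)) ≡ ⊖ ε w
      neg = trans (cong ε (wt-cong m eF eG)) (neg′ (dot-split k w w′ (trans (length-wt m F G) (sym (length-wt m F′ G′)))
        (subst (suc k <_) (sym (length-wt m F G)) k<) at-wt-off e₁ e₂))

      no-new : ∀ c′ q′ k′ d′ → c < c′ ⊎ (c ≡ c′ × q′ ≤ q) → Event F′ G′ c′ q′ k′ d′ → Event F G c′ q′ k′ d′
      no-new c′ q′ k′ d′ (inj₁ lt) = no-new-events-right-of chˡ chʳ d ev lt d′
      no-new c′ q′ k′ d′ (inj₂ (refl , le)) = no-new-events-before chˡ chʳ d ev le d′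

    closed : ∀ {i p} → p ∈ objs m n → Ev i p →
      ι i p ∈ objs m n × Ev i (ι i p) × ι i (ι i p) ≡ p × ε (weight m n (ι i p)) ≡ ⊖ ε (weight m n p)
    closed {c , q , k , d} {p} i ev = objs⁺ m n le-n P′ , persists , invol , neg
      where open Step {p} (proj₁ (objs⁻ m n {p} i)) (proj₂ (objs⁻ m n {p} i)) c q k d ev

    stable : ∀ {i i′ p} → p ∈ objs m n → Ev i p → i′ ≼ i → Ev i′ (ι i p) → Ev i′ p
    stable {c , q , k , d} {c′ , q′ , k′ , d′} {p} i ev le ev′ = no-new c′ q′ k′ d′ le (PairCong.event-cong R eF eG d′ ev′)
      where open Step {p} (proj₁ (objs⁻ m n {p} i)) (proj₂ (objs⁻ m n {p} i)) c q k d ev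

  -- Column heights are at most `R`, so the largest rank is `1 + (R + R)`.
  ranks : ℕ
  ranks = 2 + (R + R)

  indices : ℕ → List Idx
  indices m = cartesianProduct (upTo width) (cartesianProduct (downFrom ranks) (cartesianProduct (upTo m) (left ∷ right ∷ both ∷ [])))

  indices-ordered : ∀ m → AllPairs (λ (c , q , _) (c′ , q′ , _) → c < c′ ⊎ (c ≡ c′ × q′ ≤ q)) (indices m)
  indices-ordered m = AllPairs.map (λ { (inj₁ lt) → inj₁ lt ; (inj₂ (e , inj₁ lt)) → inj₂ (e , <⇒≤ lt) ; (inj₂ (e , inj₂ (e′ , _))) → inj₂ (e , ≤-reflexive (sym e′)) })
    (allPairs-× (AllPairs.applyUpTo⁺₁ id width (λ lt _ → lt))
      (allPairs-× {P = λ q q′ → q′ < q} (AllPairs.applyDownFrom⁺₁ id ranks (λ lt _ → lt)) (allPairs-⊤ (cartesianProduct (upTo m) (left ∷ right ∷ both ∷ [])))))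

  ∈-indices : ∀ {m F G} → PairTab m F G → ∀ {c q k} d → c < width → Event F G c q k d → (c , q , k , d) ∈ indices m
  ∈-indices {m} {F} {G} P {c} {q} {k} d lt ev = ∈-cartesianProduct⁺ (∈-upTo⁺ lt) (∈-cartesianProduct⁺ (∈-downFrom⁺ (rank d ev))
    (∈-cartesianProduct⁺ (∈-upTo⁺ (<⇒≤ (interior P d ev))) (all-kinds d)))
    where
    all-kinds : ∀ d → d ∈ left ∷ right ∷ both ∷ []
    all-kinds left  = here refl
    all-kinds right = there (here refl)
    all-kinds both  = there (there (here refl))
    rank : ∀ d → Event F G c q k d → q < ranks
    rank left  (_ , refl) = s≤s (m≤n⇒m≤1+n (+-mono-≤ (H≤ R _ c) (H≤ R _ c)))
    rank right (_ , refl) = s≤s (s≤s (+-mono-≤ (H≤ R _ c) (H≤ R _ c)))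
    rank both  (_ , refl) = s≤s z≤n

  clear?′ : ∀ m (p : Obj) → Dec (All (λ i → ¬ Ev i p) (indices m))
  clear?′ m p = All.all? (λ i → ¬? (Ev? i p)) (indices m)

  module _ (m n : ℕ) where

    yams : List Obj
    yams = filter (clear?′ m) (objs m n)

    unique-yams : Unique yams
    unique-yams = Unique.filter⁺ (clear?′ m) (unique-objs m n)

    yams-objs : ∀ {p} → p ∈ yams → p ∈ objs m n
    yams-objs = proj₁ ∘ ∈-filter⁻ (clear?′ m) {xs = objs m n}

    yams-tab : ∀ {p} → p ∈ yams → PairTab m (fˡ p) (fʳ p)
    yams-tab {p} i = proj₁ (objs⁻ m n {p} (yams-objs i))

    yams-yam : ∀ {p} → p ∈ yams → Yam (fˡ p) (fʳ p)
    yams-yam {p} i = noEvents⇒yam (PairTab.chˡ P) (PairTab.chʳ P) width (widthˡ P) (widthʳ P)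
        (λ c lt q k d ev → All.lookup (proj₂ (∈-filter⁻ (clear?′ m) {xs = objs m n} i)) (∈-indices P d lt ev) ev)
      where
      P : PairTab m (fˡ p) (fʳ p)
      P = yams-tab {p} i

    yams⁺ : ∀ {p} → p ∈ objs m n → Yam (fˡ p) (fʳ p) → p ∈ yams
    yams⁺ {p} j y = ∈-filter⁺ (clear?′ m) j (All.tabulate (λ {i} _ → yam⇒noEvents (PairTab.chˡ P) (PairTab.chʳ P) y (proj₁ i) _ _ _))
      where
      P : PairTab m (fˡ p) (fʳ p)
      P = proj₁ (objs⁻ m n {p} j)

    yams-pairing : total ≤ n → ∀ ε → Alternating ε → Σℤ (λ β → ℤ.+ N β ⊛ ε β) (box m n) ≡ Σℤ (ε ∘ weight m n) yams
    yams-pairing le ε alt = trans (pairing m n ε) (El.eliminate (indices m) (indices-ordered m))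
      where
      module SR = SignReversal m n le ε alt
      module El = Elimination Ev Ev? SR.ι (ε ∘ weight m n) SR._≼_ (unique-objs m n)
        (λ {i} {p} → SR.closed {i} {p}) (λ {i} {i′} {p} → SR.stable {i} {i′} {p})

    -- Concavity at column 0 concerns the sizes of the whole shapes, whose increments are the
    -- weight.
    weight-partition : ∀ {p} → p ∈ yams → IsPartition (weight m n p)
    weight-partition {p} i t = subst₂ _≤_ (sym (PairTab.at-wt P (suc t))) (sym (PairTab.at-wt P t))
        (diff (PairTab.size-mono P t) (Yam.concave (yams-yam {p} i) t 0))
      where
      P : PairTab m (fˡ p) (fʳ p)
      P = yams-tab {p} i
      transpose : ∀ a {c o} → a + c ≤ o → c ≤ o ∸ a
      transpose a {c} le = ≤-trans (≤-reflexive (sym (m+n∸m≡n a c))) (∸-monoˡ-≤ a le)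
      diff : ∀ {a b c} → a ≤ b → a + c ≤ b + b → c ∸ b ≤ b ∸ a
      diff {a} {b} {c} a≤b le = ≤-trans (∸-monoˡ-≤ b (transpose a le)) (≤-reflexive (trans (cong (_∸ b) (+-∸-comm b a≤b)) (m+n∸n≡m (b ∸ a) b)))

  -- The ordinary Bender-Knuth involution on both tableaux: with threshold `width` no cell is kept,
  -- so `δ` is 0 and two adjacent weights are interchanged.
  N-symmetric : ∀ m → Symmetric m N
  N-symmetric m p x y z l = trans (sym (length-map refl-k (pairs λ′ μ ν ρ (p ++ x ∷ y ∷ z)))) (↭.↭-length
    (bijection⇒↭ refl-k {pairs λ′ μ ν ρ (p ++ x ∷ y ∷ z)} {pairs λ′ μ ν ρ (p ++ y ∷ x ∷ z)} (unique-pairs (p ++ x ∷ y ∷ z)) (unique-pairs (p ++ y ∷ x ∷ z))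
      (λ {a} i → go x y l {a} i)
      (λ {a} {b} i j eq → trans (sym (back x y l {a} i)) (trans (cong refl-k eq) (back x y l {b} j)))
      (λ {b} i → refl-k b , go y x l′ {b} i , back y x l′ {b} i)))
    where
    k = length p
    refl-k : Obj → Obj
    refl-k = reflect m k width width
    l′ : length (p ++ y ∷ x ∷ z) ≡ m
    l′ = trans (length-++ p) (trans (sym (length-++ p {x ∷ y ∷ z})) l)
    k< : suc k < m
    k< = subst (suc k <_) l (≤-trans (≤-reflexive (trans (+-comm 2 k) refl)) (≤-trans (+-monoʳ-≤ k (s≤s (s≤s z≤n))) (≤-reflexive (sym (length-++ p {x ∷ y ∷ z})))))
    module _ (x y : ℕ) (l : length (p ++ x ∷ y ∷ z) ≡ m) {a : Obj} (i : a ∈ pairs λ′ μ ν ρ (p ++ x ∷ y ∷ z)) where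
      private
        α = p ++ x ∷ y ∷ z
        α′ = p ++ y ∷ x ∷ z
        data₀ : PairTab m (fˡ a) (fʳ a) × wt m (fˡ a) (fʳ a) ≡ α × obj m (fˡ a) (fʳ a) ≡ a
        data₀ = subst (λ v → PairTab v (fˡ a) (fʳ a) × wt v (fˡ a) (fʳ a) ≡ α × obj v (fˡ a) (fʳ a) ≡ a) l (pairs⁻ α {a} i)
        P = proj₁ data₀
        w≡ = proj₁ (proj₂ data₀)
        open PairTab P
        gl : Layer.Good (fˡ a) k width
        gl r _ = widthˡ P (suc k) r
        gr : Layer.Good (fʳ a) k width
        gr r _ = widthʳ P (suc k) r
        open Reflect m k< {a} P (proj₂ (proj₂ data₀)) gl gr
        S0 : ∀ {T : Fun} → (∀ t r → T t r ≤ width) → ∀ t → S R (T t) width ≡ 0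
        S0 b t = ∑-zero R (λ r → m≤n⇒m∸n≡0 (b t r))
        rel : size F′ G′ (suc k) + size F G (suc k) ≡ size F G k + size F G (2 + k)
        rel = bk-size chˡ chʳ k width width 0 gl gr defect
          where
          defect : (S R (F (suc k)) width + S R (F (suc k)) width) + (S R (G (suc k)) width + S R (G (suc k)) width) ≡
            (S R (F k) width + S R (F (2 + k)) width) + (S R (G k) width + S R (G (2 + k)) width)
          defect rewrite S0 (widthˡ P) k | S0 (widthˡ P) (suc k) | S0 (widthˡ P) (2 + k)
                       | S0 (widthʳ P) k | S0 (widthʳ P) (suc k) | S0 (widthʳ P) (2 + k) = refl
        s₀≤ : size F G k ≤ size F′ G′ (suc k)
        s₀≤ = subst (_≤ size F′ G′ (suc k)) size-before (PairTab.size-mono P′ k)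
        e₁ : at (wt m F G) (suc k) ≡ at (wt m F′ G′) k
        e₁ = trans (at-wt (suc k)) (trans (flip-diff 0 s₀≤ rel) (sym (trans (PairTab.at-wt P′ k) (cong (size F′ G′ (suc k) ∸_) size-before))))
        e₂ : at (wt m F′ G′) (suc k) ≡ at (wt m F G) k
        e₂ = trans (PairTab.at-wt P′ (suc k)) (trans (cong (_∸ size F′ G′ (suc k)) size-after)
          (trans (flip-diff 0 (size-mono k) (trans (+-comm (size F G (suc k)) (size F′ G′ (suc k))) rel)) (sym (at-wt k))))
        w′≡ : wt m F′ G′ ≡ α′
        w′≡ = at-ext _ _ (trans (length-wt m F′ G′) (trans (sym l) (trans (length-++ p) (sym (length-++ p))))) pt
          where
          pt : ∀ t → at (wt m F′ G′) t ≡ at α′ t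
          pt t = cases (t ≟ k) (t ≟ suc k)
            where
            cases : Dec (t ≡ k) → Dec (t ≡ suc k) → at (wt m F′ G′) t ≡ at α′ t
            cases (yes refl) _ = trans (sym e₁) (trans (cong (λ v → at v (suc k)) w≡) (trans (at-++₁ p x (y ∷ z)) (sym (at-++ p (y ∷ x ∷ z)))))
            cases (no _) (yes refl) = trans e₂ (trans (cong (λ v → at v k) w≡) (trans (at-++ p (x ∷ y ∷ z)) (sym (at-++₁ p y (x ∷ z)))))
            cases (no n₀) (no n₁) = trans (sym (at-wt-off t n₀ n₁)) (trans (cong (λ v → at v t) w≡) (at-++-off p x y y x z n₀ n₁))
      go : refl-k a ∈ pairs λ′ μ ν ρ α′
      go = subst (λ v → obj m F′ G′ ∈ pairs λ′ μ ν ρ v) w′≡ (pairs⁺ P′)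
      back : refl-k (refl-k a) ≡ a
      back = invol

-- Products of symmetric functions

antidiag : ℕ → (ℕ → ℕ → ℕ) → ℕ
antidiag zero    F = F 0 0
antidiag (suc a) F = F 0 (suc a) + antidiag a (λ b c → F (suc b) c)

antidiag-cong : ∀ a {F G : ℕ → ℕ → ℕ} → (∀ b c → F b c ≡ G b c) → antidiag a F ≡ antidiag a G
antidiag-cong zero    e = e 0 0
antidiag-cong (suc a) e = cong₂ _+_ (e 0 (suc a)) (antidiag-cong a (λ b → e (suc b)))

antidiag-+ : ∀ a F G → antidiag a (λ b c → F b c + G b c) ≡ antidiag a F + antidiag a G
antidiag-+ zero    F G = refl
antidiag-+ (suc a) F G rewrite antidiag-+ a (λ b c → F (suc b) c) (λ b c → G (suc b) c) =
  ar (F 0 (suc a)) (G 0 (suc a)) (antidiag a (λ b c → F (suc b) c)) (antidiag a (λ b c → G (suc b) c))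
  where
  ar : ∀ x y u v → x + y + (u + v) ≡ x + u + (y + v)
  ar = solve-∀

antidiag-last : ∀ a F → antidiag (suc a) F ≡ antidiag a (λ b c → F b (suc c)) + F (suc a) 0
antidiag-last zero    F = refl
antidiag-last (suc a) F rewrite antidiag-last a (λ b c → F (suc b) c) = sym (+-assoc (F 0 (2 + a)) _ _)

antidiag-comm : ∀ a F → antidiag a F ≡ antidiag a (flip F)
antidiag-comm zero    F = refl
antidiag-comm (suc a) F = trans (+-comm (F 0 (suc a)) _)
  (trans (cong (_+ F 0 (suc a)) (antidiag-comm a (λ b c → F (suc b) c))) (sym (antidiag-last a (flip F))))

antidiag-assoc : ∀ a (G : ℕ → ℕ → ℕ → ℕ) →
  antidiag a (λ b c → antidiag b (λ p q → G p q c)) ≡ antidiag a (λ p b → antidiag b (λ q c → G p q c))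
antidiag-assoc zero    G = refl
antidiag-assoc (suc a) G = trans
  (cong (G 0 0 (suc a) +_) (trans (antidiag-+ a (λ b c → G 0 (suc b) c) _)
    (cong (antidiag a (λ b c → G 0 (suc b) c) +_) (antidiag-assoc a (λ p → G (suc p))))))
  (sym (+-assoc (G 0 0 (suc a)) _ _))

-- The Cauchy product one variable at a time. Antidiagonals keep both exponents explicit, so no
-- truncated subtraction occurs and the ring laws reduce to those of `antidiag`.
_∙_ : Poly → Poly → Poly
(f ∙ g) []      = f [] * g []
(f ∙ g) (a ∷ α) = antidiag a (λ b c → ((λ β → f (b ∷ β)) ∙ (λ γ → g (c ∷ γ))) α)

sum-concatMap : ∀ {A B : Set} (h : B → ℕ) (F : A → List B) xs → sum (map h (concatMap F xs)) ≡ sum (map (λ x → sum (map h (F x))) xs)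
sum-concatMap h F []       = refl
sum-concatMap h F (x ∷ xs) = trans (cong sum (map-++ h (F x) (concatMap F xs)))
  (trans (sum-++ (map h (F x)) _) (cong (sum (map h (F x)) +_) (sum-concatMap h F xs)))

sum-antidiag : ∀ a (F : ℕ → ℕ → ℕ) → sum (map (λ b → F b (a ∸ b)) (upTo (suc a))) ≡ antidiag a F
sum-antidiag a F = trans (cong sum (map-applyUpTo id (suc a))) (go a F)
  where
  map-applyUpTo : ∀ f n → map (λ b → F b (a ∸ b)) (applyUpTo f n) ≡ applyUpTo (λ b → F (f b) (a ∸ f b)) n
  map-applyUpTo f zero    = refl
  map-applyUpTo f (suc n) = cong (F (f 0) (a ∸ f 0) ∷_) (map-applyUpTo (f ∘ suc) n)
  go : ∀ a F → sum (applyUpTo (λ b → F b (a ∸ b)) (suc a)) ≡ antidiag a F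
  go zero    F = +-identityʳ _
  go (suc a) F = cong (F 0 (suc a) +_) (go a (λ b c → F (suc b) c))

·≡∙ : ∀ f g α → (f · g) α ≡ (f ∙ g) α
·≡∙ f g []      = +-identityʳ _
·≡∙ f g (a ∷ α) = begin
  sum (map h (concatMap (λ b → map (b ∷_) (below α)) (upTo (suc a))))
    ≡⟨ sum-concatMap h (λ b → map (b ∷_) (below α)) (upTo (suc a)) ⟩
  sum (map (λ b → sum (map h (map (b ∷_) (below α)))) (upTo (suc a)))
    ≡⟨ cong sum (map-cong (λ b → trans (cong sum (sym (map-∘ (below α)))) (·≡∙ (λ β → f (b ∷ β)) (λ γ → g (a ∸ b ∷ γ)) α)) (upTo (suc a))) ⟩
  sum (map (λ b → ((λ β → f (b ∷ β)) ∙ (λ γ → g (a ∸ b ∷ γ))) α) (upTo (suc a)))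
    ≡⟨ sum-antidiag a (λ b c → ((λ β → f (b ∷ β)) ∙ (λ γ → g (c ∷ γ))) α) ⟩
  (f ∙ g) (a ∷ α) ∎
  where
  open ≡-Reasoning
  h = λ β → f β * g (zipWith _∸_ (a ∷ α) β)

_≗ₚ_ : Poly → Poly → Set
f ≗ₚ g = ∀ α → f α ≡ g α

∙-cong : ∀ {f f′ g g′} → f ≗ₚ f′ → g ≗ₚ g′ → (f ∙ g) ≗ₚ (f′ ∙ g′)
∙-cong e e′ []      = cong₂ _*_ (e []) (e′ [])
∙-cong e e′ (a ∷ α) = antidiag-cong a (λ b c → ∙-cong (λ β → e (b ∷ β)) (λ γ → e′ (c ∷ γ)) α)

∙-comm : ∀ f g → (f ∙ g) ≗ₚ (g ∙ f)
∙-comm f g []      = *-comm (f []) (g [])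
∙-comm f g (a ∷ α) = trans (antidiag-cong a (λ b c → ∙-comm (λ β → f (b ∷ β)) (λ γ → g (c ∷ γ)) α))
  (antidiag-comm a _)

∙-+ˡ : ∀ f f′ g → ((λ β → f β + f′ β) ∙ g) ≗ₚ (λ α → (f ∙ g) α + (f′ ∙ g) α)
∙-+ˡ f f′ g []      = *-distribʳ-+ (g []) (f []) (f′ [])
∙-+ˡ f f′ g (a ∷ α) = trans (antidiag-cong a (λ b c → ∙-+ˡ (λ β → f (b ∷ β)) (λ β → f′ (b ∷ β)) (λ γ → g (c ∷ γ)) α))
  (antidiag-+ a _ _)

∙-antidiagˡ : ∀ b (F : ℕ → ℕ → Poly) g α → ((λ β → antidiag b (λ p q → F p q β)) ∙ g) α ≡ antidiag b (λ p q → (F p q ∙ g) α)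
∙-antidiagˡ zero    F g α = refl
∙-antidiagˡ (suc b) F g α = trans (∙-+ˡ (F 0 (suc b)) _ g α) (cong ((F 0 (suc b) ∙ g) α +_) (∙-antidiagˡ b (λ p q → F (suc p) q) g α))

∙-antidiagʳ : ∀ b (F : ℕ → ℕ → Poly) g α → (g ∙ (λ β → antidiag b (λ p q → F p q β))) α ≡ antidiag b (λ p q → (g ∙ F p q) α)
∙-antidiagʳ b F g α = trans (∙-comm g _ α) (trans (∙-antidiagˡ b F g α) (antidiag-cong b (λ p q → ∙-comm (F p q) g α)))

∙-assoc : ∀ f g h → ((f ∙ g) ∙ h) ≗ₚ (f ∙ (g ∙ h))
∙-assoc f g h []      = *-assoc (f []) (g []) (h [])
∙-assoc f g h (a ∷ α) = begin
  antidiag a (λ b c → ((λ β → (f ∙ g) (b ∷ β)) ∙ h′ c) α)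
    ≡⟨ antidiag-cong a (λ b c → trans (∙-antidiagˡ b (λ p q → f′ p ∙ g′ q) (h′ c) α) (antidiag-cong b (λ p q → ∙-assoc (f′ p) (g′ q) (h′ c) α))) ⟩
  antidiag a (λ b c → antidiag b (λ p q → (f′ p ∙ (g′ q ∙ h′ c)) α))
    ≡⟨ antidiag-assoc a (λ p q c → (f′ p ∙ (g′ q ∙ h′ c)) α) ⟩
  antidiag a (λ p b → antidiag b (λ q c → (f′ p ∙ (g′ q ∙ h′ c)) α))
    ≡⟨ antidiag-cong a (λ p b → sym (∙-antidiagʳ b (λ q c → g′ q ∙ h′ c) (f′ p) α)) ⟩
  (f ∙ (g ∙ h)) (a ∷ α) ∎
  where
  open ≡-Reasoning
  f′ = λ b β → f (b ∷ β)
  g′ = λ b β → g (b ∷ β)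
  h′ = λ b β → h (b ∷ β)

∙-zeroˡ : ∀ g → ((λ _ → 0) ∙ g) ≗ₚ (λ _ → 0)
∙-zeroˡ g []      = refl
∙-zeroˡ g (a ∷ α) = go a (λ c → (λ γ → g (c ∷ γ)))
  where
  go : ∀ a (G : ℕ → Poly) → antidiag a (λ b c → ((λ _ → 0) ∙ G c) α) ≡ 0
  go zero    G = ∙-zeroˡ (G 0) α
  go (suc a) G rewrite ∙-zeroˡ (G (suc a)) α = go a G

∙-identityˡ : ∀ g → (onePoly ∙ g) ≗ₚ g
∙-identityˡ g []      = +-identityʳ _
∙-identityˡ g (a ∷ α) = trans (head a (λ c γ → g (c ∷ γ))) (∙-identityˡ (λ γ → g (a ∷ γ)) α)
  where
  rest : ∀ a (G : ℕ → Poly) → antidiag a (λ b c → ((λ β → onePoly (suc b ∷ β)) ∙ G c) α) ≡ 0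
  rest zero    G = ∙-zeroˡ (G 0) α
  rest (suc a) G rewrite ∙-zeroˡ (G (suc a)) α = tail a G
    where
    tail : ∀ a (G : ℕ → Poly) → antidiag a (λ b c → ((λ β → onePoly (suc (suc b) ∷ β)) ∙ G c) α) ≡ 0
    tail zero    G = ∙-zeroˡ (G 0) α
    tail (suc a) G rewrite ∙-zeroˡ (G (suc a)) α = tail a G
  head : ∀ a (G : ℕ → Poly) → antidiag a (λ b c → ((λ β → onePoly (b ∷ β)) ∙ G c) α) ≡ (onePoly ∙ G a) α
  head zero    G = refl
  head (suc a) G = trans (cong ((onePoly ∙ G (suc a)) α +_) (rest a G)) (+-identityʳ _)

·-cong : ∀ {f f′ g g′} → f ≗ₚ f′ → g ≗ₚ g′ → (f · g) ≗ₚ (f′ · g′)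
·-cong {f} {f′} {g} {g′} e e′ α = trans (·≡∙ f g α) (trans (∙-cong e e′ α) (sym (·≡∙ f′ g′ α)))

·-comm : ∀ f g → (f · g) ≗ₚ (g · f)
·-comm f g α = trans (·≡∙ f g α) (trans (∙-comm f g α) (sym (·≡∙ g f α)))

·-assoc : ∀ f g h → ((f · g) · h) ≗ₚ (f · (g · h))
·-assoc f g h α = trans (·≡∙ (f · g) h α) (trans (∙-cong (·≡∙ f g) (λ _ → refl) α) (trans (∙-assoc f g h α)
  (trans (∙-cong (λ _ → refl) (λ β → sym (·≡∙ g h β)) α) (sym (·≡∙ f (g · h) α)))))

·-+ˡ : ∀ f f′ g → ((λ β → f β + f′ β) · g) ≗ₚ (λ α → (f · g) α + (f′ · g) α)
·-+ˡ f f′ g α = trans (·≡∙ _ g α) (trans (∙-+ˡ f f′ g α) (cong₂ _+_ (sym (·≡∙ f g α)) (sym (·≡∙ f′ g α))))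

·-zeroˡ : ∀ g → ((λ _ → 0) · g) ≗ₚ (λ _ → 0)
·-zeroˡ g α = trans (·≡∙ _ g α) (∙-zeroˡ g α)

·-identityˡ : ∀ g → (onePoly · g) ≗ₚ g
·-identityˡ g α = trans (·≡∙ onePoly g α) (∙-identityˡ g α)

·-identityʳ : ∀ g → (g · onePoly) ≗ₚ g
·-identityʳ g α = trans (·-comm g onePoly α) (·-identityˡ g α)

·-*ˡ : ∀ k f g → ((λ β → k * f β) · g) ≗ₚ (λ α → k * (f · g) α)
·-*ˡ zero    f g α = ·-zeroˡ g α
·-*ˡ (suc k) f g α = trans (·-+ˡ f (λ β → k * f β) g α) (cong ((f · g) α +_) (·-*ˡ k f g α))

-- Zero exponents and bijections between tableaux

ZeroInv : Poly → Set
ZeroInv f = ∀ p s → f (p ++ 0 ∷ s) ≡ f (p ++ s)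

∙-zeroInv : ∀ {f g} → ZeroInv f → ZeroInv g → ZeroInv (f ∙ g)
∙-zeroInv zf zg []      s = ∙-cong (zf []) (zg []) s
∙-zeroInv zf zg (a ∷ p) s = antidiag-cong a (λ b c → ∙-zeroInv (λ q → zf (b ∷ q)) (λ q → zg (c ∷ q)) p s)

·-zeroInv : ∀ {f g} → ZeroInv f → ZeroInv g → ZeroInv (f · g)
·-zeroInv {f} {g} zf zg p s = trans (·≡∙ f g (p ++ 0 ∷ s)) (trans (∙-zeroInv zf zg p s) (sym (·≡∙ f g (p ++ s))))

nonzeros : List ℕ → List ℕ
nonzeros []          = []
nonzeros (zero ∷ α)  = nonzeros α
nonzeros (suc a ∷ α) = suc a ∷ nonzeros α

length-nonzeros : ∀ α → length (nonzeros α) ≤ sum α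
length-nonzeros []          = z≤n
length-nonzeros (zero ∷ α)  = length-nonzeros α
length-nonzeros (suc a ∷ α) = s≤s (≤-trans (length-nonzeros α) (m≤n+m (sum α) a))

nonzeros-inv : ∀ f → ZeroInv f → ∀ p α → f (p ++ α) ≡ f (p ++ nonzeros α)
nonzeros-inv f zf p []          = refl
nonzeros-inv f zf p (zero ∷ α)  = trans (zf p α) (nonzeros-inv f zf p α)
nonzeros-inv f zf p (suc a ∷ α) = trans (cong f (sym (++-assoc p [ suc a ] α)))
  (trans (nonzeros-inv f zf (p ++ [ suc a ]) α) (cong f (++-assoc p [ suc a ] (nonzeros α))))

-- With `nonzeros-inv`, this carries an identity proved in one fixed number of variables over to
-- exponent vectors of other lengths.
pad-inv : ∀ f → ZeroInv f → ∀ j α → f (α ++ replicate j 0) ≡ f α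
pad-inv f zf zero    α = cong f (++-identityʳ α)
pad-inv f zf (suc j) α = trans (zf α (replicate j 0)) (pad-inv f zf j α)

module _ (λ′ μ λ″ μ″ : List ℕ) (p : IsPartition λ′) (p″ : IsPartition λ″)
  (l : length μ ≤ length λ′) (l″ : length μ″ ≤ length λ″) where
  private
    R = length λ′
    R″ = length λ″

    Good-tab : List ℕ → List ℕ → List ℕ → Fun → Set
    Good-tab λ′ μ α F = Tab (length α) (at λ′) (at μ) F × (∀ t → ∑ (length λ′) (F (suc t)) ≡ at α t + ∑ (length λ′) (F t))

  kostka-bijection : ∀ α (Φ Ψ : Fun → Fun) →
    (∀ {F} → Good-tab λ′ μ α F → Good-tab λ″ μ″ α (Φ F)) → (∀ {F} → Good-tab λ″ μ″ α F → Good-tab λ′ μ α (Ψ F)) →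
    (∀ {F G} → F ≗₂ G → Φ F ≗₂ Φ G) → (∀ {F G} → F ≗₂ G → Ψ F ≗₂ Ψ G) →
    (∀ {F} → Good-tab λ′ μ α F → Ψ (Φ F) ≗₂ F) → (∀ {F} → Good-tab λ″ μ″ α F → Φ (Ψ F) ≗₂ F) →
    kostka λ′ μ α ≡ kostka λ″ μ″ α
  kostka-bijection α Φ Ψ okΦ okΨ Φ-cong Ψ-cong ΨΦ ΦΨ = begin
    kostka λ′ μ α                       ≡⟨ sym (length-enum λ′ μ α) ⟩
    length (enum λ′ μ α)                ≡⟨ sym (length-map to (enum λ′ μ α)) ⟩
    length (map to (enum λ′ μ α))       ≡⟨ ↭.↭-length (bijection⇒↭ to (unique-enum λ′ μ α) (unique-enum λ″ μ″ α) to∈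
                                             (λ i j e → trans (sym (from-to i)) (trans (cong from e) (from-to j)))
                                             (λ {y} i → from y , from∈ i , to-from i)) ⟩
    length (enum λ″ μ″ α)               ≡⟨ length-enum λ″ μ″ α ⟩
    kostka λ″ μ″ α ∎
    where
    open ≡-Reasoning
    m = length α
    to from : List (List ℕ) → List (List ℕ)
    to x = tab R″ m (Φ (fn μ x))
    from y = tab R m (Ψ (fn μ″ y))
    good : ∀ {x} → x ∈ enum λ′ μ α → Good-tab λ′ μ α (fn μ x)
    good i = let (T , C , _) = enum⁻ p α l i in T , C
    good″ : ∀ {x} → x ∈ enum λ″ μ″ α → Good-tab λ″ μ″ α (fn μ″ x)
    good″ i = let (T , C , _) = enum⁻ p″ α l″ i in T , C
    back : ∀ {x} → x ∈ enum λ′ μ α → tab R m (fn μ x) ≡ x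
    back {x} i = let (_ , _ , lx , ls) = enum⁻ p α l i in trans (cong (λ z → tab R z (fn μ x)) (sym lx)) (tab-fn R μ x ls)
    back″ : ∀ {x} → x ∈ enum λ″ μ″ α → tab R″ m (fn μ″ x) ≡ x
    back″ {x} i = let (_ , _ , lx , ls) = enum⁻ p″ α l″ i in trans (cong (λ z → tab R″ z (fn μ″ x)) (sym lx)) (tab-fn R″ μ″ x ls)
    fnt : ∀ {F} → Good-tab λ′ μ α F → fn μ (tab R m F) ≗₂ F
    fnt (T , _) = fn-tab μ (λ r le → at-beyond λ′ le) T
    fnt″ : ∀ {F} → Good-tab λ″ μ″ α F → fn μ″ (tab R″ m F) ≗₂ F
    fnt″ (T , _) = fn-tab μ″ (λ r le → at-beyond λ″ le) T
    to∈ : ∀ {x} → x ∈ enum λ′ μ α → to x ∈ enum λ″ μ″ α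
    to∈ i = let (T , C) = okΦ (good i) in enum⁺ p″ α l″ T C
    from∈ : ∀ {x} → x ∈ enum λ″ μ″ α → from x ∈ enum λ′ μ α
    from∈ i = let (T , C) = okΨ (good″ i) in enum⁺ p α l T C
    from-to : ∀ {x} → x ∈ enum λ′ μ α → from (to x) ≡ x
    from-to i = trans (tab-cong R m (λ t r → trans (Ψ-cong (fnt″ (okΦ (good i))) t r) (ΨΦ (good i) t r))) (back i)
    to-from : ∀ {x} → x ∈ enum λ″ μ″ α → to (from x) ≡ x
    to-from i = trans (tab-cong R″ m (λ t r → trans (Φ-cong (fnt (okΨ (good″ i))) t r) (ΦΨ (good″ i) t r))) (back″ i)

_≈ₚ_ : List ℕ → List ℕ → Set
xs ≈ₚ ys = ∀ j → at xs j ≡ at ys j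

∑-beyond : ∀ n j {f} → (∀ r → n ≤ r → f r ≡ 0) → ∑ (j + n) f ≡ ∑ n f
∑-beyond n zero    e = refl
∑-beyond n (suc j) e rewrite ∑-beyond n j e | e (j + n) (m≤n+m n j) = +-identityʳ _

∑-support : ∀ m n {f} → (∀ r → m ≤ r → f r ≡ 0) → (∀ r → n ≤ r → f r ≡ 0) → ∑ m f ≡ ∑ n f
∑-support m n {f} e e′ = trans (sym (∑-beyond m n e)) (trans (cong (λ z → ∑ z f) (+-comm n m)) (∑-beyond n m e′))

partition-≈ : ∀ {xs ys} → xs ≈ₚ ys → IsPartition xs → IsPartition ys
partition-≈ e p j = subst₂ _≤_ (e (suc j)) (e j) (p j)

kostka-cong : ∀ {λ′ μ λ″ μ″} → IsPartition λ′ → length μ ≤ length λ′ → length μ″ ≤ length λ″ →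
  λ′ ≈ₚ λ″ → μ ≈ₚ μ″ → ∀ α → kostka λ′ μ α ≡ kostka λ″ μ″ α
kostka-cong {λ′} {μ} {λ″} {μ″} p l l″ eλ eμ α = kostka-bijection λ′ μ λ″ μ″ p (partition-≈ {λ′} {λ″} eλ p) l l″ α id id
  (λ {F} (T , C) → conv λ′ λ″ μ μ″ eλ eμ T , cont λ′ λ″ μ eλ T C)
  (λ {F} (T , C) → conv λ″ λ′ μ″ μ (sym ∘ eλ) (sym ∘ eμ) T , cont λ″ λ′ μ″ (sym ∘ eλ) T C)
  id id (λ _ _ _ → refl) (λ _ _ _ → refl)
  where
  conv : ∀ λ′ λ″ μ μ″ {m F} → λ′ ≈ₚ λ″ → μ ≈ₚ μ″ → Tab m (at λ′) (at μ) F → Tab m (at λ″) (at μ″) F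
  conv λ′ λ″ μ μ″ eλ eμ T = record { start = λ r → trans (start r) (eμ r) ; end = λ t r le → trans (end t r le) (eλ r) ; mono = mono ; strip = strip }
    where open Tab T
  cont : ∀ λ′ λ″ μ {m F} → λ′ ≈ₚ λ″ → Tab m (at λ′) (at μ) F → (∀ t → ∑ (length λ′) (F (suc t)) ≡ at α t + ∑ (length λ′) (F t)) →
    ∀ t → ∑ (length λ″) (F (suc t)) ≡ at α t + ∑ (length λ″) (F t)
  cont λ′ λ″ μ {F = F} eλ T C t = trans (sym (eq (suc t))) (trans (C t) (cong (at α t +_) (eq t)))
    where
    null : ∀ xs → λ′ ≈ₚ xs → ∀ t r → length xs ≤ r → F t r ≡ 0
    null xs e t r le = n≤0⇒n≡0 (≤-trans (Tab.bounded T t r) (≤-reflexive (trans (e r) (at-beyond xs le))))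
    eq : ∀ t → ∑ (length λ′) (F t) ≡ ∑ (length λ″) (F t)
    eq t = ∑-support (length λ′) (length λ″) (null λ′ (λ _ → refl) t) (null λ″ eλ t)

-- The new top row has no cell and stays equal to `K` at all times, and `K` is long enough to impose
-- nothing on the row below. This later turns the last shape and the first into neighbours whose
-- rows are offset by one.
kostka-prepend : ∀ K {λ′ μ} → IsPartition λ′ → length μ ≤ length λ′ → at λ′ 0 ≤ K → ∀ α →
  kostka (K ∷ λ′) (K ∷ μ) α ≡ kostka λ′ μ α
kostka-prepend K {λ′} {μ} p l le α = sym (kostka-bijection λ′ μ (K ∷ λ′) (K ∷ μ) p p′ l (s≤s l) α Φ Ψ okΦ okΨ
    (λ { e t zero → refl ; e t (suc r) → e t r }) (λ e t r → e t (suc r)) (λ _ _ _ → refl)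
    (λ { g t zero → sym (top g t) ; g t (suc r) → refl }))
  where
  p′ : IsPartition (K ∷ λ′)
  p′ zero    = le
  p′ (suc j) = p j
  m = length α
  R = length λ′
  Φ Ψ : Fun → Fun
  Φ F t zero    = K
  Φ F t (suc r) = F t r
  Ψ F t r = F t (suc r)
  Cnt : ℕ → Fun → Set
  Cnt R F = ∀ t → ∑ R (F (suc t)) ≡ at α t + ∑ R (F t)
  ∑Φ : ∀ F t → ∑ (suc R) (Φ F t) ≡ K + ∑ R (F t)
  ∑Φ F t = ∑-front R (Φ F t)
  swap : ∀ a b c → a + (b + c) ≡ b + (a + c)
  swap a b c = trans (sym (+-assoc a b c)) (trans (cong (_+ c) (+-comm a b)) (+-assoc b a c))
  okΦ : ∀ {F} → Tab m (at λ′) (at μ) F × Cnt R F → Tab m (at (K ∷ λ′)) (at (K ∷ μ)) (Φ F) × Cnt (suc R) (Φ F)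
  okΦ {F} (T , C) = record
    { start = λ { zero → refl ; (suc r) → start r } ; end = λ { t zero _ → refl ; t (suc r) le → end t r le }
    ; mono = λ { t zero → ≤-refl ; t (suc r) → mono t r }
    ; strip = λ { t zero → ≤-trans (bounded (suc t) 0) le ; t (suc r) → strip t r } }
    , λ t → trans (∑Φ F (suc t)) (trans (cong (K +_) (C t)) (trans (swap K (at α t) _) (cong (at α t +_) (sym (∑Φ F t)))))
    where open Tab T
  top : ∀ {F} → Tab m (at (K ∷ λ′)) (at (K ∷ μ)) F × Cnt (suc R) F → ∀ t → F t 0 ≡ K
  top {F} (T , _) t = ≤-antisym (Tab.bounded T t 0) (go t)
    where
    go : ∀ t → K ≤ F t 0
    go zero    = ≤-reflexive (sym (Tab.start T 0))
    go (suc t) = ≤-trans (go t) (Tab.mono T t 0)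
  okΨ : ∀ {F} → Tab m (at (K ∷ λ′)) (at (K ∷ μ)) F × Cnt (suc R) F → Tab m (at λ′) (at μ) (Ψ F) × Cnt R (Ψ F)
  okΨ {F} g@(T , C) = record { start = start ∘ suc ; end = λ t r → end t (suc r) ; mono = λ t r → mono t (suc r) ; strip = λ t r → strip t (suc r) }
    , λ t → +-cancelˡ-≡ K _ _ (trans (sym (split (suc t))) (trans (C t) (trans (cong (at α t +_) (split t)) (swap (at α t) K _))))
    where
    open Tab T
    split : ∀ t → ∑ (suc R) (F t) ≡ K + ∑ R (Ψ F t)
    split t = trans (∑-front R (F t)) (cong (_+ ∑ R (Ψ F t)) (top g t))

sum-map-cong-∈ : ∀ {A : Set} {f g : A → ℕ} xs → (∀ {x} → x ∈ xs → f x ≡ g x) → sum (map f xs) ≡ sum (map g xs)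
sum-map-cong-∈ []       e = refl
sum-map-cong-∈ (x ∷ xs) e = cong₂ _+_ (e (here refl)) (sum-map-cong-∈ xs (e ∘ there))

∑-equal : ∀ n {f g : ℕ → ℕ} → (∀ r → f r ≤ g r) → ∑ n f ≡ ∑ n g → ∀ r → r < n → f r ≡ g r
∑-equal (suc n) {f} {g} le e r lt with r ≟ n
... | yes refl = ≤-antisym (le r) (+-cancelˡ-≤ (∑ n f) _ _ (≤-trans (+-monoˡ-≤ (g n) (∑-mono n le)) (≤-reflexive (sym e))))
... | no ne = ∑-equal n le (≤-antisym (∑-mono n le) (+-cancelʳ-≤ (f n) _ _ (≤-trans (+-monoʳ-≤ (∑ n g) (le n)) (≤-reflexive (sym e))))) r (≤∧≢⇒< (≤-pred lt) ne)

singleton : ∀ {A : Set} {y : A} {xs} → Unique xs → (∀ {x} → x ∈ xs → x ≡ y) → y ∈ xs → xs ≡ [ y ]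
singleton {xs = x ∷ []} u e i = cong [_] (e (here refl))
singleton {xs = x ∷ z ∷ xs} ((ne ∷ _) ∷ _) e i = ⊥-elim (ne (trans (e (here refl)) (sym (e (there (here refl))))))

-- A horizontal strip of size 0 leaves only one choice, `μ` itself, written with the length of `λ′`.
kostka-zeroInv : ∀ {λ′} → IsPartition λ′ → ∀ {μ} → IsPartition μ → μ ⊆ₚ λ′ → length μ ≤ length λ′ → ZeroInv (kostka λ′ μ)
kostka-zeroInv {λ′} pλ {μ} pμ sub l [] s = trans (cong (λ z → sum (map (λ κ → kostka λ′ κ s) z)) single)
    (trans (+-identityʳ _) (kostka-cong pλ (≤-reflexive (length-applyUpTo (at μ) R)) l (λ _ → refl) at-κ s))
  where
  R = length λ′
  κ₀ = row R (at μ)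
  at-κ : ∀ j → at κ₀ j ≡ at μ j
  at-κ = at-row-null R (at μ) (λ j le → at-beyond μ (≤-trans l le))
  sumκ : sum κ₀ ≡ sum μ
  sumκ = trans (sum≡∑ R κ₀ (≤-reflexive (length-applyUpTo (at μ) R))) (trans (∑-cong R at-κ) (sym (sum≡∑ R μ l)))
  St : Strip μ λ′ 0 (at λ′ 0) κ₀
  St = record
    { len = length-applyUpTo (at μ) R
    ; lo = λ i _ → ≤-reflexive (trans (cong (at μ) (+-identityʳ i)) (sym (at-κ i)))
    ; hi = λ i → subst (_≤ at λ′ i) (sym (at-κ i)) (sub i)
    ; top = subst (_≤ at λ′ 0) (sym (at-κ 0)) (sub 0)
    ; next = λ i → subst₂ _≤_ (sym (at-κ (suc i))) (cong (at μ) (sym (+-identityʳ i))) (pμ i) }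
  sum? = λ κ → sum κ ≟ 0 + sum μ
  only : ∀ {κ} → κ ∈ strips λ′ μ 0 → κ ≡ κ₀
  only {κ} i with ∈-filter⁻ sum? {xs = stripsGen μ λ′ 0 (at λ′ 0)} i
  ... | j , e = at-ext κ κ₀ (trans len (sym (length-applyUpTo (at μ) R))) eq
    where
    open Strip (strip⁻ μ λ′ 0 (at λ′ 0) j)
    low : ∀ r → at μ r ≤ at κ r
    low r with r <? R
    ... | yes lt = subst (λ z → at μ z ≤ at κ r) (+-identityʳ r) (lo r lt)
    ... | no nlt rewrite at-beyond μ (≤-trans l (≮⇒≥ nlt)) = z≤n
    eq : ∀ r → at κ r ≡ at κ₀ r
    eq r with r <? R
    ... | yes lt = trans (sym (∑-equal R low (trans (sym (sum≡∑ R μ l)) (trans (sym e) (sum≡∑ R κ (≤-reflexive len)))) r lt)) (sym (at-κ r))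
    ... | no nlt = trans (at-beyond κ (≤-trans (≤-reflexive len) (≮⇒≥ nlt))) (sym (trans (at-κ r) (at-beyond μ (≤-trans l (≮⇒≥ nlt)))))
  single : strips λ′ μ 0 ≡ [ κ₀ ]
  single = singleton (Unique.filter⁺ sum? (unique-stripsGen μ λ′ 0 (at λ′ 0))) only (∈-filter⁺ sum? (strip⁺ μ λ′ 0 (at λ′ 0) St) sumκ)
kostka-zeroInv {λ′} pλ {μ} pμ sub l (a ∷ p) s = sum-map-cong-∈ (strips λ′ μ a) step
  where
  sum? = λ κ → sum κ ≟ a + sum μ
  step : ∀ {κ} → κ ∈ strips λ′ μ a → kostka λ′ κ (p ++ 0 ∷ s) ≡ kostka λ′ κ (p ++ s)
  step {κ} i = kostka-zeroInv pλ part hi (≤-reflexive len) p s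
    where
    open Strip (strip⁻ μ λ′ 0 (at λ′ 0) (proj₁ (∈-filter⁻ sum? {xs = stripsGen μ λ′ 0 (at λ′ 0)} i)))
    part : IsPartition κ
    part r with r <? length λ′
    ... | yes lt = ≤-trans (next r) (lo r lt)
    ... | no nlt rewrite at-beyond κ {suc r} (≤-trans (≤-reflexive len) (m≤n⇒m≤1+n (≮⇒≥ nlt))) = z≤n

at-zeros : ∀ n j → at (replicate n 0) j ≡ 0
at-zeros zero    j       = refl
at-zeros (suc n) zero    = refl
at-zeros (suc n) (suc j) = at-zeros n j

skewSchur-empty : ∀ n → skewSchur (replicate n 0) [] ≗ₚ onePoly
skewSchur-empty n α = trans (kostka-cong {replicate n 0} {[]} {[]} {[]} part z≤n z≤n (at-zeros n) (λ _ → refl) α) (go α)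
  where
  part : IsPartition (replicate n 0)
  part j rewrite at-zeros n (suc j) = z≤n
  go : ∀ α → kostka [] [] α ≡ onePoly α
  go []          = refl
  go (zero ∷ α)  = trans (+-identityʳ _) (go α)
  go (suc a ∷ α) = refl

-- The superstandard tableau and the pairing with Schur functions

∑-cong< : ∀ n {f g : ℕ → ℕ} → (∀ r → r < n → f r ≡ g r) → ∑ n f ≡ ∑ n g
∑-cong< zero    e = refl
∑-cong< (suc n) e = cong₂ _+_ (∑-cong< n (λ r lt → e r (m<n⇒m<1+n lt))) (e n ≤-refl)

∑-strict : ∀ n {f g : ℕ → ℕ} → (∀ r → f r ≤ g r) → ∀ {t} → t < n → f t < g t → ∑ n f < ∑ n g
∑-strict (suc n) {f} {g} le {t} lt st with t ≟ n
... | yes refl = ≤-trans (≤-reflexive (sym (+-suc (∑ n f) (f n)))) (+-mono-≤ (∑-mono n le) st)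
... | no ne = +-mono-≤ (∑-strict n le (≤∧≢⇒< (≤-pred lt) ne) st) (le n)

∑-telescope : ∀ n (w : ℕ → ℕ) → (∀ t → w t ≤ w (suc t)) → ∑ n (λ t → w (suc t) ∸ w t) + w 0 ≡ w n
∑-telescope zero    w mo = refl
∑-telescope (suc n) w mo = trans (ar (∑ n (λ t → w (suc t) ∸ w t)) (w (suc n) ∸ w n) (w 0))
  (trans (cong (w (suc n) ∸ w n +_) (∑-telescope n w mo)) (m∸n+n≡m (mo n)))
  where
  ar : ∀ a b c → a + b + c ≡ b + (a + c)
  ar = solve-∀

module Canonical (m : ℕ) (τ : List ℕ) (pτ : IsPartition τ) (lτ : length τ ≡ m) where

  zeros : List ℕ
  zeros = replicate m 0

  private
    pz : IsPartition zeros
    pz j rewrite at-zeros m (suc j) = z≤n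

  open Expansion m τ [] zeros [] pτ pz lτ (length-replicate m) z≤n z≤n public
  open Pair m
  open PairY m

  N≡schur : ∀ α → N α ≡ schur τ α
  N≡schur α = trans (length-pairs τ [] zeros [] α) (trans (·-cong {schur τ} {schur τ} (λ _ → refl) (skewSchur-empty m) α) (·-identityʳ (schur τ) α))

  total≡ : total ≡ sum τ
  total≡ = trans (cong₂ _+_ (sym (sum≡∑ m τ (≤-reflexive lτ))) (∑-zero m (at-zeros m))) (+-identityʳ (sum τ))

  -- The superstandard tableau, all entries of row `r` being `r`, paired with the empty tableau. An
  -- empty second factor makes the two-factor cancellation available for a single Schur function.
  F₀ Z : Fun
  F₀ t r with r <? t
  ... | yes _ = at τ r
  ... | no _  = 0
  Z _ _ = 0

  private
    F-in : ∀ {t r} → r < t → F₀ t r ≡ at τ r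
    F-in {t} {r} lt with r <? t
    ... | yes _ = refl
    ... | no n  = ⊥-elim (n lt)

    F-out : ∀ {t r} → t ≤ r → F₀ t r ≡ 0
    F-out {t} {r} le with r <? t
    ... | yes p = ⊥-elim (<-irrefl refl (≤-trans p le))
    ... | no _  = refl

  private
    unchanged : ∀ (g : ℕ → ℕ) {t} n → n ≤ t → ∑ n (λ r → g (F₀ (suc t) r)) ≡ ∑ n (λ r → g (F₀ t r))
    unchanged g n le = ∑-cong< n (λ r lt → cong g (trans (F-in (m<n⇒m<1+n (≤-trans lt le))) (sym (F-in (≤-trans lt le)))))

  cut : ∀ (g : ℕ → ℕ) → g 0 ≡ 0 → ∀ t → ∑ m (λ r → g (F₀ (suc t) r)) ≡ ∑ m (λ r → g (F₀ t r)) + g (at τ t)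
  cut g g0 t with t <? m
  ... | no nlt = trans (unchanged g m (≮⇒≥ nlt)) (sym (trans (cong (∑ m (λ r → g (F₀ t r)) +_)
                   (trans (cong g (at-beyond τ (≤-trans (≤-reflexive lτ) (≮⇒≥ nlt)))) g0)) (+-identityʳ _)))
  ... | yes lt = above m lt
    where
    above : ∀ n → t < n → ∑ n (λ r → g (F₀ (suc t) r)) ≡ ∑ n (λ r → g (F₀ t r)) + g (at τ t)
    above (suc n) lt = cases (t ≟ n)
      where
      ar : ∀ a b c → a + b + c ≡ a + c + b
      ar = solve-∀
      cases : Dec (t ≡ n) → ∑ (suc n) (λ r → g (F₀ (suc t) r)) ≡ ∑ (suc n) (λ r → g (F₀ t r)) + g (at τ t)
      cases (yes refl) = cong₂ _+_ (trans (unchanged g n ≤-refl) (sym (trans (cong (∑ n (λ r → g (F₀ t r)) +_)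
        (trans (cong g (F-out {t} {t} ≤-refl)) g0)) (+-identityʳ _)))) (cong g (F-in {suc t} {t} ≤-refl))
      cases (no ne) = trans (cong₂ _+_ (above n (≤∧≢⇒< (≤-pred lt) ne)) (cong g (trans (F-out (≤∧≢⇒< (≤-pred lt) ne)) (sym (F-out (<⇒≤ (≤∧≢⇒< (≤-pred lt) ne)))))))
        (ar _ (g (at τ t)) (g (F₀ t n)))

  canonical : PairTab m F₀ Z
  canonical = record
    { tabˡ = record { start = λ r → F-out {0} {r} z≤n ; end = end ; mono = mono ; strip = strip }
    ; tabʳ = record { start = λ _ → refl ; end = λ _ r _ → sym (at-zeros m r) ; mono = λ _ _ → z≤n ; strip = λ _ _ → z≤n } }
    where
    end : ∀ t r → m ≤ t → F₀ t r ≡ at τ r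
    end t r le with r <? t
    ... | yes _ = refl
    ... | no n  = sym (at-beyond τ (≤-trans (≤-reflexive lτ) (≤-trans le (≮⇒≥ n))))
    mono : ∀ t r → F₀ t r ≤ F₀ (suc t) r
    mono t r with r <? t
    ... | yes lt = ≤-reflexive (sym (F-in (m<n⇒m<1+n lt)))
    ... | no _   = z≤n
    strip : ∀ t r → F₀ (suc t) (suc r) ≤ F₀ t r
    strip t r with r <? t
    ... | yes lt = ≤-trans (≤-reflexive (F-in (s≤s lt))) (pτ r)
    ... | no nlt = ≤-reflexive (F-out (s≤s (≮⇒≥ nlt)))

  canonical-yam : Yam F₀ Z
  canonical-yam = record { concave = conc ; noˡ = λ k c r q _ b → case-0 (Bad.U-end b) ; noʳ = λ k c r q _ b → n≮0 (Bad.T-in b) }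
    where
    case-0 : ∀ {c} → 0 ≡ suc c → ⊥
    case-0 ()
    conc : ∀ k c → Concave (s F₀ Z c) k
    conc k c rewrite cut (_∸ c) (0∸n≡0 c) (suc k) | cut (_∸ c) (0∸n≡0 c) k =
      ≤-trans (≤-reflexive (ar₁ (S m (F₀ k) c) (at τ k ∸ c) (at τ (suc k) ∸ c) z))
        (≤-trans (+-monoʳ-≤ (S m (F₀ k) c + S m (F₀ k) c + z + z + (at τ k ∸ c)) (∸-monoˡ-≤ c (pτ k)))
          (≤-reflexive (ar₂ (S m (F₀ k) c) (at τ k ∸ c) z)))
      where
      z = S m (Z k) c
      ar₁ : ∀ a x y z → a + z + (a + x + y + z) ≡ a + a + z + z + x + y
      ar₁ = solve-∀
      ar₂ : ∀ a x z → a + a + z + z + x + x ≡ a + x + z + (a + x + z)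
      ar₂ = solve-∀

  module _ {F G : Fun} (P : PairTab m F G) (y : Yam F G) where
    open PairTab P

    yam-right : ∀ t r → G t r ≡ 0
    yam-right t r = n≤0⇒n≡0 (≤-trans (Tab.bounded tabʳ t r) (≤-reflexive (at-zeros m r)))

    private
      low : ∀ t r → t ≤ r → F t r ≡ 0
      low zero    r       _        = Tab.start tabˡ r
      low (suc t) (suc r) (s≤s le) = n≤0⇒n≡0 (≤-trans (Tab.strip tabˡ t r) (≤-reflexive (low t r le)))

      S≡s : ∀ c t → s F G c t ≡ S m (F t) c
      S≡s c t = trans (cong (S m (F t) c +_) (∑-zero m (λ r → trans (cong (_∸ c) (yam-right t r)) (0∸n≡0 c)))) (+-identityʳ _)

      S-descends : ∀ c t → S m (F (suc t)) c ≤ S m (F t) c → ∀ j → S m (F (suc (j + t))) c ≤ S m (F (j + t)) c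
      S-descends c t le zero    = le
      S-descends c t le (suc j) = +-cancelˡ-≤ (S m (F (j + t)) c) _ _ (≤-trans
        (subst₂ _≤_ (cong₂ _+_ (S≡s c (j + t)) (S≡s c (2 + (j + t)))) (cong₂ _+_ (S≡s c (suc (j + t))) (S≡s c (suc (j + t)))) (Yam.concave y (j + t) c))
        (+-monoˡ-≤ _ (S-descends c t le j)))

      S-final : ∀ c t → S m (F (suc t)) c ≤ S m (F t) c → ∀ j → S m (F (j + t)) c ≤ S m (F t) c
      S-final c t le zero    = ≤-refl
      S-final c t le (suc j) = ≤-trans (S-descends c t le j) (S-final c t le j)

      high : ∀ t r → r < t → F t r ≡ at τ r
      high (suc t) r lt = cases (r ≟ t)
        where
        cases : Dec (r ≡ t) → F (suc t) r ≡ at τ r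
        cases (no ne) = ≤-antisym (Tab.bounded tabˡ (suc t) r) (≤-trans (≤-reflexive (sym (high t r (≤∧≢⇒< (≤-pred lt) ne)))) (Tab.mono tabˡ t r))
        cases (yes refl) = ≤-antisym (Tab.bounded tabˡ (suc r) r) (≮⇒≥ contra)
          where
          x = F (suc r) r
          -- If row `r` were still short at time `r + 1`, of length `x`, this step would have added
          -- nothing in the columns from `x` on. By concavity nothing would be added there later
          -- either, although row `r` must still grow beyond `x`.
          contra : ¬ (x < at τ r)
          contra x< = <-irrefl refl (≤-trans bigger (S-final x r same m))
            where
            r<m : r < m
            r<m = ≰⇒> λ le → n≮0 (subst (x <_) (at-beyond τ (≤-trans (≤-reflexive lτ) le)) x<)
            same : S m (F (suc r)) x ≤ S m (F r) x
            same = ∑-mono m pointwise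
              where
              pointwise : ∀ q → F (suc r) q ∸ x ≤ F r q ∸ x
              pointwise q = by (<-cmp q r)
                where
                by : Tri (q < r) (q ≡ r) (r < q) → F (suc r) q ∸ x ≤ F r q ∸ x
                by (tri< q< _ _) = ∸-monoˡ-≤ x (≤-trans (Tab.bounded tabˡ (suc r) q) (≤-reflexive (sym (high r q q<))))
                by (tri≈ _ refl _) = ≤-trans (≤-reflexive (n∸n≡0 x)) z≤n
                by (tri> _ _ q>) = ≤-trans (≤-reflexive (trans (cong (_∸ x) (low (suc r) q q>)) (0∸n≡0 x))) z≤n
            bigger : S m (F r) x < S m (F (m + r)) x
            bigger = ∑-strict m (λ q → ∸-monoˡ-≤ x (≤-trans (Tab.bounded tabˡ r q) (≤-reflexive (sym (Tab.end tabˡ (m + r) q (m≤m+n m r)))))) r<m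
              (≤-trans (≤-reflexive (cong (λ v → suc (v ∸ x)) (low r r ≤-refl)))
                (≤-trans (≤-reflexive (cong suc (0∸n≡0 x))) (≤-trans (m<n⇒0<n∸m x<) (≤-reflexive (cong (_∸ x) (sym (Tab.end tabˡ (m + r) r (m≤m+n m r))))))))

    yam-left : ∀ t r → F t r ≡ F₀ t r
    yam-left t r = cases (r <? t)
      where
      cases : Dec (r < t) → F t r ≡ F₀ t r
      cases (yes lt) = trans (high t r lt) (sym (F-in lt))
      cases (no nlt) = trans (low t r (≮⇒≥ nlt)) (sym (F-out (≮⇒≥ nlt)))

  private
    eF : fˡ (obj m F₀ Z) ≗₂ F₀
    eF = obj-fˡ canonical
    eZ : fʳ (obj m F₀ Z) ≗₂ Z
    eZ = obj-fʳ canonical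

  weight-canonical : wt m F₀ Z ≡ τ
  weight-canonical = at-ext _ _ (trans (length-wt m F₀ Z) (sym lτ)) (λ t → trans (PairTab.at-wt canonical t) (diff t))
    where
    diff : ∀ t → size F₀ Z (suc t) ∸ size F₀ Z t ≡ at τ t
    diff t = trans (cong (_∸ size F₀ Z t) (trans (cong (_+ ∑ m (Z (suc t))) (cut id refl t)) (ar (∑ m (F₀ t)) (at τ t) (∑ m (Z t))))) (m+n∸n≡m (at τ t) (size F₀ Z t))
      where
      ar : ∀ a b c → a + b + c ≡ b + (a + c)
      ar = solve-∀

  yams-canonical : ∀ n → total ≤ n → yams m n ≡ [ obj m F₀ Z ]
  yams-canonical n le = singleton (unique-yams m n)
    (λ {p} i → trans (sym (proj₂ (objs⁻ m n {p} (yams-objs m n {p} i))))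
      (obj-cong m (yam-left (yams-tab m n {p} i) (yams-yam m n {p} i)) (yam-right (yams-tab m n {p} i) (yams-yam m n {p} i))))
    (yams⁺ m n {obj m F₀ Z} (objs⁺ m n le canonical) (yam-cong m (λ t r → sym (eF t r)) (λ t r → sym (eZ t r)) canonical-yam))

  -- Only the superstandard tableau survives the cancellation, and its weight is `τ`. Pairing with
  -- an alternating `ε` therefore turns a Schur expansion into the sum of the values of `ε` at its
  -- index partitions.
  schur-pairing : ∀ n → sum τ ≤ n → ∀ ε → Alternating ε → Σℤ (λ β → ℤ.+ schur τ β ⊛ ε β) (box m n) ≡ ε τ
  schur-pairing n le ε alt = begin
    Σℤ (λ β → ℤ.+ schur τ β ⊛ ε β) (box m n) ≡⟨ Σℤ-cong (box m n) (λ {β} _ → cong (λ v → ℤ.+ v ⊛ ε β) (sym (N≡schur β))) ⟩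
    Σℤ (λ β → ℤ.+ N β ⊛ ε β) (box m n)       ≡⟨ yams-pairing m n le′ ε alt ⟩
    Σℤ (ε ∘ weight m n) (yams m n)           ≡⟨ cong (Σℤ (ε ∘ weight m n)) (yams-canonical n le′) ⟩
    ε (weight m n (obj m F₀ Z)) ⊕ 0ℤ         ≡⟨ ℤ.+-identityʳ _ ⟩
    ε (weight m n (obj m F₀ Z))              ≡⟨ cong ε (trans (wt-cong m eF eZ) weight-canonical) ⟩
    ε τ ∎
    where
    open ≡-Reasoning
    le′ : total ≤ n
    le′ = ≤-trans (≤-reflexive total≡) le

  schur-symmetric : Symmetric m (schur τ)
  schur-symmetric p x y z l = trans (sym (N≡schur (p ++ x ∷ y ∷ z))) (trans (N-symmetric m p x y z l) (N≡schur (p ++ y ∷ x ∷ z)))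

  schur-bounded : ∀ {n} → sum τ ≤ n → ∀ β → ¬ All (_≤ n) β → schur τ β ≡ 0
  schur-bounded le β na = trans (sym (N≡schur β)) (N-bounded (≤-trans (≤-reflexive total≡) le) β na)

-- Homogeneity and the Littlewood-Richardson expansion

+sum-map : ∀ {A : Set} (f : A → ℕ) xs → ℤ.+ sum (map f xs) ≡ Σℤ (λ x → ℤ.+ f x) xs
+sum-map f []       = refl
+sum-map f (x ∷ xs) = trans (ℤ.pos-+ (f x) (sum (map f xs))) (cong (ℤ.+ f x ⊕_) (+sum-map f xs))

sum-zero : ∀ {A : Set} (f : A → ℕ) xs → (∀ {x} → x ∈ xs → f x ≡ 0) → sum (map f xs) ≡ 0
sum-zero f []       e = refl
sum-zero f (x ∷ xs) e rewrite e (here refl) = sum-zero f xs (e ∘ there)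

module Degree (R : ℕ) (λ′ μ ν ρ : List ℕ) (pλ : IsPartition λ′) (pν : IsPartition ν)
  (lλ : length λ′ ≡ R) (lν : length ν ≡ R) (lμ : length μ ≤ R) (lρ : length ρ ≤ R) where
  open Expansion R λ′ μ ν ρ pλ pν lλ lν lμ lρ
  open Pair R

  base : ℕ
  base = ∑ R (at μ) + ∑ R (at ρ)

  wt-degree : ∀ {m F G} → PairTab m F G → sum (wt m F G) + base ≡ total
  wt-degree {m} {F} {G} P = trans (cong₂ _+_ (trans (sum≡∑ m (wt m F G) (≤-reflexive (length-wt m F G))) (∑-cong m at-wt))
      (cong₂ _+_ (∑-cong R (sym ∘ Tab.start tabˡ)) (∑-cong R (sym ∘ Tab.start tabʳ))))
    (trans (∑-telescope m (size F G) size-mono)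
      (cong₂ _+_ (∑-cong R (λ r → Tab.end tabˡ m r ≤-refl)) (∑-cong R (λ r → Tab.end tabʳ m r ≤-refl))))
    where open PairTab P

  N-degree : ∀ α → sum α + base ≢ total → N α ≡ 0
  N-degree α ne = go (pairs λ′ μ ν ρ α) refl
    where
    go : ∀ ps → pairs λ′ μ ν ρ α ≡ ps → N α ≡ 0
    go []      e = cong length e
    go (p ∷ _) e = ⊥-elim (ne (subst (λ z → sum z + base ≡ total) (proj₁ (proj₂ dat)) (wt-degree (proj₁ dat))))
      where
      dat = pairs⁻ α {p} (subst (p ∈_) (sym e) (here refl))

schur-degree : ∀ τ → IsPartition τ → ∀ α → sum α ≢ sum τ → schur τ α ≡ 0
schur-degree τ pτ α ne = trans (sym (C.N≡schur α)) (D.N-degree α (λ e → ne (trans (sym (+-identityʳ _))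
    (trans (cong (sum α +_) (sym base≡0)) (trans e C.total≡)))))
  where
  module C = Canonical (length τ) τ pτ refl
  pz : IsPartition (replicate (length τ) 0)
  pz j rewrite at-zeros (length τ) (suc j) = z≤n
  module D = Degree (length τ) τ [] (replicate (length τ) 0) [] pτ pz refl (length-replicate (length τ)) z≤n z≤n
  base≡0 : D.base ≡ 0
  base≡0 = cong₂ _+_ (∑-zero (length τ) (λ _ → refl)) (∑-zero (length τ) (λ _ → refl))

module LittlewoodRichardson (R : ℕ) (λ′ μ ν ρ : List ℕ) (pλ : IsPartition λ′) (pν : IsPartition ν)
  (lλ : length λ′ ≡ R) (lν : length ν ≡ R) (lμ : length μ ≤ R) (lρ : length ρ ≤ R)
  (pμ : IsPartition μ) (pρ : IsPartition ρ) (sub : μ ⊆ₚ λ′) (sub′ : ρ ⊆ₚ ν) where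

  open Expansion R λ′ μ ν ρ pλ pν lλ lν lμ lρ public
  open Degree R λ′ μ ν ρ pλ pν lλ lν lμ lρ public

  module _ (n : ℕ) (le : total ≤ n) where
    private
      ys = yams n n
      w = weight n n

      len-w : ∀ p → length (w p) ≡ n
      len-w p = length-wt n (fˡ p) (fʳ p)

      deg-w : ∀ {p} → p ∈ ys → sum (w p) + base ≡ total
      deg-w {p} i = wt-degree (yams-tab n n {p} i)

      sum-w : ∀ {p} → p ∈ ys → sum (w p) ≤ n
      sum-w {p} i = ≤-trans (≤-trans (m≤m+n (sum (w p)) base) (≤-reflexive (deg-w i))) le

      module C (p : Obj) (i : p ∈ ys) = Canonical n (w p) (weight-partition n n {p} i) (len-w p)

      K : List ℕ → ℤ
      K β = Σℤ (λ p → ℤ.+ schur (w p) β) ys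

      g : List ℕ → ℤ
      g β = ℤ.+ N β ⊕ ⊖ K β

      pair-K : ∀ ε → Alternating ε → Σℤ (λ β → K β ⊛ ε β) (box n n) ≡ Σℤ (ε ∘ w) ys
      pair-K ε alt = begin
        Σℤ (λ β → K β ⊛ ε β) (box n n)
          ≡⟨ Σℤ-cong (box n n) (λ {β} _ → trans (ℤ.*-comm (K β) (ε β)) (trans (sym (Σℤ-*ˡ (ε β) (λ p → ℤ.+ schur (w p) β) ys))
               (Σℤ-cong ys (λ {p} _ → ℤ.*-comm (ε β) (ℤ.+ schur (w p) β))))) ⟩
        Σℤ (λ β → Σℤ (λ p → ℤ.+ schur (w p) β ⊛ ε β) ys) (box n n)
          ≡⟨ Σℤ-comm (λ β p → ℤ.+ schur (w p) β ⊛ ε β) (box n n) ys ⟩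
        Σℤ (λ p → Σℤ (λ β → ℤ.+ schur (w p) β ⊛ ε β) (box n n)) ys
          ≡⟨ Σℤ-cong ys (λ {p} i → C.schur-pairing p i n (sum-w i) ε alt) ⟩
        Σℤ (ε ∘ w) ys ∎
        where open ≡-Reasoning

      pair-g : ∀ ε → Alternating ε → Σℤ (λ β → g β ⊛ ε β) (box n n) ≡ 0ℤ
      pair-g ε alt = begin
        Σℤ (λ β → g β ⊛ ε β) (box n n)
          ≡⟨ Σℤ-cong (box n n) (λ {β} _ → dist (ℤ.+ N β) (K β) (ε β)) ⟩
        Σℤ (λ β → ℤ.+ N β ⊛ ε β ⊕ ⊖ (K β ⊛ ε β)) (box n n)
          ≡⟨ Σℤ-+ (λ β → ℤ.+ N β ⊛ ε β) (λ β → ⊖ (K β ⊛ ε β)) (box n n) ⟩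
        Σℤ (λ β → ℤ.+ N β ⊛ ε β) (box n n) ⊕ Σℤ (λ β → ⊖ (K β ⊛ ε β)) (box n n)
          ≡⟨ cong₂ _⊕_ (yams-pairing n n le ε alt) (trans (Σℤ-neg (λ β → K β ⊛ ε β) (box n n)) (cong ⊖_ (pair-K ε alt))) ⟩
        Σℤ (ε ∘ w) ys ⊕ ⊖ Σℤ (ε ∘ w) ys
          ≡⟨ ℤ.+-inverseʳ (Σℤ (ε ∘ w) ys) ⟩
        0ℤ ∎
        where
        open ≡-Reasoning
        dist : ∀ a b c → (a ⊕ ⊖ b) ⊛ c ≡ a ⊛ c ⊕ ⊖ (b ⊛ c)
        dist = ℤSolver.solve-∀

      sym-g : Symmetric n g
      sym-g p x y z l = cong₂ (λ a b → ℤ.+ a ⊕ ⊖ b) (N-symmetric n p x y z l)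
        (Σℤ-cong ys (λ {q} i → cong ℤ.+_ (C.schur-symmetric q i p x y z l)))

      bounded-g : ∀ β → length β ≡ n → ¬ All (_≤ n) β → g β ≡ 0ℤ
      bounded-g β _ na = cong₂ (λ a b → ℤ.+ a ⊕ ⊖ b) (N-bounded le β na)
        (Σℤ-0 ys (λ {q} i → cong ℤ.+_ (C.schur-bounded q i (sum-w i) β na)))

      at-length-n : ∀ α → length α ≡ n → N α ≡ sum (map (λ p → schur (w p) α) ys)
      at-length-n α l = ℤ.+-injective (trans (cancel (ℤ.+ N α) (K α) (alternating-vanish n n g sym-g bounded-g pair-g α l))
          (sym (+sum-map (λ p → schur (w p) α) ys)))
        where
        cancel : ∀ a b → a ⊕ ⊖ b ≡ 0ℤ → a ≡ b
        cancel a b e = trans (sym (ar a b)) (trans (cong (_⊕ b) e) (ℤ.+-identityˡ b))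
          where
          ar : ∀ a b → (a ⊕ ⊖ b) ⊕ b ≡ a
          ar = ℤSolver.solve-∀

      N-zeroInv : ZeroInv N
      N-zeroInv p s = trans (length-pairs λ′ μ ν ρ (p ++ 0 ∷ s)) (trans
        (·-zeroInv {kostka λ′ μ} {kostka ν ρ} (kostka-zeroInv pλ {μ} pμ sub (≤-trans lμ (≤-reflexive (sym lλ))))
          (kostka-zeroInv pν {ρ} pρ sub′ (≤-trans lρ (≤-reflexive (sym lν)))) p s)
        (sym (length-pairs λ′ μ ν ρ (p ++ s))))

      schur-zeroInv : ∀ τ → IsPartition τ → ZeroInv (schur τ)
      schur-zeroInv τ pτ = kostka-zeroInv pτ {[]} (λ _ → z≤n) (λ _ → z≤n) z≤n

    -- If the degree of `α` is wrong, both sides are zero. Otherwise `α` has at most `n` nonzero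
    -- exponents; removing and adding zeros brings it to length `n`, where the difference of the two
    -- sides is symmetric, bounded and orthogonal to all alternating functions.
    expansion : ∀ α → N α ≡ sum (map (λ p → schur (weight n n p) α) (yams n n))
    expansion α = cases (sum α + base ≟ total)
      where
      cases : Dec (sum α + base ≡ total) → N α ≡ sum (map (λ p → schur (w p) α) ys)
      cases (no ne) = trans (N-degree α ne) (sym (sum-zero (λ p → schur (w p) α) ys
        (λ {p} i → schur-degree (w p) (weight-partition n n {p} i) α (λ e → ne (trans (cong (_+ base) e) (deg-w i))))))
      cases (yes e) = begin
        N α                                         ≡⟨ shift N N-zeroInv ⟩
        N α′                                        ≡⟨ at-length-n α′ l′ ⟩
        sum (map (λ p → schur (w p) α′) ys)         ≡⟨ sum-map-cong-∈ ys (λ {p} i → sym (shift (schur (w p)) (schur-zeroInv (w p) (weight-partition n n {p} i)))) ⟩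
        sum (map (λ p → schur (w p) α) ys)          ∎
        where
        open ≡-Reasoning
        j = n ∸ length (nonzeros α)
        α′ = nonzeros α ++ replicate j 0
        shift : ∀ f → ZeroInv f → f α ≡ f α′
        shift f zf = trans (nonzeros-inv f zf [] α) (sym (pad-inv f zf j (nonzeros α)))
        short : length (nonzeros α) ≤ n
        short = ≤-trans (length-nonzeros α) (≤-trans (≤-trans (m≤m+n (sum α) base) (≤-reflexive e)) le)
        l′ : length α′ ≡ n
        l′ = trans (length-++ (nonzeros α)) (trans (cong (length (nonzeros α) +_) (length-replicate j)) (m+[n∸m]≡n short))

-- Join and meet of two skew shapes

unit : {A : Set} → (A → List ℕ) → List A → List (List ℕ × ℕ)
unit w = map (λ p → w p , 1)

unit-comb : ∀ {A : Set} (w : A → List ℕ) ps α → schurComb (unit w ps) α ≡ sum (map (λ p → schur (w p) α) ps)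
unit-comb w []       α = refl
unit-comb w (p ∷ ps) α = cong₂ _+_ (+-identityʳ (schur (w p) α)) (unit-comb w ps α)

unit-partitions : ∀ {A : Set} (w : A → List ℕ) ps → (∀ {p} → p ∈ ps → IsPartition (w p)) → AllPartitions (unit w ps)
unit-partitions w []       h = tt
unit-partitions w (p ∷ ps) h = h (here refl) , unit-partitions w ps (h ∘ there)

_∨_ _∧_ : List ℕ → List ℕ → List ℕ
_∨_ = zipWith _⊔_
_∧_ = zipWith _⊓_

at-zipWith : ∀ (f : ℕ → ℕ → ℕ) → f 0 0 ≡ 0 → ∀ xs ys → length xs ≡ length ys → ∀ j → at (zipWith f xs ys) j ≡ f (at xs j) (at ys j)
at-zipWith f e []       []       _ j       = sym e
at-zipWith f e (x ∷ xs) (y ∷ ys) _ zero    = refl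
at-zipWith f e (x ∷ xs) (y ∷ ys) l (suc j) = at-zipWith f e xs ys (suc-injective l) j

length-zip : ∀ (f : ℕ → ℕ → ℕ) {R} xs ys → length xs ≡ R → length ys ≡ R → length (zipWith f xs ys) ≡ R
length-zip f []       []       refl _ = refl
length-zip f (x ∷ xs) (y ∷ ys) refl l = cong suc (length-zip f xs ys refl (suc-injective l))

module JoinMeet (R : ℕ) (λ′ μ ν ρ : List ℕ)
  (lλ : length λ′ ≡ R) (lμ : length μ ≡ R) (lν : length ν ≡ R) (lρ : length ρ ≡ R)
  (skˡ : IsSkewShape λ′ μ) (skʳ : IsSkewShape ν ρ) where

  private
    pλ = proj₁ skˡ
    pμ = proj₁ (proj₂ skˡ)
    sub = proj₂ (proj₂ skˡ)
    pν = proj₁ skʳ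
    pρ = proj₁ (proj₂ skʳ)
    sub′ = proj₂ (proj₂ skʳ)

    at∨ : ∀ xs ys → length xs ≡ R → length ys ≡ R → ∀ j → at (xs ∨ ys) j ≡ at xs j ⊔ at ys j
    at∨ xs ys l l′ = at-zipWith _⊔_ refl xs ys (trans l (sym l′))
    at∧ : ∀ xs ys → length xs ≡ R → length ys ≡ R → ∀ j → at (xs ∧ ys) j ≡ at xs j ⊓ at ys j
    at∧ xs ys l l′ = at-zipWith _⊓_ refl xs ys (trans l (sym l′))

    p∨ : ∀ xs ys → length xs ≡ R → length ys ≡ R → IsPartition xs → IsPartition ys → IsPartition (xs ∨ ys)
    p∨ xs ys l l′ p q j = subst₂ _≤_ (sym (at∨ xs ys l l′ (suc j))) (sym (at∨ xs ys l l′ j)) (⊔-mono-≤ (p j) (q j))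
    p∧ : ∀ xs ys → length xs ≡ R → length ys ≡ R → IsPartition xs → IsPartition ys → IsPartition (xs ∧ ys)
    p∧ xs ys l l′ p q j = subst₂ _≤_ (sym (at∧ xs ys l l′ (suc j))) (sym (at∧ xs ys l l′ j)) (⊓-mono-≤ (p j) (q j))

    s∨ : (μ ∨ ρ) ⊆ₚ (λ′ ∨ ν)
    s∨ j = subst₂ _≤_ (sym (at∨ μ ρ lμ lρ j)) (sym (at∨ λ′ ν lλ lν j)) (⊔-mono-≤ (sub j) (sub′ j))
    s∧ : (μ ∧ ρ) ⊆ₚ (λ′ ∧ ν)
    s∧ j = subst₂ _≤_ (sym (at∧ μ ρ lμ lρ j)) (sym (at∧ λ′ ν lλ lν j)) (⊓-mono-≤ (sub j) (sub′ j))

    module A = LittlewoodRichardson R λ′ μ ν ρ pλ pν lλ lν (≤-reflexive lμ) (≤-reflexive lρ) pμ pρ sub sub′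
    module B = LittlewoodRichardson R (λ′ ∨ ν) (μ ∨ ρ) (λ′ ∧ ν) (μ ∧ ρ) (p∨ λ′ ν lλ lν pλ pν) (p∧ λ′ ν lλ lν pλ pν)
      (length-zip _⊔_ λ′ ν lλ lν) (length-zip _⊓_ λ′ ν lλ lν)
      (≤-reflexive (length-zip _⊔_ μ ρ lμ lρ)) (≤-reflexive (length-zip _⊓_ μ ρ lμ lρ))
      (p∨ μ ρ lμ lρ pμ pρ) (p∧ μ ρ lμ lρ pμ pρ) s∨ s∧

    -- A common bound for both sides, used at once as the number of variables, the largest exponent
    -- and the last time of the chains.
    n = A.total + B.total
    A≤ : A.total ≤ n
    A≤ = m≤m+n A.total B.total
    B≤ : B.total ≤ n
    B≤ = m≤n+m B.total A.total

    open Flip R n (at λ′) (at μ) (at ν) (at ρ)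

    W : A.Obj → ℕ → ℕ → Bool
    W p = Graph.Wset (A.fˡ p) (A.fʳ p)

    F′ G′ : A.Obj → Fun
    F′ p = swapˡ (W p) (A.fˡ p) (A.fʳ p)
    G′ p = swapʳ (W p) (A.fˡ p) (A.fʳ p)

    φ : A.Obj → B.Obj
    φ p = B.obj n (F′ p) (G′ p)

    module One {p : A.Obj} (i : p ∈ A.yams n n) where
      P : A.PairTab n (A.fˡ p) (A.fʳ p)
      P = A.yams-tab n n {p} i
      open A.PairTab P
      sT = Tab.start tabˡ
      sU = Tab.start tabʳ
      eT = Tab.end tabˡ
      eU = Tab.end tabʳ
      wn = W-neg chˡ chʳ sT sU eT eU
      wv = W-vert chˡ chʳ sT sU eT eU
      wd = W-diag chˡ chʳ sT sU eT eU
      module Sw = Swap R (W p) chˡ chʳ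

      chF : Chain R (F′ p)
      chF = Sw.swap-chainˡ wn wv wd
      chG : Chain R (G′ p)
      chG = Sw.swap-chainʳ wn wv wd

      Q : B.PairTab n (F′ p) (G′ p)
      Q = record
        { tabˡ = record { start = λ r → trans (flip-startˡ chˡ chʳ sT sU eT eU r) (sym (at∨ μ ρ lμ lρ r))
                        ; end = λ t r le → trans (flip-endˡ chˡ chʳ sT sU eT eU t r le) (sym (at∨ λ′ ν lλ lν r))
                        ; mono = Chain.mono chF ; strip = Chain.strip chF }
        ; tabʳ = record { start = λ r → trans (flip-startʳ chˡ chʳ sT sU eT eU r) (sym (at∧ μ ρ lμ lρ r))
                        ; end = λ t r le → trans (flip-endʳ chˡ chʳ sT sU eT eU t r le) (sym (at∧ λ′ ν lλ lν r))
                        ; mono = Chain.mono chG ; strip = Chain.strip chG } }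

      eF : B.fˡ (φ p) ≗₂ F′ p
      eF = B.obj-fˡ Q
      eG : B.fʳ (φ p) ≗₂ G′ p
      eG = B.obj-fʳ Q

      φ∈ : φ p ∈ B.yams n n
      φ∈ = B.yams⁺ n n {φ p} (B.objs⁺ n n B≤ Q)
        (yam-cong R (λ t r → sym (eF t r)) (λ t r → sym (eG t r)) (Sw.swap-yam wn wv wd (A.yams-yam n n {p} i)))

      φ-weight : B.weight n n (φ p) ≡ A.weight n n p
      φ-weight = trans (B.wt-cong n eF eG) (row-cong n (λ t → cong₂ _∸_ (Sw.swap-∑ id (suc t)) (Sw.swap-∑ id t)))

    φ-inj : ∀ {p q} → p ∈ A.yams n n → q ∈ A.yams n n → φ p ≡ φ q → p ≡ q
    φ-inj {p} {q} i j e = trans (sym (proj₂ (A.objs⁻ n n {p} (A.yams-objs n n {p} i))))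
      (trans (A.obj-cong n (λ t r → proj₁ (same t r)) (λ t r → proj₂ (same t r))) (proj₂ (A.objs⁻ n n {q} (A.yams-objs n n {q} j))))
      where
      module I = One {p} i
      module J = One {q} j
      same : ∀ t r → A.fˡ p t r ≡ A.fˡ q t r × A.fʳ p t r ≡ A.fʳ q t r
      same = flip-injective {A.fˡ p} {A.fʳ p} {A.fˡ q} {A.fʳ q}
        (λ t r → trans (sym (I.eF t r)) (trans (cong (λ z → B.fˡ z t r) e) (J.eF t r)))
        (λ t r → trans (sym (I.eG t r)) (trans (cong (λ z → B.fʳ z t r) e) (J.eG t r)))

    _≟O_ : ∀ (x y : B.Obj) → Dec (x ≡ y)
    _≟O_ = ≡-dec (List-≡-dec (List-≡-dec _≟_)) (List-≡-dec (List-≡-dec _≟_))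

    -- Since `φ` preserves weights, the lattice pairs outside its image index the Schur functions of
    -- the difference, each with coefficient 1.
    matched : ∃ λ rest → (∀ {y} → y ∈ rest → y ∈ B.yams n n) × B.yams n n ↭ map φ (A.yams n n) ++ rest
    matched = injection⇒↭ _≟O_ φ (A.unique-yams n n) (B.unique-yams n n) (λ {p} i → One.φ∈ {p} i) (λ {p} {q} → φ-inj {p} {q})

  join-meet : SchurNonnegDiff (skewSchur (λ′ ∨ ν) (μ ∨ ρ) · skewSchur (λ′ ∧ ν) (μ ∧ ρ)) (skewSchur λ′ μ · skewSchur ν ρ)
  join-meet = unit (B.weight n n) rest
    , unit-partitions (B.weight n n) rest (λ {p} i → B.weight-partition n n {p} (proj₁ (proj₂ matched) i))
    , λ α → begin
        (skewSchur (λ′ ∨ ν) (μ ∨ ρ) · skewSchur (λ′ ∧ ν) (μ ∧ ρ)) α  ≡⟨ sym (length-pairs (λ′ ∨ ν) (μ ∨ ρ) (λ′ ∧ ν) (μ ∧ ρ) α) ⟩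
        B.N α                                                        ≡⟨ B.expansion n B≤ α ⟩
        sum (map (KB α) (B.yams n n))                                ≡⟨ sum-↭ (↭.map⁺ (KB α) (proj₂ (proj₂ matched))) ⟩
        sum (map (KB α) (map φ (A.yams n n) ++ rest))                ≡⟨ cong sum (map-++ (KB α) (map φ (A.yams n n)) rest) ⟩
        sum (map (KB α) (map φ (A.yams n n)) ++ map (KB α) rest)     ≡⟨ sum-++ (map (KB α) (map φ (A.yams n n))) _ ⟩
        sum (map (KB α) (map φ (A.yams n n))) + sum (map (KB α) rest)
          ≡⟨ cong₂ _+_ (trans (cong sum (sym (map-∘ (A.yams n n)))) (sum-map-cong-∈ (A.yams n n) (λ {p} i → cong (λ z → schur z α) (One.φ-weight {p} i))))
                       (sym (unit-comb (B.weight n n) rest α)) ⟩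
        sum (map (λ p → schur (A.weight n n p) α) (A.yams n n)) + schurComb (unit (B.weight n n) rest) α
          ≡⟨ cong (_+ schurComb (unit (B.weight n n) rest) α) (trans (sym (A.expansion n A≤ α)) (length-pairs λ′ μ ν ρ α)) ⟩
        (skewSchur λ′ μ · skewSchur ν ρ) α + schurComb (unit (B.weight n n) rest) α ∎
    where
    open ≡-Reasoning
    rest = proj₁ matched
    KB : List ℕ → B.Obj → ℕ
    KB α p = schur (B.weight n n p) α

-- Padding and products preserving Schur nonnegativity

sum-≈ : ∀ {xs ys} → xs ≈ₚ ys → sum xs ≡ sum ys
sum-≈ {xs} {ys} e = trans (sum≡∑ (length xs) xs ≤-refl)
  (trans (∑-support (length xs) (length ys) (λ _ → at-beyond xs) (λ r le → trans (e r) (at-beyond ys le)))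
  (trans (∑-cong (length ys) e) (sym (sum≡∑ (length ys) ys ≤-refl))))

stripsGen-cong : ∀ {μ μ′} → μ ≈ₚ μ′ → ∀ ls j cap → stripsGen μ ls j cap ≡ stripsGen μ′ ls j cap
stripsGen-cong e []       j cap = refl
stripsGen-cong {μ} {μ′} e (l ∷ ls) j cap rewrite e j | stripsGen-cong {μ} {μ′} e ls (suc j) (at μ′ j) = refl

kostka-congʳ : ∀ λ′ {μ μ′} → μ ≈ₚ μ′ → ∀ α → kostka λ′ μ α ≡ kostka λ′ μ′ α
kostka-congʳ λ′ {μ} {μ′} e [] = cong (λ b → if b then 1 else 0) (bool (padEqᵇ λ′ μ) (padEqᵇ λ′ μ′) refl refl)
  where
  bool : ∀ b b′ → padEqᵇ λ′ μ ≡ b → padEqᵇ λ′ μ′ ≡ b′ → b ≡ b′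
  bool true  true  _ _ = refl
  bool false false _ _ = refl
  bool true  false p q = trans (sym (padEq⁺ λ′ μ′ (λ j → trans (padEq⁻ λ′ μ p j) (e j)))) q
  bool false true  p q = trans (sym p) (padEq⁺ λ′ μ (λ j → trans (padEq⁻ λ′ μ′ q j) (sym (e j))))
kostka-congʳ λ′ {μ} {μ′} e (a ∷ α) = cong (λ xs → sum (map (λ κ → kostka λ′ κ α) xs))
  (trans (cong (filter (λ κ → sum κ ≟ a + sum μ)) (stripsGen-cong {μ} {μ′} e λ′ 0 (at λ′ 0)))
         (cong (λ s → filter (λ κ → sum κ ≟ a + s) (stripsGen μ′ λ′ 0 (at λ′ 0))) (sum-≈ {μ} {μ′} e)))

skewSchur-≈ : ∀ {λ′ μ λ″ μ″} → IsSkewShape λ′ μ → λ′ ≈ₚ λ″ → μ ≈ₚ μ″ → skewSchur λ′ μ ≗ₚ skewSchur λ″ μ″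
skewSchur-≈ {λ′} {μ} {λ″} {μ″} (pλ , pμ , sub) eλ eμ α = trans (kostka-congʳ λ′ {μ} {cut λ′} (λ j → sym (at-cut λ′ (λ _ → refl) j)) α)
  (trans (kostka-cong {λ′} {cut λ′} {λ″} {cut λ″} pλ (≤-reflexive (length-applyUpTo (at μ) (length λ′))) (≤-reflexive (length-applyUpTo (at μ) (length λ″)))
      eλ (λ j → trans (at-cut λ′ (λ _ → refl) j) (sym (at-cut λ″ eλ j))) α)
    (kostka-congʳ λ″ {cut λ″} {μ″} (λ j → trans (at-cut λ″ eλ j) (eμ j)) α))
  where
  -- `μ` may carry trailing zeros beyond the length of the outer list, whereas `kostka-cong` asks
  -- for inner lists that are no longer than the outer ones.
  cut : List ℕ → List ℕ
  cut xs = row (length xs) (at μ)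
  at-cut : ∀ xs → λ′ ≈ₚ xs → ∀ j → at (cut xs) j ≡ at μ j
  at-cut xs e = at-row-null (length xs) (at μ) (λ j le → n≤0⇒n≡0 (≤-trans (sub j) (≤-reflexive (trans (e j) (at-beyond xs le)))))

at-pad : ∀ {R xs} → length xs ≤ R → ∀ j → at (row R (at xs)) j ≡ at xs j
at-pad {R} {xs} le = at-row-null R (at xs) (λ j R≤j → at-beyond xs (≤-trans le R≤j))

skew-≈ : ∀ {λ′ μ λ″ μ″} → λ′ ≈ₚ λ″ → μ ≈ₚ μ″ → IsSkewShape λ′ μ → IsSkewShape λ″ μ″
skew-≈ {λ′} {μ} {λ″} {μ″} e e′ (p , q , s) = partition-≈ {λ′} {λ″} e p , partition-≈ {μ} {μ″} e′ q , λ j → subst₂ _≤_ (e′ j) (e j) (s j)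

-- The expansion by lattice pairs with `τ` over the empty partition as first factor, after padding
-- all lists to the common length `R`.
schur-times-skew : ∀ τ λ′ μ → IsPartition τ → IsSkewShape λ′ μ →
  ∃ λ cs → AllPartitions cs × (∀ α → (schur τ · skewSchur λ′ μ) α ≡ schurComb cs α)
schur-times-skew τ λ′ μ pτ sk = unit (L.weight n n) (L.yams n n) , unit-partitions (L.weight n n) (L.yams n n) (λ {p} → L.weight-partition n n {p}) ,
    λ α → trans (·-cong {schur τ} {schur τ₁} (skewSchur-≈ {τ} {[]} {τ₁} {[]} (pτ , (λ _ → z≤n) , λ _ → z≤n) (λ j → sym (eτ j)) (λ _ → refl))
                        (skewSchur-≈ sk (λ j → sym (eλ j)) (λ j → sym (eμ j))) α)
      (trans (sym (length-pairs τ₁ [] λ₁ μ₁ α)) (trans (L.expansion n ≤-refl α) (sym (unit-comb (L.weight n n) (L.yams n n) α))))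
  where
  R = length τ + (length λ′ + length μ)
  τ₁ = row R (at τ)
  λ₁ = row R (at λ′)
  μ₁ = row R (at μ)
  eτ : τ₁ ≈ₚ τ
  eτ = at-pad {R} {τ} (m≤m+n _ _)
  eλ : λ₁ ≈ₚ λ′
  eλ = at-pad {R} {λ′} (≤-trans (m≤m+n _ _) (m≤n+m _ (length τ)))
  eμ : μ₁ ≈ₚ μ
  eμ = at-pad {R} {μ} (≤-trans (m≤n+m _ (length λ′)) (m≤n+m _ (length τ)))
  sk₁ : IsSkewShape λ₁ μ₁
  sk₁ = skew-≈ {λ′} {μ} {λ₁} {μ₁} (λ j → sym (eλ j)) (λ j → sym (eμ j)) sk
  module L = LittlewoodRichardson R τ₁ [] λ₁ μ₁ (partition-≈ {τ} {τ₁} (λ j → sym (eτ j)) pτ) (proj₁ sk₁)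
    (length-applyUpTo (at τ) R) (length-applyUpTo (at λ′) R) z≤n (≤-reflexive (length-applyUpTo (at μ) R))
    (λ _ → z≤n) (proj₁ (proj₂ sk₁)) (λ _ → z≤n) (proj₂ (proj₂ sk₁))
  n = L.total

allPartitions-++ : ∀ cs ds → AllPartitions cs → AllPartitions ds → AllPartitions (cs ++ ds)
allPartitions-++ []       ds _       q = q
allPartitions-++ (_ ∷ cs) ds (p , ps) q = p , allPartitions-++ cs ds ps q

schurComb-++ : ∀ cs ds α → schurComb (cs ++ ds) α ≡ schurComb cs α + schurComb ds α
schurComb-++ []             ds α = refl
schurComb-++ ((ν , c) ∷ cs) ds α = trans (cong (c * schur ν α +_) (schurComb-++ cs ds α)) (sym (+-assoc (c * schur ν α) _ _))

scale : ℕ → List (List ℕ × ℕ) → List (List ℕ × ℕ)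
scale k = map (λ (ν , c) → ν , k * c)

allPartitions-scale : ∀ k cs → AllPartitions cs → AllPartitions (scale k cs)
allPartitions-scale k []       _       = tt
allPartitions-scale k (_ ∷ cs) (p , ps) = p , allPartitions-scale k cs ps

schurComb-scale : ∀ k cs α → schurComb (scale k cs) α ≡ k * schurComb cs α
schurComb-scale k []             α = sym (*-zeroʳ k)
schurComb-scale k ((ν , c) ∷ cs) α = trans (cong₂ _+_ (*-assoc k c (schur ν α)) (schurComb-scale k cs α)) (sym (*-distribˡ-+ k (c * schur ν α) _))

-- When two factors of a product are exchanged, the resulting difference is multiplied by all the
-- other factors. This property of a factor keeps it Schur nonnegative and is closed under products.
Preserving : Poly → Set
Preserving h = ∀ cs → AllPartitions cs → ∃ λ ds → AllPartitions ds × (schurComb cs · h) ≗ₚ schurComb ds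

preserving-skew : ∀ {λ′ μ} → IsSkewShape λ′ μ → Preserving (skewSchur λ′ μ)
preserving-skew {λ′} {μ} sk [] _ = [] , tt , ·-zeroˡ (skewSchur λ′ μ)
preserving-skew {λ′} {μ} sk ((ν , c) ∷ cs) (p , ps) = scale c ds₁ ++ ds₂ , allPartitions-++ (scale c ds₁) ds₂ (allPartitions-scale c ds₁ p₁) p₂ , λ α → begin
    (schurComb ((ν , c) ∷ cs) · s) α                             ≡⟨ ·-+ˡ (λ β → c * schur ν β) (schurComb cs) s α ⟩
    ((λ β → c * schur ν β) · s) α + (schurComb cs · s) α         ≡⟨ cong₂ _+_ (trans (·-*ˡ c (schur ν) s α) (cong (c *_) (e₁ α))) (e₂ α) ⟩
    c * schurComb ds₁ α + schurComb ds₂ α                        ≡⟨ cong (_+ schurComb ds₂ α) (sym (schurComb-scale c ds₁ α)) ⟩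
    schurComb (scale c ds₁) α + schurComb ds₂ α                  ≡⟨ sym (schurComb-++ (scale c ds₁) ds₂ α) ⟩
    schurComb (scale c ds₁ ++ ds₂) α ∎
  where
  open ≡-Reasoning
  s = skewSchur λ′ μ
  first = schur-times-skew ν λ′ μ p sk
  ds₁ = proj₁ first
  p₁ = proj₁ (proj₂ first)
  e₁ = proj₂ (proj₂ first)
  second = preserving-skew {λ′} {μ} sk cs ps
  ds₂ = proj₁ second
  p₂ = proj₁ (proj₂ second)
  e₂ = proj₂ (proj₂ second)

preserving-one : Preserving onePoly
preserving-one cs ps = cs , ps , ·-identityʳ (schurComb cs)

preserving-· : ∀ {f g} → Preserving f → Preserving g → Preserving (f · g)
preserving-· {f} {g} pf pg cs ps with pf cs ps
... | ds , qs , e with pg ds qs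
...   | es , rs , e′ = es , rs , λ α → trans (sym (·-assoc (schurComb cs) f g α)) (trans (·-cong {g = g} {g} e (λ _ → refl) α) (e′ α))

nonneg-refl : ∀ {f g} → f ≗ₚ g → SchurNonnegDiff f g
nonneg-refl e = [] , tt , λ α → trans (e α) (sym (+-identityʳ _))

nonneg-trans : ∀ {f g h} → SchurNonnegDiff f g → SchurNonnegDiff g h → SchurNonnegDiff f h
nonneg-trans {f} {g} {h} (cs , p , e) (ds , q , e′) = ds ++ cs , allPartitions-++ ds cs q p , λ α →
  trans (e α) (trans (cong (_+ schurComb cs α) (e′ α)) (trans (+-assoc (h α) _ _) (cong (h α +_) (sym (schurComb-++ ds cs α)))))

nonneg-· : ∀ {f g h} → Preserving h → SchurNonnegDiff f g → SchurNonnegDiff (f · h) (g · h)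
nonneg-· {f} {g} {h} ph (cs , p , e) with ph cs p
... | ds , q , e′ = ds , q , λ α → trans (·-cong {g = h} {h} e (λ _ → refl) α) (trans (·-+ˡ g (schurComb cs) h α) (cong ((g · h) α +_) (e′ α)))

-- Adjacent exchanges and sorting

nonneg-cong : ∀ {f f′ g g′} → f ≗ₚ f′ → g ≗ₚ g′ → SchurNonnegDiff f g → SchurNonnegDiff f′ g′
nonneg-cong e e′ (cs , p , q) = cs , p , λ α → trans (sym (e α)) (trans (q α) (cong (_+ schurComb cs α) (e′ α)))

prodℕ : ℕ → (ℕ → Poly) → Poly
prodℕ zero    g = onePoly
prodℕ (suc n) g = g 0 · prodℕ n (g ∘ suc)

prodFin≡prodℕ : ∀ n (g : ℕ → Poly) → prodFin n (g ∘ toℕ) ≡ prodℕ n g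
prodFin≡prodℕ zero    g = refl
prodFin≡prodℕ (suc n) g = cong (g 0 ·_) (prodFin≡prodℕ n (g ∘ suc))

prodFin-cong : ∀ n {f g : Fin n → Poly} → (∀ i → f i ≗ₚ g i) → prodFin n f ≗ₚ prodFin n g
prodFin-cong zero    e α = refl
prodFin-cong (suc n) e α = ·-cong (e Fin.zero) (prodFin-cong n (e ∘ Fin.suc)) α

prodℕ-cong : ∀ n {f g : ℕ → Poly} → (∀ j → j < n → f j ≗ₚ g j) → prodℕ n f ≗ₚ prodℕ n g
prodℕ-cong zero    e α = refl
prodℕ-cong (suc n) e α = ·-cong (e 0 (s≤s z≤n)) (prodℕ-cong n (λ j lt → e (suc j) (s≤s lt))) α

prodℕ-last : ∀ n g → prodℕ (suc n) g ≗ₚ (prodℕ n g · g n)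
prodℕ-last zero    g α = trans (·-identityʳ (g 0) α) (sym (·-identityˡ (g 0) α))
prodℕ-last (suc n) g α = trans (·-cong {g 0} {g 0} (λ _ → refl) (prodℕ-last n (g ∘ suc)) α)
  (sym (·-assoc (g 0) (prodℕ n (g ∘ suc)) (g (suc n)) α))

preserving-prodℕ : ∀ n g → (∀ j → j < n → Preserving (g j)) → Preserving (prodℕ n g)
preserving-prodℕ zero    g p = preserving-one
preserving-prodℕ (suc n) g p = preserving-· {g 0} {prodℕ n (g ∘ suc)} (p 0 (s≤s z≤n)) (preserving-prodℕ n (g ∘ suc) (λ j lt → p (suc j) (s≤s lt)))

exchange : ∀ n i (f g : ℕ → Poly) → suc i < n → (∀ j → j < n → Preserving (g j)) →
  (∀ j → j < n → j ≢ i → j ≢ suc i → f j ≗ₚ g j) → SchurNonnegDiff (f i · f (suc i)) (g i · g (suc i)) →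
  SchurNonnegDiff (prodℕ n f) (prodℕ n g)
exchange (suc (suc n)) zero f g _ p off d = nonneg-cong
  (λ α → trans (·-cong {f 0 · f 1} {f 0 · f 1} (λ _ → refl) (prodℕ-cong n (λ j lt β → sym (off (2 + j) (s≤s (s≤s lt)) (λ ()) (λ ()) β))) α) (·-assoc (f 0) (f 1) (prodℕ n (f ∘ suc ∘ suc)) α))
  (·-assoc (g 0) (g 1) (prodℕ n (g ∘ suc ∘ suc))) (nonneg-· {h = prodℕ n (g ∘ suc ∘ suc)} (preserving-prodℕ n (g ∘ suc ∘ suc) (λ j lt → p (2 + j) (s≤s (s≤s lt)))) d)
exchange (suc zero) zero f g (s≤s ()) p off d
exchange (suc n) (suc i) f g (s≤s lt) p off d = nonneg-cong
  (λ α → trans (·-comm (prodℕ n (f ∘ suc)) (g 0) α) (·-cong {g 0} {f 0} {prodℕ n (f ∘ suc)} (λ β → sym (off 0 (s≤s z≤n) (λ ()) (λ ()) β)) (λ _ → refl) α))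
  (·-comm (prodℕ n (g ∘ suc)) (g 0))
  (nonneg-· {h = g 0} (p 0 (s≤s z≤n)) (exchange n i (f ∘ suc) (g ∘ suc) lt (λ j l → p (suc j) (s≤s l))
    (λ j l n₀ n₁ → off (suc j) (s≤s l) (n₀ ∘ suc-injective) (n₁ ∘ suc-injective)) d))

-- `σ q` selects the pair of positions `q` and `q + 1`, whose larger value goes to `q`. At `suc q`
-- the test of `σ q` asks whether the position is the second member of a selected pair.
op : (ℕ → Bool) → (ℕ → ℕ) → ℕ → ℕ
op σ z zero    = if σ 0 then z 0 ⊔ z 1 else z 0
op σ z (suc q) = if σ q then z q ⊓ z (suc q) else (if σ (suc q) then z (suc q) ⊔ z (2 + q) else z (suc q))

NonAdjacent : (ℕ → Bool) → Set
NonAdjacent σ = ∀ q → σ q ≡ true → σ (suc q) ≡ false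

module _ (σ : ℕ → Bool) where

  op-min : ∀ z {q} → σ q ≡ true → op σ z (suc q) ≡ z q ⊓ z (suc q)
  op-min z e rewrite e = refl

  op-max : NonAdjacent σ → ∀ z {q} → σ q ≡ true → op σ z q ≡ z q ⊔ z (suc q)
  op-max na z {zero} e rewrite e = refl
  op-max na z {suc q} e with σ q in eq
  ... | true  = ⊥-elim (contra (trans (sym e) (na q eq)))
    where
    contra : true ≡ false → ⊥
    contra ()
  ... | false rewrite e = refl

  op-off₀ : ∀ z → σ 0 ≡ false → op σ z 0 ≡ z 0
  op-off₀ z e rewrite e = refl

  op-off : ∀ z {q} → σ q ≡ false → σ (suc q) ≡ false → op σ z (suc q) ≡ z (suc q)
  op-off z e e′ rewrite e | e′ = refl

  op-mono : ∀ {z w : ℕ → ℕ} → (∀ q → w q ≤ z q) → ∀ q → op σ w q ≤ op σ z q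
  op-mono le zero with σ 0
  ... | true  = ⊔-mono-≤ (le 0) (le 1)
  ... | false = le 0
  op-mono le (suc q) with σ q | σ (suc q)
  ... | true  | _     = ⊓-mono-≤ (le q) (le (suc q))
  ... | false | true  = ⊔-mono-≤ (le (suc q)) (le (2 + q))
  ... | false | false = le (suc q)

  op-supp : ∀ {z B} → (∀ q → B ≤ q → z q ≡ 0) → ∀ q → B ≤ q → op σ z q ≡ 0
  op-supp {z} s zero le with σ 0
  ... | true  = cong₂ _⊔_ (s 0 le) (s 1 (m≤n⇒m≤1+n le))
  ... | false = s 0 le
  op-supp {z} s (suc q) le with σ q | σ (suc q)
  ... | true  | _     = trans (cong (z q ⊓_) (s (suc q) le)) (⊓-zeroʳ (z q))
  ... | false | true  = cong₂ _⊔_ (s (suc q) le) (s (2 + q) (m≤n⇒m≤1+n le))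
  ... | false | false = s (suc q) le

  -- Periodicity places each selected pair of a block over one of the next block, and `⊔` and `⊓`
  -- are monotone. Position 0 has no predecessor, so the predecessor `n′` of position `suc n′` has
  -- to be unselected.
  op-periodic : ∀ n′ {z} → (∀ q → σ (suc n′ + q) ≡ σ q) → σ n′ ≡ false → (∀ q → z (suc n′ + q) ≤ z q) → ∀ q → op σ z (suc n′ + q) ≤ op σ z q
  op-periodic n′ {z} per last v zero = subst (λ m → op σ z (suc m) ≤ op σ z 0) (sym (+-identityʳ n′)) go
    where
    v₀ : z (suc n′) ≤ z 0
    v₀ = subst (λ m → z (suc m) ≤ z 0) (+-identityʳ n′) (v 0)
    v₁ : z (2 + n′) ≤ z 1
    v₁ = subst (λ m → z (suc m) ≤ z 1) (+-comm n′ 1) (v 1)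
    per₀ : σ (suc n′) ≡ σ 0
    per₀ = trans (cong (λ m → σ (suc m)) (sym (+-identityʳ n′))) (per 0)
    go : op σ z (suc n′) ≤ op σ z 0
    go rewrite last | per₀ with σ 0
    ... | true  = ⊔-mono-≤ v₀ v₁
    ... | false = v₀
  op-periodic n′ {z} per last v (suc q) rewrite +-suc n′ q | per q | trans (cong (λ m → σ (suc m)) (sym (+-suc n′ q))) (per (suc q))
    with σ q | σ (suc q)
  ... | true  | _     = ⊓-mono-≤ (v q) v₁
    where
    v₁ = subst (λ m → z (suc m) ≤ z (suc q)) (+-suc n′ q) (v (suc q))
  ... | false | true  = ⊔-mono-≤ v₁ v₂
    where
    v₁ = subst (λ m → z (suc m) ≤ z (suc q)) (+-suc n′ q) (v (suc q))
    v₂ = subst (λ m → z (suc m) ≤ z (2 + q)) (trans (+-suc n′ (suc q)) (cong suc (+-suc n′ q))) (v (2 + q))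
  ... | false | false = subst (λ m → z (suc m) ≤ z (suc q)) (+-suc n′ q) (v (suc q))

_◂_ : ℕ → (ℕ → ℕ) → ℕ → ℕ
(K ◂ z) zero    = K
(K ◂ z) (suc q) = z q

-- `K` dominates `z 0`, so ordering this pair changes nothing; all other pairs are merely shifted.
op-◂ : ∀ σ → NonAdjacent σ → ∀ K z → z 0 ≤ K → ∀ q → op σ (K ◂ z) q ≡ (K ◂ op (σ ∘ suc) z) q
op-◂ σ na K z le zero with σ 0
... | true  = m≥n⇒m⊔n≡m le
... | false = refl
op-◂ σ na K z le (suc zero) with σ 0 in eq
... | true rewrite na 0 eq = m≥n⇒m⊓n≡n le
... | false = refl
op-◂ σ na K z le (suc (suc q)) = refl

module PairSum (σ : ℕ → Bool) (na : NonAdjacent σ) (f : ℕ → ℕ → ℕ) (z : ℕ → ℕ) where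

  private
    T T′ : ℕ → ℕ
    T q = f q (z q)
    T′ q = f q (op σ z q)

    contra : true ≡ false → ⊥
    contra ()

    before : ∀ {Q} → σ Q ≡ true → ∀ q → suc q ≡ Q → σ q ≡ false
    before eq q refl with σ q in e
    ... | false = refl
    ... | true  = trans (sym eq) (na q e)

  module _ (_~_ : ℕ → ℕ → Set) (~refl : ∀ {x} → x ~ x) (_~+_ : ∀ {a b c d} → a ~ b → c ~ d → (a + c) ~ (b + d))
    (pair : ∀ q → σ q ≡ true → (f q (z q ⊔ z (suc q)) + f (suc q) (z q ⊓ z (suc q))) ~ (T q + T (suc q))) where

    -- A selected pair is treated as one unit, so the recursion goes back two steps there; the
    -- hypothesis keeps the cut at `Q` from splitting a pair. The relation is left open to cover
    -- both `_≡_` and `_≤_`.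
    pair-sum : ∀ Q → (∀ q → suc q ≡ Q → σ q ≡ false) → ∑ Q T′ ~ ∑ Q T
    pair-sum zero          _ = ~refl
    pair-sum (suc zero)    h = ~refl ~+ subst (λ x → f 0 x ~ T 0) (sym (op-off₀ σ z (h 0 refl))) ~refl
    pair-sum (suc (suc Q)) h = cases (pair-sum Q) (pair-sum (suc Q)) (σ Q) refl
      where
      IH : ℕ → Set
      IH Q = (∀ q → suc q ≡ Q → σ q ≡ false) → ∑ Q T′ ~ ∑ Q T
      cases : IH Q → IH (suc Q) → ∀ b → σ Q ≡ b → ∑ (2 + Q) T′ ~ ∑ (2 + Q) T
      cases _ ih false eq = ih (λ { q refl → eq }) ~+ subst (λ x → f (suc Q) x ~ T (suc Q)) (sym (op-off σ z eq (h (suc Q) refl))) ~refl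
      cases ih _ true eq = subst₂ _~_ (sym (+-assoc (∑ Q T′) _ _)) (sym (+-assoc (∑ Q T) _ _))
        (ih (before eq) ~+ subst₂ (λ x y → (f Q x + f (suc Q) y) ~ (T Q + T (suc Q))) (sym (op-max σ na z eq)) (sym (op-min σ z eq)) (pair Q eq))

  module _ (pair : ∀ q → σ q ≡ true → f q (z q ⊔ z (suc q)) + f (suc q) (z q ⊓ z (suc q)) ≤ T q + T (suc q)) where

    -- No pair increases its contribution, so if the whole sum does not drop, no single pair can
    -- have dropped.
    pair-sum-equal : ∀ Q → (∀ q → suc q ≡ Q → σ q ≡ false) → ∑ Q T ≤ ∑ Q T′ → ∀ q → suc q < Q → σ q ≡ true →
      T q + T (suc q) ≤ f q (z q ⊔ z (suc q)) + f (suc q) (z q ⊓ z (suc q))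
    pair-sum-equal (suc zero) h le q (s≤s ()) e
    pair-sum-equal (suc (suc Q)) h le q lt e = cases (pair-sum-equal Q) (pair-sum-equal (suc Q)) (σ Q) refl
      where
      IH : ℕ → Set
      IH Q = (∀ q → suc q ≡ Q → σ q ≡ false) → ∑ Q T ≤ ∑ Q T′ → ∀ q → suc q < Q → σ q ≡ true →
        T q + T (suc q) ≤ f q (z q ⊔ z (suc q)) + f (suc q) (z q ⊓ z (suc q))
      all≤ : ∀ Q → (∀ q → suc q ≡ Q → σ q ≡ false) → ∑ Q T′ ≤ ∑ Q T
      all≤ = pair-sum _≤_ ≤-refl +-mono-≤ pair
      Goal = T q + T (suc q) ≤ f q (z q ⊔ z (suc q)) + f (suc q) (z q ⊓ z (suc q))
      earlier : q ≢ Q → suc q < suc Q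
      earlier ne = s≤s (≤∧≢⇒< (≤-pred (≤-pred lt)) ne)
      cases : IH Q → IH (suc Q) → ∀ b → σ Q ≡ b → Goal
      cases _ ih false eq = ih (λ { _ refl → eq })
        (+-cancelʳ-≤ (T (suc Q)) _ _ (subst (λ x → ∑ (suc Q) T + T (suc Q) ≤ ∑ (suc Q) T′ + f (suc Q) x) (op-off σ z eq (h (suc Q) refl)) le))
        q (earlier (λ { refl → contra (trans (sym e) eq) })) e
      cases ih _ true eq = split (q ≟ Q)
        where
        le′ : ∑ Q T + (T Q + T (suc Q)) ≤ ∑ Q T′ + (f Q (z Q ⊔ z (suc Q)) + f (suc Q) (z Q ⊓ z (suc Q)))
        le′ = subst₂ _≤_ (+-assoc (∑ Q T) _ _) (trans (+-assoc (∑ Q T′) _ _)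
          (cong (∑ Q T′ +_) (cong₂ _+_ (cong (f Q) (op-max σ na z eq)) (cong (f (suc Q)) (op-min σ z eq))))) le
        split : Dec (q ≡ Q) → Goal
        split (yes refl) = +-cancelˡ-≤ (∑ Q T) _ _ (≤-trans le′ (+-monoˡ-≤ _ (all≤ Q (before eq))))
        split (no ne) = ih (before eq) (+-cancelʳ-≤ (T Q + T (suc Q)) _ _ (≤-trans le′ (+-monoʳ-≤ (∑ Q T′) (pair Q eq))))
          q (≤∧≢⇒< (≤-pred (earlier ne)) (λ { refl → contra (trans (sym e) (before eq q refl)) })) e

module _ (σ : ℕ → Bool) (na : NonAdjacent σ) (z : ℕ → ℕ) {B : ℕ} (supp : ∀ q → B ≤ q → z q ≡ 0) where

  private
    -- a cut-off not separating a selected pair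
    Q : ℕ
    Q = if σ B then 2 + B else suc B

    Q-ok : ∀ q → suc q ≡ Q → σ q ≡ false
    Q-ok q e with σ B in eq
    Q-ok q refl | true  = na B eq
    Q-ok q refl | false = eq

    cut : ∀ (f : ℕ → ℕ → ℕ) → (∀ q → f q 0 ≡ 0) → ∀ (y : ℕ → ℕ) → (∀ q → B ≤ q → y q ≡ 0) → ∑ Q (λ q → f q (y q)) ≡ ∑ B (λ q → f q (y q))
    cut f f0 y s with σ B
    ... | true  = ∑-beyond B 2 (λ q le → trans (cong (f q) (s q le)) (f0 q))
    ... | false = ∑-beyond B 1 (λ q le → trans (cong (f q) (s q le)) (f0 q))

  op-sum : ∀ (g : ℕ → ℕ) → g 0 ≡ 0 → ∑ B (λ q → g (op σ z q)) ≡ ∑ B (λ q → g (z q))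
  op-sum g g0 = trans (sym (cut (λ _ → g) (λ _ → g0) (op σ z) (op-supp σ supp)))
    (trans (PairSum.pair-sum σ na (λ _ → g) z _≡_ refl (cong₂ _+_) (λ q _ → swap (z q) (z (suc q))) Q Q-ok) (cut (λ _ → g) (λ _ → g0) z supp))
    where
    swap : ∀ a b → g (a ⊔ b) + g (a ⊓ b) ≡ g a + g b
    swap a b with ≤-total a b
    ... | inj₁ le rewrite m≤n⇒m⊔n≡n le | m≤n⇒m⊓n≡m le = +-comm (g b) (g a)
    ... | inj₂ le rewrite m≥n⇒m⊔n≡m le | m≥n⇒m⊓n≡n le = refl

  private
    exch : ∀ q a b → q * (a ⊔ b) + suc q * (a ⊓ b) ≤ q * a + suc q * b
    exch q a b with ≤-total a b
    ... | inj₂ le rewrite m≥n⇒m⊔n≡m le | m≥n⇒m⊓n≡n le = ≤-refl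
    ... | inj₁ le rewrite m≤n⇒m⊔n≡n le | m≤n⇒m⊓n≡m le = ≤-trans (≤-reflexive (ar q a b)) (≤-trans (+-monoʳ-≤ (q * a + q * b) le) (≤-reflexive (ar′ q a b)))
      where
      ar : ∀ q a b → q * b + suc q * a ≡ q * a + q * b + a
      ar = solve-∀
      ar′ : ∀ q a b → q * a + q * b + b ≡ q * a + suc q * b
      ar′ = solve-∀

    exch-strict : ∀ q a b → a < b → q * (a ⊔ b) + suc q * (a ⊓ b) < q * a + suc q * b
    exch-strict q a b lt rewrite m≤n⇒m⊔n≡n (<⇒≤ lt) | m≤n⇒m⊓n≡m (<⇒≤ lt) =
        ≤-trans (≤-reflexive (cong suc (ar q a b))) (≤-trans (≤-reflexive (sym (+-suc (q * a + q * b) a))) (≤-trans (+-monoʳ-≤ (q * a + q * b) lt) (≤-reflexive (ar′ q a b))))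
      where
      ar : ∀ q a b → q * b + suc q * a ≡ q * a + q * b + a
      ar = solve-∀
      ar′ : ∀ q a b → q * a + q * b + b ≡ q * a + suc q * b
      ar′ = solve-∀

  -- Weighting by position: the moment falls strictly when a larger value moves ahead of a smaller
  -- one, and it measures how far a sequence is from being sorted.
  moment : (ℕ → ℕ) → ℕ
  moment y = ∑ B (λ q → q * y q)

  private
    z* : ∀ q → q * 0 ≡ 0
    z* = *-zeroʳ

  op-moment : moment (op σ z) ≤ moment z
  op-moment = subst₂ _≤_ (cut _*_ z* (op σ z) (op-supp σ supp)) (cut _*_ z* z supp)
    (PairSum.pair-sum σ na _*_ z _≤_ ≤-refl +-mono-≤ (λ q _ → exch q (z q) (z (suc q))) Q Q-ok)

  op-moment-equal : moment z ≤ moment (op σ z) → ∀ q → σ q ≡ true → z (suc q) ≤ z q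
  op-moment-equal le q e with suc q <? Q
  ... | no nlt = ≤-trans (≤-reflexive (supp (suc q) (≤-trans B≤Q (≮⇒≥ nlt)))) z≤n
    where
    B≤Q : B ≤ Q
    B≤Q with σ B
    ... | true  = m≤n⇒m≤1+n (n≤1+n B)
    ... | false = n≤1+n B
  ... | yes lt = ≮⇒≥ λ asc → <-irrefl refl (≤-trans (exch-strict q (z q) (z (suc q)) asc)
      (PairSum.pair-sum-equal σ na _*_ z (λ q _ → exch q (z q) (z (suc q))) Q Q-ok
        (subst₂ _≤_ (sym (cut _*_ z* z supp)) (sym (cut _*_ z* (op σ z) (op-supp σ supp))) le) q lt e))

zipWith-row : ∀ (f : ℕ → ℕ → ℕ) L g h → zipWith f (row L g) (row L h) ≡ row L (λ r → f (g r) (h r))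
zipWith-row f zero    g h = refl
zipWith-row f (suc L) g h = cong (f (g 0) (h 0) ∷_) (zipWith-row f L (g ∘ suc) (h ∘ suc))

-- The n = suc n′ partitions are interleaved into one sequence: part r of partition j is z (j + r * n).
module Interleaved (n′ : ℕ) where

  n : ℕ
  n = suc n′

  col : ℕ → (ℕ → ℕ) → ℕ → List ℕ
  col L z j = row L (λ r → z (j + r * n))

  -- `z` and `w` hold the outer and the inner shapes. Position `n + q` is the next row of the shape
  -- that owns position `q`, so `vz` and `vw` say that every shape is a partition.
  record State (B : ℕ) (z w : ℕ → ℕ) : Set where
    field
      vz   : ∀ q → z (n + q) ≤ z q
      vw   : ∀ q → w (n + q) ≤ w q
      sub  : ∀ q → w q ≤ z q
      supp : ∀ q → B ≤ q → z q ≡ 0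

    supp′ : ∀ q → B ≤ q → w q ≡ 0
    supp′ q le = n≤0⇒n≡0 (≤-trans (sub q) (≤-reflexive (supp q le)))

  far : ∀ {B j r} → B ≤ r → B ≤ j + r * n
  far {B} {j} {r} le = ≤-trans le (≤-trans (m≤m*n r n) (m≤n+m (r * n) j))

  at-col : ∀ {B L z j} → B ≤ L → (∀ q → B ≤ q → z q ≡ 0) → ∀ r → at (col L z j) r ≡ z (j + r * n)
  at-col {B} {L} {z} {j} le s = at-row-null L (λ r → z (j + r * n)) (λ r L≤ → s (j + r * n) (far {j = j} (≤-trans le L≤)))

  factor : ℕ → (ℕ → ℕ) → (ℕ → ℕ) → ℕ → Poly
  factor L z w j = skewSchur (col L z j) (col L w j)

  P : ℕ → (ℕ → ℕ) → (ℕ → ℕ) → Poly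
  P L z w = prodℕ n (factor L z w)

  col-cong : ∀ L {z z′} → (∀ q → z q ≡ z′ q) → ∀ j → col L z j ≡ col L z′ j
  col-cong L e j = row-cong L (λ r → e (j + r * n))

  P-cong : ∀ L {z z′ w w′} → (∀ q → z q ≡ z′ q) → (∀ q → w q ≡ w′ q) → P L z w ≗ₚ P L z′ w′
  P-cong L e e′ = prodℕ-cong n (λ j _ α → cong₂ (λ a b → skewSchur a b α) (col-cong L e j) (col-cong L e′ j))

  next-row : ∀ j r → j + suc r * n ≡ n + (j + r * n)
  next-row j r = ar j (r * n) n
    where
    ar : ∀ a b c → a + (c + b) ≡ c + (a + b)
    ar = solve-∀

  col-skew : ∀ {B L z w} → State B z w → B ≤ L → ∀ j → IsSkewShape (col L z j) (col L w j)
  col-skew {B} {L} {z} {w} s le j = part z supp vz , part w supp′ vw ,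
      λ r → subst₂ _≤_ (sym (at-col le supp′ r)) (sym (at-col le supp r)) (sub (j + r * n))
    where
    open State s
    part : ∀ y → (∀ q → B ≤ q → y q ≡ 0) → (∀ q → y (n + q) ≤ y q) → IsPartition (col L y j)
    part y sp v r = subst₂ _≤_ (trans (cong y (sym (next-row j r))) (sym (at-col le sp (suc r)))) (sym (at-col le sp r)) (v (j + r * n))

  -- Selects, in every row at once, the pair formed by shapes `i` and `i + 1`.
  σ : ℕ → ℕ → Bool
  σ i q = does (q % n ≟ i)

  σ-col : ∀ i {j} r → j < n → σ i (j + r * n) ≡ does (j ≟ i)
  σ-col i {j} r lt = cong (λ v → does (v ≟ i)) (trans ([m+kn]%n≡m%n j r n) (m<n⇒m%n≡m lt))

  %-suc : ∀ q → q % n < n′ → suc q % n ≡ suc (q % n)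
  %-suc q lt = trans (cong (λ v → suc v % n) (m≡m%n+[m/n]*n q n))
    (trans ([m+kn]%n≡m%n (suc (q % n)) (q / n) n) (m<n⇒m%n≡m (s≤s lt)))

  %-wrap : ∀ q → q % n ≡ n′ → suc q % n ≡ 0
  %-wrap q e = trans (cong (λ v → suc v % n) (trans (m≡m%n+[m/n]*n q n) (cong (_+ q / n * n) e)))
    (trans ([m+kn]%n≡m%n n (q / n) n) (n%n≡0 n))

  does-true : ∀ {A : Set} (d : Dec A) → does d ≡ true → A
  does-true (yes a) _ = a

  module _ {i : ℕ} (i< : i < n′) where

    σ-nonadjacent : NonAdjacent (σ i)
    σ-nonadjacent q e = dec-false (suc q % n ≟ i) (λ e′ → 1+n≢n (trans (sym (%-suc q (subst (_< n′) (sym q%) i<))) (trans e′ (sym q%))))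
      where
      q% : q % n ≡ i
      q% = does-true (q % n ≟ i) e

    σ-periodic : ∀ q → σ i (n + q) ≡ σ i q
    σ-periodic q = cong (λ v → does (v ≟ i)) (trans (cong (_% n) (+-comm n q)) ([m+n]%n≡m%n q n))

    σ-last : σ i n′ ≡ false
    σ-last = dec-false (n′ % n ≟ i) (λ e → <-irrefl (trans (sym e) (m<n⇒m%n≡m ≤-refl)) i<)

    op-state : ∀ {B z w} → State B z w → State B (op (σ i) z) (op (σ i) w)
    op-state s = record
      { vz = op-periodic (σ i) n′ σ-periodic σ-last vz ; vw = op-periodic (σ i) n′ σ-periodic σ-last vw
      ; sub = op-mono (σ i) sub ; supp = op-supp (σ i) supp }
      where open State s

    private
      here-true : ∀ r → σ i (i + r * n) ≡ true
      here-true r = trans (σ-col i r (m<n⇒m<1+n i<)) (dec-true (i ≟ i) refl)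

      op-col-max : ∀ L z → col L (op (σ i) z) i ≡ col L z i ∨ col L z (suc i)
      op-col-max L z = trans (row-cong L (λ r → op-max (σ i) σ-nonadjacent z (here-true r))) (sym (zipWith-row _⊔_ L _ _))

      op-col-min : ∀ L z → col L (op (σ i) z) (suc i) ≡ col L z i ∧ col L z (suc i)
      op-col-min L z = trans (row-cong L (λ r → op-min (σ i) z (here-true r))) (sym (zipWith-row _⊓_ L _ _))

      op-fixed : ∀ z {j} → j < n → j ≢ i → j ≢ suc i → ∀ r → op (σ i) z (j + r * n) ≡ z (j + r * n)
      op-fixed z {j} lt n₀ n₁ r = go (j + r * n) refl
        where
        off : σ i (j + r * n) ≡ false
        off = trans (σ-col i r lt) (dec-false (j ≟ i) n₀)
        go : ∀ q → q ≡ j + r * n → op (σ i) z q ≡ z q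
        go zero    e = op-off₀ (σ i) z (trans (cong (σ i) e) off)
        go (suc q) e = op-off (σ i) z before (trans (cong (σ i) e) off)
          where
          before : σ i q ≡ false
          before = dec-false (q % n ≟ i) (λ e′ → n₁ (trans (sym (trans (cong (_% n) e) (trans ([m+kn]%n≡m%n j r n) (m<n⇒m%n≡m lt))))
            (trans (%-suc q (subst (_< n′) (sym e′) i<)) (cong suc e′))))

    op-increases : ∀ {B z w L} → State B z w → B ≤ L → SchurNonnegDiff (P L (op (σ i) z) (op (σ i) w)) (P L z w)
    op-increases {B} {z} {w} {L} s le = exchange n i (factor L (op (σ i) z) (op (σ i) w)) (factor L z w) (s≤s i<)
      (λ j _ → preserving-skew {col L z j} {col L w j} (col-skew s le j))
      (λ j lt n₀ n₁ α → cong₂ (λ a b → skewSchur a b α) (row-cong L (op-fixed z lt n₀ n₁)) (row-cong L (op-fixed w lt n₀ n₁)))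
      (nonneg-cong (·-cong (λ α → cong₂ (λ a b → skewSchur a b α) (sym (op-col-max L z)) (sym (op-col-max L w)))
                           (λ α → cong₂ (λ a b → skewSchur a b α) (sym (op-col-min L z)) (sym (op-col-min L w))))
        (λ _ → refl)
        (JoinMeet.join-meet L (col L z i) (col L w i) (col L z (suc i)) (col L w (suc i)) len len len len (col-skew s le i) (col-skew s le (suc i))))
      where
      len : ∀ {f} → length (row L f) ≡ L
      len {f} = length-applyUpTo f L

  module _ {B z w K} (s : State B z w) (K≥ : ∀ q → z q ≤ K) where
    open State s

    ◂-state : State (suc B) (K ◂ z) (K ◂ w)
    ◂-state = record { vz = per z vz K≥ ; vw = per w vw (λ q → ≤-trans (sub q) (K≥ q))
                     ; sub = λ { zero → ≤-refl ; (suc q) → sub q } ; supp = λ { (suc q) (s≤s le) → supp q le } }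
      where
      per : ∀ y → (∀ q → y (n + q) ≤ y q) → (∀ q → y q ≤ K) → ∀ q → (K ◂ y) (n + q) ≤ (K ◂ y) q
      per y v b zero    = b _
      per y v b (suc q) = subst (λ v → y v ≤ y q) (sym (+-suc n′ q)) (v q)

    -- Prepending one term rotates the shapes: the last one becomes shape 0 with a new top row `K`
    -- in both its partitions, which leaves its skew Schur function unchanged, and the others move
    -- up by one index.
    ◂-product : ∀ {L} → suc B ≤ L → P L (K ◂ z) (K ◂ w) ≗ₚ P L z w
    ◂-product {L} le α = begin
      (factor L (K ◂ z) (K ◂ w) 0 · prodℕ n′ (factor L z w)) α ≡⟨ ·-cong {g = prodℕ n′ (factor L z w)} first (λ _ → refl) α ⟩
      (factor L z w n′ · prodℕ n′ (factor L z w)) α            ≡⟨ ·-comm (factor L z w n′) (prodℕ n′ (factor L z w)) α ⟩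
      (prodℕ n′ (factor L z w) · factor L z w n′) α            ≡⟨ sym (prodℕ-last n′ (factor L z w) α) ⟩
      P L z w α ∎
      where
      open ≡-Reasoning
      B≤L : B ≤ L
      B≤L = ≤-trans (n≤1+n B) le
      shift : ∀ y → (∀ q → B ≤ q → y q ≡ 0) → col L (K ◂ y) 0 ≈ₚ (K ∷ col L y n′)
      shift y sp zero    = at-col {suc B} {L} {K ◂ y} {0} le (λ { (suc q) (s≤s l) → sp q l }) 0
      shift y sp (suc r) = trans (at-col {suc B} {L} {K ◂ y} {0} le (λ { (suc q) (s≤s l) → sp q l }) (suc r)) (sym (at-col {B} {L} {y} {n′} B≤L sp r))
      first : factor L (K ◂ z) (K ◂ w) 0 ≗ₚ factor L z w n′
      first α = trans (skewSchur-≈ {col L (K ◂ z) 0} {col L (K ◂ w) 0} {K ∷ col L z n′} {K ∷ col L w n′} (col-skew ◂-state le 0) (shift z supp) (shift w supp′) α)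
        (kostka-prepend K {col L z n′} {col L w n′} (proj₁ (col-skew s B≤L n′))
          (≤-reflexive (trans (length-applyUpTo _ L) (sym (length-applyUpTo _ L))))
          (≤-trans (≤-reflexive (at-col {B} {L} {z} {n′} B≤L supp 0)) (K≥ _)) α)

  bound : ∀ {B} z → (∀ q → B ≤ q → z q ≡ 0) → ∀ q → z q ≤ ∑ B z
  bound {B} z s q with q <? B
  ... | no nlt = ≤-trans (≤-reflexive (s q (≮⇒≥ nlt))) z≤n
  ... | yes lt = term B lt
    where
    term : ∀ B → q < B → z q ≤ ∑ B z
    term (suc B) lt with q ≟ B
    ... | yes refl = m≤n+m (z q) (∑ B z)
    ... | no ne = ≤-trans (term B (≤∧≢⇒< (≤-pred lt) ne)) (m≤m+n _ _)

  record Sorted (B L : ℕ) (z w : ℕ → ℕ) : Set where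
    field
      z′ w′ : ℕ → ℕ
      state : State B z′ w′
      antiz : ∀ q → z′ (suc q) ≤ z′ q
      antiw : ∀ q → w′ (suc q) ≤ w′ q
      sumz  : ∀ (g : ℕ → ℕ) → g 0 ≡ 0 → ∑ B (λ q → g (z′ q)) ≡ ∑ B (λ q → g (z q))
      sumw  : ∀ (g : ℕ → ℕ) → g 0 ≡ 0 → ∑ B (λ q → g (w′ q)) ≡ ∑ B (λ q → g (w q))
      more  : SchurNonnegDiff (P L z′ w′) (P L z w)

  module _ (0< : 0 < n′) where

    -- Pairs row `r` of the last shape with row `r + 1` of shape 0. After a term is prepended these
    -- pairs are the ones selected by `σ 0`.
    wrap : ℕ → Bool
    wrap = σ 0 ∘ suc

    wrap-nonadjacent : NonAdjacent wrap
    wrap-nonadjacent q = σ-nonadjacent 0< (suc q)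

    module _ {B z w} (s : State B z w) where
      private
        open State s
        -- A crude upper bound for all entries of `z`, and by `sub` for those of `w`.
        K = ∑ B z
        K≥ = bound z supp
        s⁺ = ◂-state s K≥
        eqz = op-◂ (σ 0) (σ-nonadjacent 0<) K z (K≥ 0)
        eqw = op-◂ (σ 0) (σ-nonadjacent 0<) K w (≤-trans (sub 0) (K≥ 0))
        t = op-state 0< s⁺

      wrap-state : State B (op wrap z) (op wrap w)
      wrap-state = record { vz = per z eqz (State.vz t) ; vw = per w eqw (State.vw t) ; sub = op-mono wrap sub ; supp = op-supp wrap supp }
        where
        per : ∀ y → (∀ q → op (σ 0) (K ◂ y) q ≡ (K ◂ op wrap y) q) → (∀ q → op (σ 0) (K ◂ y) (n + q) ≤ op (σ 0) (K ◂ y) q) →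
          ∀ q → op wrap y (n + q) ≤ op wrap y q
        per y e v q = subst₂ _≤_ (trans (e (n + suc q)) (cong (op wrap y) (+-suc n′ q))) (e (suc q)) (v (suc q))

      wrap-increases : ∀ {L} → suc B ≤ L → SchurNonnegDiff (P L (op wrap z) (op wrap w)) (P L z w)
      wrap-increases {L} le = nonneg-cong
        (λ α → trans (P-cong L eqz eqw α) (◂-product wrap-state (λ q → wrapped q) le α)) (◂-product s K≥ le) (op-increases 0< s⁺ le)
        where
        wrapped : ∀ q → op wrap z q ≤ K
        wrapped zero with wrap 0
        ... | true  = ⊔-lub (K≥ 0) (K≥ 1)
        ... | false = K≥ 0
        wrapped (suc q) with wrap q | wrap (suc q)
        ... | true  | _     = ≤-trans (m⊓n≤m _ _) (K≥ q)
        ... | false | true  = ⊔-lub (K≥ (suc q)) (K≥ (2 + q))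
        ... | false | false = K≥ (suc q)

    sel : ℕ → ℕ → Bool
    sel i with i <? n′
    ... | yes _ = σ i
    ... | no _  = wrap

    sel-nonadjacent : ∀ i → NonAdjacent (sel i)
    sel-nonadjacent i with i <? n′
    ... | yes lt = σ-nonadjacent lt
    ... | no _   = wrap-nonadjacent

    sel-step : ∀ i {B z w L} → State B z w → suc B ≤ L →
      State B (op (sel i) z) (op (sel i) w) × SchurNonnegDiff (P L (op (sel i) z) (op (sel i) w)) (P L z w)
    sel-step i s le with i <? n′
    ... | yes lt = op-state lt s , op-increases lt s (≤-trans (n≤1+n _) le)
    ... | no _   = wrap-state s , wrap-increases s le

    sel-cover : ∀ q → sel (q % n) q ≡ true
    sel-cover q with q % n <? n′
    ... | yes _  = dec-true (q % n ≟ q % n) refl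
    ... | no nlt = dec-true (suc q % n ≟ 0) (%-wrap q (≤-antisym (≤-pred (m%n<n q n)) (≮⇒≥ nlt)))

    -- Outer and inner sequences undergo the same selection, so the descent is on the sum of their
    -- moments. Neither moment can rise; hence if no selection lowers the sum, each moment is
    -- unchanged by all of them, and both sequences are in order at every adjacent pair.
    sort : ∀ {B L z w} → suc B ≤ L → State B z w → Sorted B L z w
    sort {B} {L} le s = go s (<-wellFounded _)
      where
      Φ : (ℕ → ℕ) → ℕ
      Φ y = ∑ B (λ q → q * y q)
      go : ∀ {z w} → State B z w → Acc _<_ (Φ z + Φ w) → Sorted B L z w
      go {z} {w} s (acc rec) = cases (anyUpTo? (λ i → Φ (op (sel i) z) + Φ (op (sel i) w) <? Φ z + Φ w) n)
        where
        open State s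
        cases : Dec (∃ λ i → i < n × Φ (op (sel i) z) + Φ (op (sel i) w) < Φ z + Φ w) → Sorted B L z w
        cases (yes (i , _ , lt)) = record
          { Sorted r hiding (sumz; sumw; more)
          ; sumz = λ g g0 → trans (Sorted.sumz r g g0) (op-sum (sel i) (sel-nonadjacent i) z supp g g0)
          ; sumw = λ g g0 → trans (Sorted.sumw r g g0) (op-sum (sel i) (sel-nonadjacent i) w supp′ g g0)
          ; more = nonneg-trans (Sorted.more r) (proj₂ (sel-step i s le)) }
          where
          r : Sorted B L (op (sel i) z) (op (sel i) w)
          r = go (proj₁ (sel-step i s le)) (rec lt)
        cases (no none) = record
          { z′ = z ; w′ = w ; state = s
          ; antiz = λ q → op-moment-equal (sel (q % n)) (sel-nonadjacent (q % n)) z supp (fixz (q % n) (m%n<n q n)) q (sel-cover q)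
          ; antiw = λ q → op-moment-equal (sel (q % n)) (sel-nonadjacent (q % n)) w supp′ (fixw (q % n) (m%n<n q n)) q (sel-cover q)
          ; sumz = λ _ _ → refl ; sumw = λ _ _ → refl ; more = nonneg-refl (λ _ → refl) }
          where
          whole : ∀ i → i < n → Φ z + Φ w ≤ Φ (op (sel i) z) + Φ (op (sel i) w)
          whole i lt = ≮⇒≥ (λ l → none (i , lt , l))
          fixz : ∀ i → i < n → Φ z ≤ Φ (op (sel i) z)
          fixz i lt = +-cancelʳ-≤ (Φ w) _ _ (≤-trans (whole i lt) (+-monoʳ-≤ (Φ (op (sel i) z)) (op-moment (sel i) (sel-nonadjacent i) w supp′)))
          fixw : ∀ i → i < n → Φ w ≤ Φ (op (sel i) w)
          fixw i lt = +-cancelˡ-≤ (Φ z) _ _ (≤-trans (whole i lt) (+-monoˡ-≤ (Φ (op (sel i) w)) (op-moment (sel i) (sel-nonadjacent i) z supp)))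

-- Identification of the sorted sequence with the union of all parts

S-determines : ∀ Q {f g} → Shape Q f → Shape Q g → (∀ c → S Q f c ≡ S Q g c) → ∀ r → f r ≡ g r
S-determines Q {f} {g} sf sg e r = ≤-antisym (≮⇒≥ (λ lt → absurd sf sg H≡ lt)) (≮⇒≥ (λ lt → absurd sg sf (sym ∘ H≡) lt))
  where
  -- Consecutive differences of `S` are the column lengths, that is, the conjugate partition.
  H≡ : ∀ c → H Q f c ≡ H Q g c
  H≡ c = +-cancelˡ-≡ (S Q g (suc c)) _ _ (trans (cong (_+ H Q f c) (sym (e (suc c))))
    (trans (sym (S-step Q (Shape.anti sf) c)) (trans (e c) (S-step Q (Shape.anti sg) c))))
  absurd : ∀ {f g} → Shape Q f → Shape Q g → (∀ c → H Q f c ≡ H Q g c) → ¬ (g r < f r)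
  absurd {f} {g} sf sg h lt = <-irrefl refl (H-below Q (Shape.anti sg) (subst (r <_) (h (g r))
    (≰⇒> λ le → <-irrefl refl (≤-trans lt (H-above Q sf le)))))

insertDesc-sum : ∀ (g : ℕ → ℕ) x ys → sum (map g (insertDesc x ys)) ≡ g x + sum (map g ys)
insertDesc-sum g x [] = refl
insertDesc-sum g x (y ∷ ys) with y ≤ᵇ x
... | true  = refl
... | false = trans (cong (g y +_) (insertDesc-sum g x ys)) (trans (sym (+-assoc (g y) (g x) _))
                (trans (cong (_+ sum (map g ys)) (+-comm (g y) (g x))) (+-assoc (g x) (g y) _)))

sortDesc-sum : ∀ (g : ℕ → ℕ) xs → sum (map g (sortDesc xs)) ≡ sum (map g xs)
sortDesc-sum g []       = refl
sortDesc-sum g (x ∷ xs) = trans (insertDesc-sum g x (sortDesc xs)) (cong (g x +_) (sortDesc-sum g xs))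

insertDesc-head : ∀ {y} x ys → x ≤ y → at ys 0 ≤ y → at (insertDesc x ys) 0 ≤ y
insertDesc-head x []       x≤ _ = x≤
insertDesc-head x (z ∷ ys) x≤ z≤ with z ≤ᵇ x
... | true  = x≤
... | false = z≤

insertDesc-partition : ∀ x ys → IsPartition ys → IsPartition (insertDesc x ys)
insertDesc-partition x []       p zero    = z≤n
insertDesc-partition x []       p (suc j) = z≤n
insertDesc-partition x (y ∷ ys) p j with y ≤ᵇ x | ≤ᵇ-reflects-≤ y x
... | true | ofʸ y≤x = first j
  where
  first : IsPartition (x ∷ y ∷ ys)
  first zero    = y≤x
  first (suc j) = p j
... | false | ofⁿ y≰x = second j
  where
  second : IsPartition (y ∷ insertDesc x ys)
  second zero    = insertDesc-head x ys (<⇒≤ (≰⇒> y≰x)) (p 0)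
  second (suc j) = insertDesc-partition x ys (p ∘ suc) j

sortDesc-partition : ∀ xs → IsPartition (sortDesc xs)
sortDesc-partition []       j = z≤n
sortDesc-partition (x ∷ xs) = insertDesc-partition x (sortDesc xs) (sortDesc-partition xs)

sum-map≡∑ : ∀ (g : ℕ → ℕ) → g 0 ≡ 0 → ∀ R xs → length xs ≤ R → sum (map g xs) ≡ ∑ R (λ r → g (at xs r))
sum-map≡∑ g g0 R [] _ = sym (∑-zero R (λ _ → g0))
sum-map≡∑ g g0 (suc R) (x ∷ xs) (s≤s le) = trans (cong (g x +_) (sum-map≡∑ g g0 R xs le)) (sym (∑-front R (λ r → g (at (x ∷ xs) r))))

∑-++ : ∀ b a f → ∑ (a + b) f ≡ ∑ b f + ∑ a (λ i → f (i + b))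
∑-++ b zero    f = sym (+-identityʳ _)
∑-++ b (suc a) f = trans (cong (_+ f (a + b)) (∑-++ b a f)) (+-assoc (∑ b f) _ _)

∑-block : ∀ n L f → ∑ (L * n) f ≡ ∑ L (λ r → ∑ n (λ i → f (i + r * n)))
∑-block n zero    f = refl
∑-block n (suc L) f = trans (∑-++ (L * n) n f) (cong (_+ ∑ n (λ i → f (i + L * n))) (∑-block n L f))

∑-swap : ∀ m n (f : ℕ → ℕ → ℕ) → ∑ m (λ r → ∑ n (λ i → f r i)) ≡ ∑ n (λ i → ∑ m (λ r → f r i))
∑-swap zero    n f = sym (∑-zero n (λ _ → refl))
∑-swap (suc m) n f = trans (cong (_+ ∑ n (f m)) (∑-swap m n f)) (sym (∑-+ n _ _))

sum-concat : ∀ (g : ℕ → ℕ) n (ℓ : ℕ → List ℕ) →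
  sum (map g (foldr _++_ [] (tabulate {n = n} (ℓ ∘ toℕ)))) ≡ ∑ n (λ i → sum (map g (ℓ i)))
sum-concat g zero    ℓ = refl
sum-concat g (suc n) ℓ = trans (cong sum (map-++ g (ℓ 0) _)) (trans (sum-++ (map g (ℓ 0)) _)
  (trans (cong (sum (map g (ℓ 0)) +_) (sum-concat g n (ℓ ∘ suc))) (sym (∑-front n (λ i → sum (map g (ℓ i)))))))

extend : ∀ n → (Fin n → List ℕ) → ℕ → List ℕ
extend zero    lam j       = []
extend (suc n) lam zero    = lam Fin.zero
extend (suc n) lam (suc j) = extend n (lam ∘ Fin.suc) j

extend-toℕ : ∀ n lam i → extend n lam (toℕ i) ≡ lam i
extend-toℕ (suc n) lam Fin.zero    = refl
extend-toℕ (suc n) lam (Fin.suc i) = extend-toℕ n (lam ∘ Fin.suc) i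

module Main (n′ : ℕ) (lam mu : Fin (suc n′) → List ℕ) (sk : ∀ i → IsSkewShape (lam i) (mu i)) where
  open Interleaved n′

  private
    ℓ m : ℕ → List ℕ
    ℓ = extend n lam
    m = extend n mu

    at-index : ∀ {j} → j < n → ∃ λ i → toℕ i ≡ j
    at-index lt = Fin.fromℕ< lt , Fin.toℕ-fromℕ< lt

    skℓ : ∀ j → j < n → IsSkewShape (ℓ j) (m j)
    skℓ j lt with at-index lt
    ... | i , refl = subst₂ IsSkewShape (sym (extend-toℕ n lam i)) (sym (extend-toℕ n mu i)) (sk i)

    interleave : (ℕ → List ℕ) → ℕ → ℕ
    interleave f q = at (f (q % n)) (q / n)

    interleave-at : ∀ f {j} r → j < n → interleave f (j + r * n) ≡ at (f j) r
    interleave-at f {j} r lt = cong₂ (λ a b → at (f a) b) (trans ([m+kn]%n≡m%n j r n) (m<n⇒m%n≡m lt))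
      (trans (+-distrib-/-∣ʳ j (divides-refl r)) (cong₂ _+_ (m<n⇒m/n≡0 lt) (m*n/n≡m r n)))

    divide : ∀ q → q ≡ q % n + q / n * n
    divide q = m≡m%n+[m/n]*n q n

    by-row : ∀ f q → interleave f (n + q) ≡ at (f (q % n)) (suc (q / n))
    by-row f q = trans (cong (interleave f) (trans (cong (n +_) (divide q)) (sym (next-row (q % n) (q / n)))))
      (interleave-at f (suc (q / n)) (m%n<n q n))

    L₀ : ℕ
    L₀ = ∑ n (length ∘ ℓ) + ∑ n (length ∘ m)

    -- `L₀` bounds the length of every list, so the interleaved sequences vanish from row `L₀` on.
    B : ℕ
    B = L₀ * n

    term≤ : ∀ k (f : ℕ → ℕ) {j} → j < k → f j ≤ ∑ k f
    term≤ (suc k) f {j} lt with j ≟ k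
    ... | yes refl = m≤n+m (f k) (∑ k f)
    ... | no ne = ≤-trans (term≤ k f (≤∧≢⇒< (≤-pred lt) ne)) (m≤m+n _ _)

    lenℓ : ∀ {j} → j < n → length (ℓ j) ≤ L₀
    lenℓ lt = ≤-trans (term≤ n (length ∘ ℓ) lt) (m≤m+n _ _)
    lenm : ∀ {j} → j < n → length (m j) ≤ L₀
    lenm lt = ≤-trans (term≤ n (length ∘ m) lt) (m≤n+m _ (∑ n (length ∘ ℓ)))

    z w : ℕ → ℕ
    z = interleave ℓ
    w = interleave m

    start : State B z w
    start = record
      { vz = λ q → ≤-trans (≤-reflexive (by-row ℓ q)) (proj₁ (skℓ (q % n) (m%n<n q n)) (q / n))
      ; vw = λ q → ≤-trans (≤-reflexive (by-row m q)) (proj₁ (proj₂ (skℓ (q % n) (m%n<n q n))) (q / n))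
      ; sub = λ q → proj₂ (proj₂ (skℓ (q % n) (m%n<n q n))) (q / n)
      ; supp = λ q le → at-beyond (ℓ (q % n)) (≤-trans (lenℓ (m%n<n q n)) (≮⇒≥ (λ lt → <-irrefl refl (≤-trans (short q lt) le)))) }
      where
      short : ∀ q → q / n < L₀ → q < B
      short q lt = ≤-trans (s≤s (≤-reflexive (divide q))) (≤-trans (+-monoˡ-≤ (q / n * n) (m%n<n q n)) (*-monoˡ-≤ n lt))

    -- One place more than `B`, to make room for the prepended term.
    L : ℕ
    L = suc B

    sorted : Sorted B L z w
    sorted = cases (0 <? n′)
      where
      cases : Dec (0 < n′) → Sorted B L z w
      cases (yes 0<) = sort 0< ≤-refl start
      -- A single shape has no neighbour to be exchanged with; its own rows already form a sorted
      -- sequence.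
      cases (no ¬0<) = record
        { z′ = z ; w′ = w ; state = start ; antiz = anti z (State.vz start) ; antiw = anti w (State.vw start)
        ; sumz = λ _ _ → refl ; sumw = λ _ _ → refl ; more = nonneg-refl (λ _ → refl) }
        where
        anti : ∀ y → (∀ q → y (n + q) ≤ y q) → ∀ q → y (suc q) ≤ y q
        anti y v q = subst (λ k → y (suc k + q) ≤ y q) (n≤0⇒n≡0 (≮⇒≥ ¬0<)) (v q)

    open Sorted sorted

    X Y : List ℕ
    X = unionP (tabulate lam)
    Y = unionP (tabulate mu)

    sums : ∀ (f : Fin n → List ℕ) → (∀ {j} → j < n → length (extend n f j) ≤ L₀) → ∀ (g : ℕ → ℕ) → g 0 ≡ 0 →
      ∑ B (λ q → g (interleave (extend n f) q)) ≡ sum (map g (unionP (tabulate f)))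
    sums f len g g0 = begin
      ∑ B (λ q → g (interleave (extend n f) q))
        ≡⟨ ∑-block n L₀ (λ q → g (interleave (extend n f) q)) ⟩
      ∑ L₀ (λ r → ∑ n (λ i → g (interleave (extend n f) (i + r * n))))
        ≡⟨ ∑-cong L₀ (λ r → ∑-cong< n (λ i lt → cong g (interleave-at (extend n f) r lt))) ⟩
      ∑ L₀ (λ r → ∑ n (λ i → g (at (extend n f i) r)))
        ≡⟨ ∑-swap L₀ n (λ r i → g (at (extend n f i) r)) ⟩
      ∑ n (λ i → ∑ L₀ (λ r → g (at (extend n f i) r)))
        ≡⟨ ∑-cong< n (λ i lt → sym (sum-map≡∑ g g0 L₀ (extend n f i) (len lt))) ⟩
      ∑ n (λ i → sum (map g (extend n f i)))
        ≡⟨ sym (sum-concat g n (extend n f)) ⟩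
      sum (map g (foldr _++_ [] (tabulate {n = n} (extend n f ∘ toℕ))))
        ≡⟨ cong (λ t → sum (map g (foldr _++_ [] t))) (tabulate-cong (extend-toℕ n f)) ⟩
      sum (map g (foldr _++_ [] (tabulate f)))
        ≡⟨ sym (sortDesc-sum g (foldr _++_ [] (tabulate f))) ⟩
      sum (map g (unionP (tabulate f))) ∎
      where open ≡-Reasoning

    -- Sums of `g` over the parts with `g 0 ≡ 0` do not see padding zeros and survive both sorting
    -- procedures. Taking `g` to be `_∸ c` for all `c` recovers a decreasing sequence from these
    -- sums.
    same-parts : ∀ (f : Fin n → List ℕ) (y : ℕ → ℕ) → (∀ {j} → j < n → length (extend n f j) ≤ L₀) →
      (∀ q → y (suc q) ≤ y q) → (∀ q → B ≤ q → y q ≡ 0) →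
      (∀ (g : ℕ → ℕ) → g 0 ≡ 0 → ∑ B (λ q → g (y q)) ≡ ∑ B (λ q → g (interleave (extend n f) q))) →
      ∀ q → y q ≡ at (unionP (tabulate f)) q
    same-parts f y len anti sp sm = S-determines Q (record { anti = anti ; null = λ r le → sp r (≤-trans (m≤m+n B _) le) })
        (record { anti = sortDesc-partition (foldr _++_ [] (tabulate f)) ; null = λ r le → at-beyond U (≤-trans (m≤n+m _ B) le) }) S≡
      where
      U = unionP (tabulate f)
      Q = B + length U
      S≡ : ∀ c → S Q y c ≡ S Q (at U) c
      S≡ c = trans (∑-support Q B {λ r → y r ∸ c} (λ r le → trans (cong (_∸ c) (sp r (≤-trans (m≤m+n B _) le))) (0∸n≡0 c)) (λ r le → trans (cong (_∸ c) (sp r le)) (0∸n≡0 c)))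
        (trans (sm (_∸ c) (0∸n≡0 c)) (trans (sums f len (_∸ c) (0∸n≡0 c)) (sum-map≡∑ (_∸ c) (0∸n≡0 c) Q U (m≤n+m _ B))))

    z≡ : ∀ q → z′ q ≡ at X q
    z≡ = same-parts lam z′ lenℓ antiz (State.supp state) sumz
    w≡ : ∀ q → w′ q ≡ at Y q
    w≡ = same-parts mu w′ lenm antiw (State.supp′ state) sumw

    subseq-at : ∀ (i : Fin n) xs k → at (subseq n i xs) k ≡ at xs (toℕ i + k * n)
    subseq-at i xs k = trans (cong (λ v → at v k) (map-upTo (λ k → at xs (toℕ i + k * n)) (length xs)))
      (at-row-null (length xs) (λ k → at xs (toℕ i + k * n)) (λ k le → at-beyond xs (far {j = toℕ i} le)) k)

    target : P L z′ w′ ≗ₚ prodFin n (λ i → skewSchur (subseq n i X) (subseq n i Y))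
    target α = trans (sym (cong (λ f → f α) (prodFin≡prodℕ n (factor L z′ w′)))) (prodFin-cong n (λ i →
      skewSchur-≈ {col L z′ (toℕ i)} {col L w′ (toℕ i)} {subseq n i X} {subseq n i Y} (col-skew state (n≤1+n B) (toℕ i))
        (λ k → trans (at-col {j = toℕ i} (n≤1+n B) (State.supp state) k) (trans (z≡ _) (sym (subseq-at i X k))))
        (λ k → trans (at-col {j = toℕ i} (n≤1+n B) (State.supp′ state) k) (trans (w≡ _) (sym (subseq-at i Y k))))) α)

    source : P L z w ≗ₚ prodFin n (λ i → skewSchur (lam i) (mu i))
    source α = trans (sym (cong (λ f → f α) (prodFin≡prodℕ n (factor L z w)))) (prodFin-cong n (λ i →
      skewSchur-≈ {col L z (toℕ i)} {col L w (toℕ i)} {lam i} {mu i} (col-skew start (n≤1+n B) (toℕ i))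
        (λ k → trans (at-col {j = toℕ i} (n≤1+n B) (State.supp start) k) (trans (interleave-at ℓ k (Fin.toℕ<n i)) (cong (λ v → at v k) (extend-toℕ n lam i))))
        (λ k → trans (at-col {j = toℕ i} (n≤1+n B) (State.supp′ start) k) (trans (interleave-at m k (Fin.toℕ<n i)) (cong (λ v → at v k) (extend-toℕ n mu i))))) α)

  theorem : SchurNonnegDiff (prodFin n (λ i → skewSchur (subseq n i X) (subseq n i Y))) (prodFin n (λ i → skewSchur (lam i) (mu i)))
  theorem = nonneg-cong target source more

theorem4p3 : (n : ℕ) (lam mu : Fin n → List ℕ) →
    (∀ i → IsSkewShape (lam i) (mu i)) →
    SchurNonnegDiff
    (prodFin n (λ i → skewSchur (subseq n i (unionP (tabulate lam))) (subseq n i (unionP (tabulate mu)))))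
    (prodFin n (λ i → skewSchur (lam i) (mu i)))
theorem4p3 zero     lam mu sk = nonneg-refl (λ _ → refl)
theorem4p3 (suc n′) lam mu sk = Main.theorem n′ lam mu sk
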